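{- For any $\varepsilon>0$, there exists a $(1-\varepsilon)$-approximation algorithm for the problem $BN^{\max}$ with running time $O\!\left(\frac{nN^3}{\varepsilon^2}\right)$. That is, given any instance of $BN^{\max}$ that has a feasible solution, the algorithm outputs a feasible solution (no constraint is violated) whose total value is at least $(1-\varepsilon)$ times the maximum total value of a feasible solution, within the stated running time.
   Context: Items are partitioned into $m$ categories; $V_i$ is the set of items of category $i\in[m]=\{1,\dots,m\}$. Item $j\in V_i$ has a non-negative weight $w_j^{(i)}$ and a non-negative value $v_j^{(i)}$ (rational numbers). $n=\max_{i\in[m]}|V_i|$ and $N=\sum_{i}|V_i|$ is the total number of items, so $N\le nm$. Problem $BN^{\max}$: given the items, integers $0\le l_i^n\le u_i^n$ for each $i\in[m]$, and a knapsack capacity $B$, find a subset $S\subseteq\bigcup_i V_i$ maximizing the total value $\sum_{i}\sum_{j\in S\cap V_i}v_j^{(i)}$ subject to $l_i^n\le|S\cap V_i|\le u_i^n$ for all $i\in[m]$ and $\sum_i\sum_{j\in S\cap V_i}w_j^{(i)}\le B$. A feasible solution is a subset satisfying all these constraints. Running time counts elementary operations (arithmetic, comparison, rounding) on numbers, each at unit cost.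
   Formalization: For ε > 1 the running time is bounded by O(nN³), since nN³/ε² would drop below a single step as ε grows, and the time bound is claimed only for N ≥ 1 because it is 0 for N = 0; ε is rational, which is equivalent up to the constant. -}

module Defs where

open import Data.Bool.Base using (Bool; true; false; if_then_else_; not; _∧_)
open import Data.Fin.Base using (Fin; toℕ; fromℕ<)
import Data.Fin.Properties as Fin
open import Data.Fin.Subset using (Subset; _∩_; ∣_∣)
import Data.Integer.Base as ℤ
open import Data.List.Base using (map; allFin)
open import Data.List.Extrema.Nat using (max)
open import Data.Nat.Base as ℕ using (ℕ; zero; suc)
import Data.Nat.Properties as ℕ
open import Data.Product.Base using (_×_)
open import Data.Rational.Base as ℚ using (ℚ; 0ℚ; 1ℚ)
import Data.Rational.Properties as ℚ
open import Data.Vec.Base using (lookup; tabulate)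
open import Relation.Binary.PropositionalEquality using (_≡_)
open import Relation.Nullary.Decidable using (does; yes; no)

open import Algebra.Properties.CommutativeMonoid.Sum ℚ.+-0-commutativeMonoid
  using (sum-syntax)

fromℕ : ℕ → ℚ
fromℕ k = ℤ.+ k ℚ./ 1

------------------------------------------------------------------------
-- The problem BN^max

-- The N items are numbered globally and `category` is the partition map, so
-- that V_i is the fibre of `category` over i.  Fibres may be empty.
record Instance : Set where
  field
    m N              : ℕ
    category         : Fin N → Fin m
    weight value     : Fin N → ℚ
    weight-nonNeg    : ∀ j → 0ℚ ℚ.≤ weight j
    value-nonNeg     : ∀ j → 0ℚ ℚ.≤ value j
    lower upper      : Fin m → ℕ
    lower≤upper      : ∀ i → lower i ℕ.≤ upper i
    capacity         : ℚ

  V : Fin m → Subset N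
  V i = tabulate λ j → does (category j Fin.≟ i)

  n : ℕ
  n = max 0 (map (λ i → ∣ V i ∣) (allFin m))

  -- Σ_i Σ_{j ∈ S ∩ V_i} f j
  total : (Fin N → ℚ) → Subset N → ℚ
  total f S =
    ∑[ i < m ] ∑[ j < N ] (if lookup (S ∩ V i) j then f j else 0ℚ)

  totalValue totalWeight : Subset N → ℚ
  totalValue  = total value
  totalWeight = total weight

  Feasible : Subset N → Set
  Feasible S =
    (∀ i → lower i ℕ.≤ ∣ S ∩ V i ∣ × ∣ S ∩ V i ∣ ℕ.≤ upper i) ×
    totalWeight S ℚ.≤ capacity

  Optimal : Subset N → Set
  Optimal S = Feasible S × (∀ T → Feasible T → totalValue T ℚ.≤ totalValue S)

  Approximate : ℚ → Subset N → Set
  Approximate ε S =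
    Feasible S ×
    (∀ T → Optimal T → (1ℚ ℚ.- ε) ℚ.* totalValue T ℚ.≤ totalValue S)

------------------------------------------------------------------------
-- The model of computation: while-programs over a random-access memory whose
-- cells hold natural numbers, rational numbers or booleans.  Besides the
-- arithmetic operations, comparisons and rounding, every literal, logical
-- connective, memory access, assignment and branch is also charged one unit.

data Sort : Set where
  nat rat bool : Sort

Val : Sort → Set
Val nat  = ℕ
Val rat  = ℚ
Val bool = Bool

-- For each sort there are countably many arrays, each with countably many
-- cells; `read σ s a k` is the contents of cell k of array a.
record Memory : Set where
  constructor memory
  field
    nats  : ℕ → ℕ → ℕ
    rats  : ℕ → ℕ → ℚ
    bools : ℕ → ℕ → Bool

open Memory

read : Memory → (s : Sort) → ℕ → ℕ → Val s
read σ nat  = nats σ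
read σ rat  = rats σ
read σ bool = bools σ

update : {A : Set} → (ℕ → ℕ → A) → ℕ → ℕ → A → (ℕ → ℕ → A)
update f a k x b l = if does (a ℕ.≟ b) ∧ does (k ℕ.≟ l) then x else f b l

write : Memory → (s : Sort) → ℕ → ℕ → Val s → Memory
write σ nat  a k x = record σ { nats  = update (nats σ) a k x }
write σ rat  a k x = record σ { rats  = update (rats σ) a k x }
write σ bool a k x = record σ { bools = update (bools σ) a k x }

data Op₁ : Sort → Sort → Set where
  notᵒ   : Op₁ bool bool
  toRat  : Op₁ nat rat
  floorᵒ : Op₁ rat nat

data Op₂ : Sort → Sort → Sort → Set where
  andᵒ            : Op₂ bool bool bool
  addᴺ subᴺ mulᴺ  : Op₂ nat nat nat
  leqᴺ            : Op₂ nat nat bool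
  addᴿ subᴿ mulᴿ  : Op₂ rat rat rat
  divᴿ            : Op₂ rat rat rat
  leqᴿ            : Op₂ rat rat bool

-- Division, made total by p / 0 = 0.
_÷₀_ : ℚ → ℚ → ℚ
p ÷₀ q with q ℚ.≟ 0ℚ
... | yes _   = 0ℚ
... | no  q≢0 = ℚ._÷_ p q {{ℚ.≢-nonZero q≢0}}

-- Negative numbers are rounded to 0.
⟦_⟧₁ : ∀ {r s} → Op₁ r s → Val r → Val s
⟦ notᵒ   ⟧₁ b = not b
⟦ toRat  ⟧₁ k = fromℕ k
⟦ floorᵒ ⟧₁ p = ℤ.∣ ℚ.floor (0ℚ ℚ.⊔ p) ∣

⟦_⟧₂ : ∀ {r s u} → Op₂ r s u → Val r → Val s → Val u
⟦ andᵒ ⟧₂ b c = b ∧ c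
⟦ addᴺ ⟧₂ k l = k ℕ.+ l
⟦ subᴺ ⟧₂ k l = k ℕ.∸ l
⟦ mulᴺ ⟧₂ k l = k ℕ.* l
⟦ leqᴺ ⟧₂ k l = does (k ℕ.≤? l)
⟦ addᴿ ⟧₂ p q = p ℚ.+ q
⟦ subᴿ ⟧₂ p q = p ℚ.- q
⟦ mulᴿ ⟧₂ p q = p ℚ.* q
⟦ divᴿ ⟧₂ p q = p ÷₀ q
⟦ leqᴿ ⟧₂ p q = does (p ℚ.≤? q)

-- Array names are fixed in the program text; only cell indices are computed.
data Exp : Sort → Set where
  lit : ∀ {s} → Val s → Exp s
  get : (s : Sort) → ℕ → Exp nat → Exp s
  op₁ : ∀ {r s} → Op₁ r s → Exp r → Exp s
  op₂ : ∀ {r s u} → Op₂ r s u → Exp r → Exp s → Exp u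

eval : ∀ {s} → Exp s → Memory → Val s
eval (lit x)     σ = x
eval (get s a e) σ = read σ s a (eval e σ)
eval (op₁ o e)   σ = ⟦ o ⟧₁ (eval e σ)
eval (op₂ o e f) σ = ⟦ o ⟧₂ (eval e σ) (eval f σ)

cost : ∀ {s} → Exp s → ℕ
cost (lit x)     = 1
cost (get s a e) = suc (cost e)
cost (op₁ o e)   = suc (cost e)
cost (op₂ o e f) = suc (cost e ℕ.+ cost f)

infixr 4 _⨾_

data Program : Set where
  skip  : Program
  put   : (s : Sort) → ℕ → Exp nat → Exp s → Program
  _⨾_   : Program → Program → Program
  if    : Exp bool → Program → Program → Program
  while : Exp bool → Program → Program

-- ⟨ P , σ ⟩⇓⟨ τ , t ⟩: started in σ, P halts in τ after t elementary steps.
data ⟨_,_⟩⇓⟨_,_⟩ : Program → Memory → Memory → ℕ → Set where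

  skip : ∀ {σ} → ⟨ skip , σ ⟩⇓⟨ σ , 1 ⟩

  put : ∀ {s a e f σ} →
    ⟨ put s a e f , σ ⟩⇓⟨ write σ s a (eval e σ) (eval f σ)
                        , suc (cost e ℕ.+ cost f) ⟩

  seq : ∀ {P Q σ τ υ t t′} →
    ⟨ P , σ ⟩⇓⟨ τ , t ⟩ → ⟨ Q , τ ⟩⇓⟨ υ , t′ ⟩ →
    ⟨ P ⨾ Q , σ ⟩⇓⟨ υ , t ℕ.+ t′ ⟩

  if-true : ∀ {b P Q σ τ t} →
    eval b σ ≡ true → ⟨ P , σ ⟩⇓⟨ τ , t ⟩ →
    ⟨ if b P Q , σ ⟩⇓⟨ τ , suc (cost b ℕ.+ t) ⟩

  if-false : ∀ {b P Q σ τ t} →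
    eval b σ ≡ false → ⟨ Q , σ ⟩⇓⟨ τ , t ⟩ →
    ⟨ if b P Q , σ ⟩⇓⟨ τ , suc (cost b ℕ.+ t) ⟩

  while-true : ∀ {b P σ τ υ t t′} →
    eval b σ ≡ true → ⟨ P , σ ⟩⇓⟨ τ , t ⟩ → ⟨ while b P , τ ⟩⇓⟨ υ , t′ ⟩ →
    ⟨ while b P , σ ⟩⇓⟨ υ , suc (cost b ℕ.+ (t ℕ.+ t′)) ⟩

  while-false : ∀ {b P σ} →
    eval b σ ≡ false →
    ⟨ while b P , σ ⟩⇓⟨ σ , suc (cost b) ⟩

------------------------------------------------------------------------
-- Input and output conventions

-- The array listing f 0, …, f (k - 1), continued by the default d.
array : {A : Set} → A → ∀ {k} → (Fin k → A) → ℕ → A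
array d {k} f l with l ℕ.<? k
... | yes l<k = f (fromℕ< l<k)
... | no  _   = d

module _ (I : Instance) where
  open Instance I

  -- natural arrays   0: N, m    1: categories    2: lower    3: upper bounds
  -- rational arrays  0: capacity    1: weights    2: values
  -- All other cells initially hold 0 or false.
  input : Memory
  input = memory inputNats inputRats (λ _ _ → false)
    where
    inputNats : ℕ → ℕ → ℕ
    inputNats 0 0 = N
    inputNats 0 1 = m
    inputNats 1 = array 0 λ j → toℕ (category j)
    inputNats 2 = array 0 lower
    inputNats 3 = array 0 upper
    inputNats _ = λ _ → 0

    inputRats : ℕ → ℕ → ℚ
    inputRats 0 0 = capacity
    inputRats 1 = array 0ℚ weight
    inputRats 2 = array 0ℚ value
    inputRats _ = λ _ → 0ℚ

  -- The selected items are marked in boolean array 0.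
  output : Memory → Subset N
  output σ = tabulate λ j → read σ bool 0 (toℕ j)

  -- t ≤ c · n N³ / ε², with the denominator cleared.  For ε > 1 the bound is
  -- the one for ε = 1, since n N³ / ε² would drop below any positive running
  -- time as ε → ∞.
  WithinTime : ℕ → ℚ → ℕ → Set
  WithinTime c ε t =
    fromℕ t ℚ.* (δ ℚ.* δ) ℚ.≤ fromℕ (c ℕ.* (n ℕ.* N ℕ.^ 3))
    where
    δ : ℚ
    δ = 1ℚ ℚ.⊓ ε

{-# OPTIONS --safe #-}

-- Let v be the largest value of an item that lies in some feasible set, and
-- δ = min(1, ε).  No feasible set uses an item of value above v, and an optimal
-- set is worth at least v.  So if the values are rounded down to multiples of
-- δ v / N, then a feasible set of maximum rounded value loses at most
-- N · δ v / N = δ v ≤ δ · OPT, and the rounded values are integers p_j ≤ N / δ.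
--
-- Maximising an integral profit p is a dynamic program that treats the
-- categories one after the other and tabulates the least weight for every
-- profit and every number of items chosen in the current category, with
-- O(n Σ p) cells.  Every item is inserted once, which takes O(n N Σ p) steps.
-- For the rounded values Σ p ≤ N² / δ, hence O(n N³ / δ).  The value v is found by
-- N runs of the same program, with the indicator of one item as the profit.
module Submission where

open import Data.Nat.Base using (ℕ; _≤_)
open import Data.Product.Base using (Σ; ∃; ∃-syntax; _×_)
open import Data.Rational.Base using (ℚ; 0ℚ; _<_)
open import Defs

open import Algebra.Bundles using (CommutativeMonoid)
import Algebra.Properties.CommutativeMonoid.Sum as FinSum
import Algebra.Properties.CommutativeSemigroup as CS
open import Data.Bool.Base using (Bool; true; false; if_then_else_; not; _∧_; _∨_)
import Data.Bool.Properties as Bool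
open import Data.Fin.Base using (Fin; toℕ; fromℕ<)
import Data.Fin.Properties as Fin
open import Data.Fin.Subset using (Subset; _∩_; ∣_∣)
import Data.Integer.Base as ℤ
import Data.Integer.Properties as ℤ
open import Data.List.Base using (map; allFin)
open import Data.List.Extrema.Nat using (xs≤max)
open import Data.List.Membership.Propositional.Properties using (∈-map⁺; ∈-allFin)
import Data.List.Relation.Unary.All as All
open import Data.Nat.Base as ℕ using (zero; suc; _+_; _*_; _∸_; _^_; z≤n; s≤s; _≡ᵇ_)
import Data.Nat.Coprimality as Coprimality
import Data.Nat.DivMod as ℕ
import Data.Nat.Properties as ℕ
open import Data.Nat.Tactic.RingSolver using (solve-∀)
open import Data.Product.Base using (_,_; proj₁; proj₂)
open import Data.Rational.Base as ℚ using (1ℚ; mkℚ)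
import Data.Rational.Properties as ℚ
open import Data.Rational.Solver using (module +-*-Solver)
open import Data.Sum.Base as Sum using (_⊎_; inj₁; inj₂)
open import Data.Unit.Base using (⊤; tt)
open import Data.Vec.Base using ([]; _∷_; lookup; tabulate)
import Data.Vec.Properties as Vec
open import Function.Base using (id; _∘_; _$_)
open import Level using (0ℓ)
open import Relation.Binary.PropositionalEquality
  using (_≡_; _≢_; refl; sym; trans; cong; cong₂; subst; subst₂)
open import Relation.Nullary.Decidable using (Dec; does; yes; no; dec-false; from-yes)
open import Relation.Nullary.Negation using (¬_; contradiction)
open Memory

-- Total correctness with a bound on the running time

-- The bound does not mention the number `m` of categories, so no loop runs over categories: they
-- are met as categories of items, a flag array marks those already treated, and the bounds of a
-- category without items are vouched for by the feasible set assumed to exist. Cardinality bounds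
-- make the profit alone too poor a state. The second coordinate, the number of items of the current
-- category, is forgotten when that category is closed and so takes at most `n` + 1 values. Both are
-- packed into one index, profit + `D` · count with `D` above the sum of all profits: inserting an
-- item is a shift by a fixed amount, the bounds cut out an interval of indices, and forgetting the
-- count is reduction modulo `D`. A cell must also yield its set. Copying a set item by item would
-- cost a factor `N`, hence a set is one binary number, copied at unit cost and decoded greedily at
-- the end. Categories are charged by a potential argument: each item is inserted once per run,
-- although the nested loops alone would suggest N² insertions. The time so obtained contains 1/δ
-- only to the first power; δ ≤ 1 turns it into the stated bound.

Run : Program → Memory → ℕ → (Memory → Set) → Set
Run P σ t Q = ∃[ τ ] ∃[ t′ ] (⟨ P , σ ⟩⇓⟨ τ , t′ ⟩ × t′ ≤ t × Q τ)

run-mono : ∀ {P σ t u} {Q R : Memory → Set} →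
  t ≤ u → (∀ τ → Q τ → R τ) → Run P σ t Q → Run P σ u R
run-mono t≤u Q⇒R (τ , _ , d , t′≤t , q) = τ , _ , d , ℕ.≤-trans t′≤t t≤u , Q⇒R τ q

run-seq : ∀ {P P′ σ t u} {Q : Memory → Set} →
  Run P σ t (λ τ → Run P′ τ u Q) → Run (P ⨾ P′) σ (t + u) Q
run-seq (_ , _ , d , t≤ , (υ , _ , d′ , u≤ , q)) =
  υ , _ , seq d d′ , ℕ.+-mono-≤ t≤ u≤ , q

run-if : ∀ {b P P′ σ t} {Q : Memory → Set} →
  (eval b σ ≡ true → Run P σ t Q) → (eval b σ ≡ false → Run P′ σ t Q) →
  Run (if b P P′) σ (suc (cost b + t)) Q
run-if {b} {σ = σ} yes-run no-run with eval b σ in eq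
... | true  = let τ , _ , d , t≤ , q = yes-run refl in
  τ , _ , if-true eq d , s≤s (ℕ.+-monoʳ-≤ (cost b) t≤) , q
... | false = let τ , _ , d , t≤ , q = no-run refl in
  τ , _ , if-false eq d , s≤s (ℕ.+-monoʳ-≤ (cost b) t≤) , q

-- Frame conditions decided on the program text

sameSort : Sort → Sort → Bool
sameSort nat  nat  = true
sameSort rat  rat  = true
sameSort bool bool = true
sameSort _    _    = false

-- Computable because array names are fixed in the program text and only cell indices are evaluated;
-- frame conditions of concrete programs are then settled by `refl`.
writes : Sort → ℕ → Program → Bool
writes s a skip          = false
writes s a (put r b _ _) = sameSort r s ∧ (b ≡ᵇ a)
writes s a (P ⨾ P′)      = writes s a P ∨ writes s a P′
writes s a (if _ P P′)   = writes s a P ∨ writes s a P′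
writes s a (while _ P)   = writes s a P

Frame : Program → Memory → Memory → Set
Frame P σ τ = ∀ s a → writes s a P ≡ false → ∀ k → read τ s a k ≡ read σ s a k

∨-falseˡ : ∀ b c → b ∨ c ≡ false → b ≡ false
∨-falseˡ false _ _ = refl

∨-falseʳ : ∀ b c → b ∨ c ≡ false → c ≡ false
∨-falseʳ false _ eq = eq

frame-put : ∀ r b k x σ s a → sameSort r s ∧ (b ≡ᵇ a) ≡ false →
  ∀ l → read (write σ r b k x) s a l ≡ read σ s a l
frame-put nat  b k x σ nat  a eq l rewrite eq = refl
frame-put rat  b k x σ rat  a eq l rewrite eq = refl
frame-put bool b k x σ bool a eq l rewrite eq = refl
frame-put nat  b k x σ rat  a eq l = refl
frame-put nat  b k x σ bool a eq l = refl
frame-put rat  b k x σ nat  a eq l = refl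
frame-put rat  b k x σ bool a eq l = refl
frame-put bool b k x σ nat  a eq l = refl
frame-put bool b k x σ rat  a eq l = refl

frame : ∀ {P σ τ t} → ⟨ P , σ ⟩⇓⟨ τ , t ⟩ → Frame P σ τ
frame skip s a eq k = refl
frame (put {r} {b} {e} {f} {σ}) s a eq k = frame-put r b (eval e σ) (eval f σ) σ s a eq k
frame (seq {P} d d′) s a eq k =
  trans (frame d′ s a (∨-falseʳ (writes s a P) _ eq) k)
        (frame d s a (∨-falseˡ _ _ eq) k)
frame (if-true _ d) s a eq k = frame d s a (∨-falseˡ _ _ eq) k
frame (if-false {P = P} _ d) s a eq k = frame d s a (∨-falseʳ (writes s a P) _ eq) k
frame (while-true _ d d′) s a eq k = trans (frame d′ s a eq k) (frame d s a eq k)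
frame (while-false _) s a eq k = refl

run-frame : ∀ {P σ t} {Q : Memory → Set} →
  Run P σ t Q → Run P σ t (λ τ → Frame P σ τ × Q τ)
run-frame (τ , _ , d , t≤ , q) = τ , _ , d , t≤ , frame d , q

-- The continuation also receives the frame of `P`, so facts about untouched arrays need not be
-- threaded through `Q`.
run-bind : ∀ {P P′ σ t u} {Q R : Memory → Set} → Run P σ t Q →
  (∀ τ → Frame P σ τ → Q τ → Run P′ τ u R) → Run (P ⨾ P′) σ (t + u) R
run-bind (τ , _ , d , t≤ , q) next =
  let υ , _ , d′ , u≤ , r = next τ (frame d) q
  in υ , _ , seq d d′ , ℕ.+-mono-≤ t≤ u≤ , r

-- Symbolic execution of loop-free programs

loopFree : Program → Bool
loopFree skip        = true
loopFree (put _ _ _ _) = true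
loopFree (P ⨾ P′)    = loopFree P ∧ loopFree P′
loopFree (if _ P P′) = loopFree P ∧ loopFree P′
loopFree (while _ _) = false

-- Junk values on programs with loops, also for `worstCase`.
step : Program → Memory → Memory
step skip          σ = σ
step (put s a e f) σ = write σ s a (eval e σ) (eval f σ)
step (P ⨾ P′)      σ = step P′ (step P σ)
step (if b P P′)   σ = if eval b σ then step P σ else step P′ σ
step (while _ _)   σ = σ

-- The costs of both branches are added: crude, but the bound stays a closed numeral with no maximum
-- to reason about.
worstCase : Program → ℕ
worstCase skip          = 1
worstCase (put s a e f) = suc (cost e + cost f)
worstCase (P ⨾ P′)      = worstCase P + worstCase P′
worstCase (if b P P′)   = suc (cost b + (worstCase P + worstCase P′))
worstCase (while _ _)   = 0

∧-trueˡ : ∀ b c → b ∧ c ≡ true → b ≡ true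
∧-trueˡ true _ _ = refl

∧-trueʳ : ∀ b c → b ∧ c ≡ true → c ≡ true
∧-trueʳ true _ eq = eq

run-loopFree : ∀ P {σ} → loopFree P ≡ true → Run P σ (worstCase P) (_≡ step P σ)
run-loopFree skip _ = _ , _ , skip , ℕ.≤-refl , refl
run-loopFree (put s a e f) _ = _ , _ , put , ℕ.≤-refl , refl
run-loopFree (P ⨾ P′) lf
  with _ , _ , d , t≤ , refl ← run-loopFree P (∧-trueˡ _ _ lf)
  with _ , _ , d′ , t≤′ , refl ← run-loopFree P′ (∧-trueʳ (loopFree P) _ lf)
  = _ , _ , seq d d′ , ℕ.+-mono-≤ t≤ t≤′ , refl
run-loopFree (if b P P′) {σ} lf with eval b σ in eq
... | true  with _ , _ , d , t≤ , refl ← run-loopFree P {σ} (∧-trueˡ _ _ lf)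
  = _ , _ , if-true eq d , s≤s (ℕ.+-monoʳ-≤ (cost b) (ℕ.≤-trans t≤ (ℕ.m≤m+n _ _))) , refl
... | false with _ , _ , d , t≤ , refl ← run-loopFree P′ {σ} (∧-trueʳ (loopFree P) _ lf)
  = _ , _ , if-false eq d , s≤s (ℕ.+-monoʳ-≤ (cost b) (ℕ.≤-trans t≤ (ℕ.m≤n+m _ _))) , refl

run-step : ∀ P {σ} {Q : Memory → Set} → loopFree P ≡ true →
  Q (step P σ) → Run P σ (worstCase P) Q
run-step P {Q = Q} lf q = run-mono ℕ.≤-refl (λ _ eq → subst Q (sym eq) q) (run-loopFree P lf)

if-elim : ∀ {A : Set} (Q : A → Set) (b : Bool) {x y : A} →
  (b ≡ true → Q x) → (b ≡ false → Q y) → Q (if b then x else y)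
if-elim Q true  t f = t refl
if-elim Q false t f = f refl

bool-elim : (Q : Bool → Set) (b : Bool) → (b ≡ true → Q true) → (b ≡ false → Q false) → Q b
bool-elim Q true  t f = t refl
bool-elim Q false t f = f refl

does-true : ∀ {A : Set} (a? : Dec A) → does a? ≡ true → A
does-true (yes a) _ = a

does-false : ∀ {A : Set} (a? : Dec A) → does a? ≡ false → ¬ A
does-false (no ¬a) _ = ¬a

-- Loops that count down

var : ℕ → Exp nat
var x = get nat x (lit 0)

infix 5 _≔_
_≔_ : ℕ → Exp nat → Program
x ≔ e = put nat x (lit 0) e

-- The loop variable runs through e - 1, …, 1, 0.
for : ℕ → Exp nat → Program → Program
for x e P =
  x ≔ e ⨾ while (op₂ leqᴺ (lit 1) (var x)) (x ≔ op₂ subᴺ (var x) (lit 1) ⨾ P)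

≡ᵇ-refl : ∀ n → (n ≡ᵇ n) ≡ true
≡ᵇ-refl zero    = refl
≡ᵇ-refl (suc n) = ≡ᵇ-refl n

≢⇒≡ᵇ-false : ∀ m n → m ≢ n → (m ≡ᵇ n) ≡ false
≢⇒≡ᵇ-false m n m≢n = dec-false (m ℕ.≟ n) m≢n

≡ᵇ⇒≡ : ∀ {m n} → (m ≡ᵇ n) ≡ true → m ≡ n
≡ᵇ⇒≡ {m} {n} = does-true (m ℕ.≟ n)

update-self : ∀ {A : Set} (f : ℕ → ℕ → A) a k {x} → update f a k x a k ≡ x
update-self f a k rewrite ≡ᵇ-refl a | ≡ᵇ-refl k = refl

-- The ghost state g records what the invariant says about the memory at the
-- current iteration, and Φ is the potential that pays for the iterations.
run-for : ∀ {G : Set} (x : ℕ) (e : Exp nat) (P : Program)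
  (Inv : ℕ → G → Memory → Set) (Φ : ℕ → G → ℕ) {σ n g} →
  writes nat x P ≡ false →
  (∀ i g σ k → Inv i g σ → Inv i g (write σ nat x 0 k)) →
  (∀ i g τ → i ℕ.< n → nats τ x 0 ≡ i → Frame (for x e P) σ τ → Inv (suc i) g τ →
    ∃[ g′ ] ∃[ t ] (Run P τ t (Inv i g′) × 11 + t + Φ i g′ ≤ Φ (suc i) g)) →
  eval e σ ≡ n → Inv n g σ →
  Run (for x e P) σ (suc (suc (cost e)) + (Φ n g + 5)) (λ τ → ∃[ g′ ] Inv 0 g′ τ)
run-for {G} x e P Inv Φ {σ} {n} fresh stable body eval-e inv =
  run-seq (_ , _ , put , ℕ.≤-refl ,
    iterate n ℕ.≤-refl (trans (update-self (nats σ) x 0) eval-e)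
      (λ s a eq → frame (put {nat} {x} {lit 0} {e}) s a (∨-falseˡ _ _ eq))
      (stable _ _ σ _ inv))
  where
  decrement : Program
  decrement = x ≔ op₂ subᴺ (var x) (lit 1)

  iterate : ∀ i {g τ} → i ≤ n → nats τ x 0 ≡ i → Frame (for x e P) σ τ → Inv i g τ →
    Run (while (op₂ leqᴺ (lit 1) (var x)) (decrement ⨾ P)) τ
        (Φ i g + 5) (λ τ → ∃[ g′ ] Inv 0 g′ τ)
  iterate zero {g} {τ} _ x≡ _ inv =
    τ , _ , while-false (cong (λ i → does (1 ℕ.≤? i)) x≡) , ℕ.m≤n+m 5 (Φ 0 g) , _ , inv
  iterate (suc i) {g} {τ} i<n x≡ fr inv
    with g′ , t , (υ , t₁ , d , t₁≤t , inv′) , pot ←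
      body i g (step decrement τ) i<n (trans (update-self (nats τ) x 0) (cong (_∸ 1) x≡))
        (λ s a eq k → trans (frame (put {nat} {x} {lit 0} {op₂ subᴺ (var x) (lit 1)}) s a (∨-falseˡ _ _ eq) k) (fr s a eq k))
        (stable _ _ τ _ inv)
    with ω , t₂ , d′ , t₂≤ , done ← iterate i {g′} {υ} (ℕ.<⇒≤ i<n)
      (trans (frame d nat x fresh 0) (trans (update-self (nats τ) x 0) (cong (_∸ 1) x≡)))
      (λ s a eq k → trans
        (frame (seq (put {nat} {x} {lit 0} {op₂ subᴺ (var x) (lit 1)}) d) s a
          (∨-falseʳ (writes s a (x ≔ e)) _ eq) k)
        (fr s a eq k))
      inv′
    = ω , _ , while-true (cong (λ i → does (1 ℕ.≤? i)) x≡) (seq put d) d′ , bound , done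
    where
    open ℕ.≤-Reasoning
    -- An iteration spends 5 steps on the successful test and 6 on the decrement, hence 11; the
    -- extra 5 is the final failing test.
    bound : 11 + (t₁ + t₂) ≤ Φ (suc i) g + 5
    bound = begin
      11 + (t₁ + t₂)             ≤⟨ ℕ.+-monoʳ-≤ 11 (ℕ.+-mono-≤ t₁≤t t₂≤) ⟩
      11 + (t + (Φ i g′ + 5))    ≡⟨ cong (11 +_) (ℕ.+-assoc t _ 5) ⟨
      11 + t + Φ i g′ + 5        ≤⟨ ℕ.+-monoˡ-≤ 5 pot ⟩
      Φ (suc i) g + 5            ∎

run-for-uniform : ∀ (x : ℕ) (e : Exp nat) (P : Program)
  (Inv : ℕ → Memory → Set) {σ n t} →
  writes nat x P ≡ false →
  (∀ i σ k → Inv i σ → Inv i (write σ nat x 0 k)) →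
  (∀ i τ → i ℕ.< n → nats τ x 0 ≡ i → Frame (for x e P) σ τ → Inv (suc i) τ →
    Run P τ t (Inv i)) →
  eval e σ ≡ n → Inv n σ →
  Run (for x e P) σ (suc (suc (cost e)) + (n * (11 + t) + 5)) (Inv 0)
run-for-uniform x e P Inv {σ} {n} {t} fresh stable body eval-e inv =
  run-mono ℕ.≤-refl (λ _ → proj₂) $
  run-for {⊤} x e P (λ i _ → Inv i) (λ i _ → i * (11 + t)) {σ} {n} {tt} fresh
    (λ i _ → stable i)
    (λ i _ τ i<n x≡ fr inv → tt , t , body i τ i<n x≡ fr inv , ℕ.≤-refl)
    eval-e inv

-- Sums over initial segments and over item sets

ItemSet : Set
ItemSet = ℕ → Bool

-- Generic in the monoid because profits, counts and codes are sums in ℕ, weights and values sums in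
-- ℚ.
module Summation (M : CommutativeMonoid 0ℓ 0ℓ) where
  open CommutativeMonoid M renaming (refl to ≈-refl; sym to ≈-sym; trans to ≈-trans)
  open CS commutativeSemigroup using (x∙yz≈xz∙y; xy∙z≈xz∙y; interchange)
  open FinSum M using (sum; sum-init-last; sum-cong-≗)

  sumBelow : ℕ → (ℕ → Carrier) → Carrier
  sumBelow zero    f = ε
  sumBelow (suc n) f = sumBelow n f ∙ f n

  sumBelow-cong : ∀ n {f g} → (∀ j → j ℕ.< n → f j ≈ g j) → sumBelow n f ≈ sumBelow n g
  sumBelow-cong zero    f≈g = ≈-refl
  sumBelow-cong (suc n) f≈g =
    ∙-cong (sumBelow-cong n λ j j<n → f≈g j (ℕ.m≤n⇒m≤1+n j<n)) (f≈g n ℕ.≤-refl)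

  sumBelow-ε : ∀ n {f} → (∀ j → j ℕ.< n → f j ≈ ε) → sumBelow n f ≈ ε
  sumBelow-ε zero    f≈ε = ≈-refl
  sumBelow-ε (suc n) f≈ε = ≈-trans
    (∙-cong (sumBelow-ε n λ j j<n → f≈ε j (ℕ.m≤n⇒m≤1+n j<n)) (f≈ε n ℕ.≤-refl))
    (identityˡ ε)

  sumBelow-∙ : ∀ n f g → sumBelow n (λ j → f j ∙ g j) ≈ sumBelow n f ∙ sumBelow n g
  sumBelow-∙ zero    f g = ≈-sym (identityˡ ε)
  sumBelow-∙ (suc n) f g = ≈-trans (∙-congʳ (sumBelow-∙ n f g)) (interchange _ _ _ _)

  -- The change at a single point that underlies the insertion of an item, unit profits and
  -- Kronecker deltas alike.
  sumBelow-bump : ∀ n {f g b x} → b ℕ.< n →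
    (∀ j → j ℕ.< n → j ≢ b → g j ≈ f j) → g b ≈ f b ∙ x →
    sumBelow n g ≈ sumBelow n f ∙ x
  sumBelow-bump (suc n) {f} {g} {b} b≤n same bump with b ℕ.≟ n
  ... | yes refl = ≈-trans
    (∙-cong (sumBelow-cong n λ j j<n → same j (ℕ.m≤n⇒m≤1+n j<n) (ℕ.<⇒≢ j<n)) bump)
    (≈-sym (assoc _ _ _))
  ... | no b≢n = ≈-trans
    (∙-cong (sumBelow-bump n (ℕ.≤∧≢⇒< (ℕ.≤-pred b≤n) b≢n)
              (λ j j<n → same j (ℕ.m≤n⇒m≤1+n j<n)) bump)
            (same n ℕ.≤-refl (b≢n ∘ sym)))
    (xy∙z≈xz∙y _ _ _)

  sumBelow-Fin : ∀ {n} {f : Fin n → Carrier} {g : ℕ → Carrier} →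
    (∀ j → f j ≡ g (toℕ j)) → sum f ≈ sumBelow n g
  sumBelow-Fin {zero}  f≡g = ≈-refl
  sumBelow-Fin {suc n} {f} {g} f≡g = ≈-trans (sum-init-last f)
    (∙-cong
      (sumBelow-Fin λ j → trans (f≡g _) (cong g (Fin.toℕ-inject₁ j)))
      (reflexive (trans (f≡g _) (cong g (Fin.toℕ-fromℕ n)))))

  sumOver : ℕ → ItemSet → (ℕ → Carrier) → Carrier
  sumOver n S f = sumBelow n (λ j → if S j then f j else ε)

  sumOver-ε : ∀ n {S} f → (∀ j → j ℕ.< n → S j ≡ true → f j ≈ ε) → sumOver n S f ≈ ε
  sumOver-ε n {S} f f≈ε = sumBelow-ε n λ j j<n →
    if-elim (_≈ ε) (S j) (f≈ε j j<n) (λ _ → ≈-refl)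

  sumOver-insert : ∀ n {S S′ b} f → b ℕ.< n → S b ≡ false → S′ b ≡ true →
    (∀ j → j ℕ.< n → j ≢ b → S′ j ≡ S j) → sumOver n S′ f ≈ sumOver n S f ∙ f b
  sumOver-insert n f b<n b∉S b∈S′ same = sumBelow-bump n b<n
    (λ j j<n j≢b → reflexive (cong (λ b → if b then f j else ε) (same j j<n j≢b)))
    (≈-trans (reflexive (cong (λ c → if c then f _ else ε) b∈S′))
      (≈-trans (≈-sym (identityˡ _))
        (∙-congʳ (reflexive (cong (λ c → if c then f _ else ε) (sym b∉S))))))

module ℕΣ = Summation ℕ.+-0-commutativeMonoid
module ℚΣ = Summation ℚ.+-0-commutativeMonoid

indicator : Bool → ℕ
indicator b = if b then 1 else 0

sumBelow-mono : ∀ n {f g : ℕ → ℕ} → (∀ j → j ℕ.< n → f j ≤ g j) →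
  ℕΣ.sumBelow n f ≤ ℕΣ.sumBelow n g
sumBelow-mono zero    f≤g = z≤n
sumBelow-mono (suc n) f≤g =
  ℕ.+-mono-≤ (sumBelow-mono n λ j j<n → f≤g j (ℕ.m≤n⇒m≤1+n j<n)) (f≤g n ℕ.≤-refl)

sumOver≤sumBelow : ∀ n S (f : ℕ → ℕ) → ℕΣ.sumOver n S f ≤ ℕΣ.sumBelow n f
sumOver≤sumBelow n S f = sumBelow-mono n λ j _ →
  if-elim (_≤ f j) (S j) (λ _ → ℕ.≤-refl) (λ _ → z≤n)

-- The dynamic program over families of item sets

module Knapsack
  (N : ℕ) (cat lo up : ℕ → ℕ) (wt : ℕ → ℚ)
  (wt-nonNeg : ∀ j → j ℕ.< N → 0ℚ ℚ.≤ wt j) (B : ℚ)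
  where

  weightOf : ItemSet → ℚ
  weightOf S = ℚΣ.sumOver N S wt

  code : ItemSet → ℕ
  code S = ℕΣ.sumOver N S (2 ^_)

  belongs : ℕ → ℕ → ℕ
  belongs i j = indicator (cat j ≡ᵇ i)

  count : ItemSet → ℕ → ℕ
  count S i = ℕΣ.sumOver N S (belongs i)

  profit : (ℕ → ℕ) → ItemSet → ℕ
  profit p S = ℕΣ.sumOver N S p

  InBounds : ItemSet → ℕ → Set
  InBounds S i = lo i ≤ count S i × count S i ≤ up i

  -- Ranges over items, not categories, since this is all that the program can check without a loop
  -- over categories. Categories without items are treated in `decode-feasible`.
  Admissible : ItemSet → Set
  Admissible S = ∀ j → j ℕ.< N → InBounds S (cat j)

  Feasible : ItemSet → Set
  Feasible S = Admissible S × weightOf S ℚ.≤ B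

  -- A weight above the capacity stands for the absence of a set.
  record Represents (𝓐 : ItemSet → Set) (w : ℚ) (c : ℕ) : Set where
    field
      attained : w ℚ.≤ B → ∃[ S ] (𝓐 S × weightOf S ≡ w × code S ≡ c)
      minimal  : ∀ S → 𝓐 S → weightOf S ℚ.≤ B → w ℚ.≤ weightOf S

  open Represents public

  represents-⇔ : ∀ {𝓐 𝓑 w c} → (∀ S → 𝓐 S → 𝓑 S) → (∀ S → 𝓑 S → 𝓐 S) →
    Represents 𝓐 w c → Represents 𝓑 w c
  represents-⇔ to from r .attained w≤B =
    let S , a , eqs = attained r w≤B in S , to S a , eqs
  represents-⇔ to from r .minimal S b = minimal r S (from S b)

  represents-empty : ∀ {𝓐 w c} → (∀ S → ¬ 𝓐 S) → B ℚ.< w → Represents 𝓐 w c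
  represents-empty empty B<w .attained w≤B =
    contradiction (ℚ.<-≤-trans B<w w≤B) (ℚ.<-irrefl refl)
  represents-empty empty B<w .minimal S a = contradiction a (empty S)

  -- The minimum over a union is the lesser minimum. The winner supplies the witness and so must lie
  -- in `𝓒`; the loser matters only for the lower bound. Both the insertion of an item and the
  -- merging of counts are instances.
  represents-union : ∀ {𝓐 𝓑 𝓒 w w′ c c′} → w ℚ.≤ w′ →
    Represents 𝓐 w c → Represents 𝓑 w′ c′ →
    (∀ S → 𝓐 S → 𝓒 S) → (∀ S → 𝓒 S → 𝓐 S ⊎ 𝓑 S) → Represents 𝓒 w c
  represents-union w≤w′ r r′ to from .attained w≤B =
    let S , a , eqs = attained r w≤B in S , to S a , eqs
  represents-union w≤w′ r r′ to from .minimal S c S≤B with from S c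
  ... | inj₁ a = minimal r S a S≤B
  ... | inj₂ b = ℚ.≤-trans w≤w′ (minimal r′ S b S≤B)

  record Insertion (b : ℕ) (S S′ : ItemSet) : Set where
    field
      absent  : S b ≡ false
      present : S′ b ≡ true
      same    : ∀ j → j ℕ.< N → j ≢ b → S′ j ≡ S j

  open Insertion

  insertion-sumℕ : ∀ {b S S′} f → b ℕ.< N → Insertion b S S′ →
    ℕΣ.sumOver N S′ f ≡ ℕΣ.sumOver N S f + f b
  insertion-sumℕ f b<N ins = ℕΣ.sumOver-insert N f b<N (absent ins) (present ins) (same ins)

  insertion-sumℚ : ∀ {b S S′} f → b ℕ.< N → Insertion b S S′ →
    ℚΣ.sumOver N S′ f ≡ ℚΣ.sumOver N S f ℚ.+ f b
  insertion-sumℚ f b<N ins = ℚΣ.sumOver-insert N f b<N (absent ins) (present ins) (same ins)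

  insert remove : ℕ → ItemSet → ItemSet
  insert b S j = (j ≡ᵇ b) ∨ S j
  remove b S j = not (j ≡ᵇ b) ∧ S j

  insertion-insert : ∀ {b S} → S b ≡ false → Insertion b S (insert b S)
  insertion-insert b∉S .absent = b∉S
  insertion-insert {b} {S} b∉S .present rewrite ≡ᵇ-refl b = refl
  insertion-insert {b} {S} b∉S .same j j<N j≢b rewrite ≢⇒≡ᵇ-false j b j≢b = refl

  insertion-remove : ∀ {b S} → S b ≡ true → Insertion b (remove b S) S
  insertion-remove {b} b∈S .absent rewrite ≡ᵇ-refl b = refl
  insertion-remove b∈S .present = b∈S
  insertion-remove {b} {S} b∈S .same j j<N j≢b rewrite ≢⇒≡ᵇ-false j b j≢b = refl

  -- Non-negative weights are used in both halves: whatever is within capacity after the insertion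
  -- was within capacity before it, so the old cell may be trusted.
  represents-insert : ∀ {𝓐 w c b} → b ℕ.< N → (∀ S → 𝓐 S → S b ≡ false) →
    Represents 𝓐 w c →
    Represents (λ S′ → ∃[ S ] (𝓐 S × Insertion b S S′)) (w ℚ.+ wt b) (c + 2 ^ b)
  represents-insert {w = w} {b = b} b<N fresh r .attained w+b≤B =
    let S , a , S≡w , S≡c = attained r (ℚ.≤-trans w≤w+b w+b≤B)
        ins = insertion-insert (fresh S a)
    in insert b S , (S , a , ins)
       , trans (insertion-sumℚ wt b<N ins) (cong (ℚ._+ wt b) S≡w)
       , trans (insertion-sumℕ (2 ^_) b<N ins) (cong (_+ 2 ^ b) S≡c)
    where
    w≤w+b : w ℚ.≤ w ℚ.+ wt b
    w≤w+b = subst (ℚ._≤ w ℚ.+ wt b) (ℚ.+-identityʳ w) (ℚ.+-monoʳ-≤ w (wt-nonNeg b b<N))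
  represents-insert {w = w} {b = b} b<N fresh r .minimal S′ (S , a , ins) S′≤B =
    subst (w ℚ.+ wt b ℚ.≤_) (sym split) (ℚ.+-monoˡ-≤ (wt b) (minimal r S a S≤B))
    where
    split : weightOf S′ ≡ weightOf S ℚ.+ wt b
    split = insertion-sumℚ wt b<N ins
    S≤B : weightOf S ℚ.≤ B
    S≤B = ℚ.≤-trans
      (subst₂ ℚ._≤_ (ℚ.+-identityʳ _) (sym split) (ℚ.+-monoʳ-≤ (weightOf S) (wt-nonNeg b b<N)))
      S′≤B

  categorySize : ℕ → ℕ
  categorySize i = ℕΣ.sumBelow N (belongs i)

  -- Families of item sets indexed by profit and count

  module Table
    (p : ℕ → ℕ) (D : ℕ) (p<D : ℕΣ.sumBelow N p ℕ.< D)
    (M : ℕ) (size≤M : ∀ j → j ℕ.< N → categorySize (cat j) ≤ M)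
    where

    -- One block of `D` cells for each count 0, ..., `M` of items of the current category.
    Q : ℕ
    Q = suc M * D

    profit<D : ∀ S → profit p S ℕ.< D
    profit<D S = ℕ.≤-<-trans (sumOver≤sumBelow N S p) p<D

    -- The state between two categories, when the count has been forgotten and the index is the
    -- profit alone.
    record Closed (done : ℕ → Bool) (q : ℕ) (S : ItemSet) : Set where
      constructor closed
      field
        support : ∀ j → j ℕ.< N → S j ≡ true → done (cat j) ≡ true
        bounds  : ∀ j → j ℕ.< N → done (cat j) ≡ true → InBounds S (cat j)
        size    : q ≡ profit p S

    -- Items are inserted in descending order: of the current category those
    -- with j ≥ b are available.  Since profits are below D, the index q encodes
    -- the pair of the profit and the number of items of the current category.
    record Partial (done : ℕ → Bool) (cur b q : ℕ) (S : ItemSet) : Set where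
      constructor partial
      field
        support : ∀ j → j ℕ.< N → S j ≡ true → done (cat j) ≡ true ⊎ (cat j ≡ cur × b ≤ j)
        bounds  : ∀ j → j ℕ.< N → done (cat j) ≡ true → InBounds S (cat j)
        size    : q ≡ profit p S + D * count S cur

    closed-init : Closed (λ _ → false) 0 (λ _ → false)
    closed-init = closed (λ _ _ ()) (λ _ _ ())
      (sym (ℕΣ.sumOver-ε N p λ _ _ ()))

    closed-init-unique : ∀ {q S} → Closed (λ _ → false) q S → q ≡ 0 × weightOf S ≡ 0ℚ
    closed-init-unique (closed support bounds refl) =
      ℕΣ.sumOver-ε N p (λ j j<N j∈S → contradiction (support j j<N j∈S) (λ ())) ,
      ℚΣ.sumOver-ε N wt (λ j j<N j∈S → contradiction (support j j<N j∈S) (λ ()))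

    represents-init : Represents (Closed (λ _ → false) 0) 0ℚ 0
    represents-init .attained _ = _ , closed-init ,
      ℚΣ.sumOver-ε N wt (λ _ _ ()) , ℕΣ.sumOver-ε N (2 ^_) (λ _ _ ())
    represents-init .minimal S cl _ = ℚ.≤-reflexive (sym (proj₂ (closed-init-unique cl)))

    closed⇒q<D : ∀ {done q S} → Closed done q S → q ℕ.< D
    closed⇒q<D {S = S} cl = subst (ℕ._< D) (sym (Closed.size cl)) (profit<D S)

    -- As profits are below `D`, the interval of indices says exactly that the count lies between
    -- the bounds of `cur`. Quantifying over the multiple `k` of `D` then erases the count.
    Filtered Merged : (ℕ → Bool) → ℕ → ℕ → ItemSet → Set
    Filtered done cur q S =
      Partial done cur 0 q S × (lo cur * D ≤ q × q ℕ.< suc (up cur) * D)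
    Merged done cur q S = ∃[ k ] Filtered done cur (q + k * D) S

    finish : (ℕ → Bool) → ℕ → ℕ → Bool
    finish done cur i = (i ≡ᵇ cur) ∨ done i

    module _ {done : ℕ → Bool} {cur : ℕ} (fresh : done cur ≡ false) where

      -- A set built from finished categories has no item of the unfinished `cur`, so its count is 0
      -- and the same cell serves both families; no table operation is needed to open a category.
      closed⇒partial : ∀ {q S} → Closed done q S → Partial done cur N q S
      closed⇒partial {q} {S} (closed support bounds size) = partial
        (λ j j<N j∈S → inj₁ (support j j<N j∈S)) bounds
        (trans size (sym (trans (cong (λ k → profit p S + D * k) none)
          (trans (cong (profit p S +_) (ℕ.*-zeroʳ D)) (ℕ.+-identityʳ _)))))
        where
        none : count S cur ≡ 0
        none = ℕΣ.sumOver-ε N {S} (belongs cur) λ j j<N j∈S → cong indicator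
          (≢⇒≡ᵇ-false (cat j) cur λ { refl → contradiction (trans (sym fresh) (support j j<N j∈S)) λ () })

      partial⇒closed : ∀ {q S} → Partial done cur N q S → Closed done q S
      partial⇒closed {q} {S} (partial support bounds size) = closed support′ bounds
        (trans size (trans (cong (λ k → profit p S + D * k) none)
          (trans (cong (profit p S +_) (ℕ.*-zeroʳ D)) (ℕ.+-identityʳ _))))
        where
        support′ : ∀ j → j ℕ.< N → S j ≡ true → done (cat j) ≡ true
        support′ j j<N j∈S with support j j<N j∈S
        ... | inj₁ d         = d
        ... | inj₂ (_ , N≤j) = contradiction (ℕ.<-≤-trans j<N N≤j) (ℕ.<-irrefl refl)
        none : count S cur ≡ 0
        none = ℕΣ.sumOver-ε N {S} (belongs cur) λ j j<N j∈S → cong indicator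
          (≢⇒≡ᵇ-false (cat j) cur λ { refl → contradiction (trans (sym fresh) (support′ j j<N j∈S)) λ () })

      partial-suc : ∀ {b q S} → Partial done cur (suc b) q S → Partial done cur b q S
      partial-suc (partial support bounds size) = partial
        (λ j j<N j∈S → Sum.map₂ (λ (c , b<j) → c , ℕ.<⇒≤ b<j) (support j j<N j∈S)) bounds size

      partial-pred : ∀ {b q S} → S b ≡ false ⊎ cat b ≢ cur →
        Partial done cur b q S → Partial done cur (suc b) q S
      partial-pred {b} {q} {S} unused (partial support bounds size) = partial support′ bounds size
        where
        b≢ : ∀ {j} → S j ≡ true → cat j ≡ cur → b ≢ j
        b≢ j∈S c refl = Sum.[ (λ b∉S → contradiction (trans (sym b∉S) j∈S) λ ()) , (λ c′ → c′ c) ]′ unused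
        support′ : ∀ j → j ℕ.< N → S j ≡ true → done (cat j) ≡ true ⊎ (cat j ≡ cur × suc b ≤ j)
        support′ j j<N j∈S = Sum.map₂ (λ (c , b≤j) → c , ℕ.≤∧≢⇒< b≤j (b≢ j∈S c)) (support j j<N j∈S)

      module _ {b : ℕ} (b<N : b ℕ.< N) (b∈cur : cat b ≡ cur) where

        partial-fresh : ∀ {q} S → Partial done cur (suc b) q S → S b ≡ false
        partial-fresh S (partial support _ _) with S b in b∈S
        ... | false = refl
        ... | true with support b b<N b∈S
        ...   | inj₁ d = contradiction (trans (sym fresh) (trans (cong done (sym b∈cur)) d)) λ ()
        ...   | inj₂ (_ , b<b) = contradiction b<b (ℕ.<-irrefl refl)

        count-cur : ∀ {S S′} → Insertion b S S′ → count S′ cur ≡ count S cur + 1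
        count-cur {S} ins = trans (insertion-sumℕ (belongs cur) b<N ins)
          (cong (λ c → count S cur + indicator c) (trans (cong (_≡ᵇ cur) b∈cur) (≡ᵇ-refl cur)))

        count-done : ∀ {S S′ i} → Insertion b S S′ → done i ≡ true → count S′ i ≡ count S i
        count-done {S} {i = i} ins d = trans (insertion-sumℕ (belongs i) b<N ins)
          (trans (cong (λ c → count S i + indicator c) (≢⇒≡ᵇ-false (cat b) i b∉i)) (ℕ.+-identityʳ (count S i)))
          where
          b∉i : cat b ≢ i
          b∉i refl = contradiction (trans (sym fresh) (trans (cong done (sym b∈cur)) d)) λ ()

        -- The shift has a part `p b` for the profit and a part `D` for the count, whatever the set;
        -- this makes a single sweep per item possible.
        size-insert : ∀ {S S′} → Insertion b S S′ →
          profit p S′ + D * count S′ cur ≡ profit p S + D * count S cur + (p b + D)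
        size-insert {S} {S′} ins = trans
          (cong₂ (λ x y → x + D * y) (insertion-sumℕ p b<N ins) (count-cur ins))
          (solve (profit p S) (p b) D (count S cur))
          where
          solve : ∀ x y d z → x + y + d * (z + 1) ≡ x + d * z + (y + d)
          solve = solve-∀

        partial-insert : ∀ {q S S′} → Insertion b S S′ →
          Partial done cur (suc b) q S → Partial done cur b (q + (p b + D)) S′
        partial-insert {q} {S} {S′} ins (partial support bounds size) = partial support′
          (λ j j<N d → subst (λ k → lo (cat j) ≤ k × k ≤ up (cat j))
            (sym (count-done ins d)) (bounds j j<N d))
          (trans (cong (_+ (p b + D)) size) (sym (size-insert ins)))
          where
          support′ : ∀ j → j ℕ.< N → S′ j ≡ true → done (cat j) ≡ true ⊎ (cat j ≡ cur × b ≤ j)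
          support′ j j<N j∈S′ with j ℕ.≟ b
          ... | yes refl = inj₂ (b∈cur , ℕ.≤-refl)
          ... | no j≢b = Sum.map₂ (λ (c , b<j) → c , ℕ.<⇒≤ b<j)
            (support j j<N (trans (sym (same ins j j<N j≢b)) j∈S′))

        partial-remove : ∀ {q S S′} → Insertion b S S′ →
          Partial done cur b (q + (p b + D)) S′ → Partial done cur (suc b) q S
        partial-remove {q} {S} {S′} ins (partial support bounds size) = partial support′
          (λ j j<N d → subst (λ k → lo (cat j) ≤ k × k ≤ up (cat j))
            (count-done ins d) (bounds j j<N d))
          (ℕ.+-cancelʳ-≡ (p b + D) _ _ (trans size (size-insert ins)))
          where
          support′ : ∀ j → j ℕ.< N → S j ≡ true → done (cat j) ≡ true ⊎ (cat j ≡ cur × suc b ≤ j)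
          support′ j j<N j∈S with j ℕ.≟ b
          ... | yes refl = contradiction (trans (sym (absent ins)) j∈S) λ ()
          ... | no j≢b = Sum.map₂ (λ (c , b≤j) → c , ℕ.≤∧≢⇒< b≤j (j≢b ∘ sym))
            (support j j<N (trans (same ins j j<N j≢b) j∈S))

        Inserted : ℕ → ItemSet → Set
        Inserted q S′ = ∃[ S ] (Partial done cur (suc b) q S × Insertion b S S′)

        -- The knapsack recurrence at the level of families: a set either avoids `b` or comes from a
        -- set `p b + D` cells lower.
        partial-split : ∀ {q} → p b + D ≤ q → ∀ S → Partial done cur b q S →
          Partial done cur (suc b) q S ⊎ Inserted (q ∸ (p b + D)) S
        partial-split {q} s≤q S pa with S b in b∈S
        ... | false = inj₁ (partial-pred (inj₁ b∈S) pa)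
        ... | true  = inj₂ (remove b S , partial-remove ins (subst (λ q → Partial done cur b q S)
              (sym (ℕ.m∸n+n≡m s≤q)) pa) , ins)
          where ins = insertion-remove b∈S

        partial-join : ∀ {q} → p b + D ≤ q → ∀ S →
          Inserted (q ∸ (p b + D)) S → Partial done cur b q S
        partial-join s≤q S (S₀ , pa , ins) =
          subst (λ q → Partial done cur b q S) (ℕ.m∸n+n≡m s≤q) (partial-insert ins pa)

        -- This and the next two lemmas are the three outcomes of the program `itemCell`: the old
        -- set is lighter, the set with `b` is lighter, or the index is too small for any set with
        -- `b`.
        represents-keep : ∀ {q w w′ c c′} → p b + D ≤ q → w ℚ.≤ w′ ℚ.+ wt b →
          Represents (Partial done cur (suc b) q) w c →
          Represents (Partial done cur (suc b) (q ∸ (p b + D))) w′ c′ →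
          Represents (Partial done cur b q) w c
        represents-keep s≤q w≤ r r′ = represents-union w≤ r
          (represents-insert b<N partial-fresh r′) (λ _ → partial-suc) (partial-split s≤q)

        represents-replace : ∀ {q w w′ c c′} → p b + D ≤ q → ¬ w ℚ.≤ w′ ℚ.+ wt b →
          Represents (Partial done cur (suc b) q) w c →
          Represents (Partial done cur (suc b) (q ∸ (p b + D))) w′ c′ →
          Represents (Partial done cur b q) (w′ ℚ.+ wt b) (c′ + 2 ^ b)
        represents-replace s≤q w≰ r r′ = represents-union (ℚ.<⇒≤ (ℚ.≰⇒> w≰))
          (represents-insert b<N partial-fresh r′) r
          (partial-join s≤q) (λ S → Sum.swap ∘ partial-split s≤q S)

        represents-small : ∀ {q w c} → ¬ p b + D ≤ q →
          Represents (Partial done cur (suc b) q) w c → Represents (Partial done cur b q) w c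
        represents-small {q} s≰q = represents-⇔ (λ _ → partial-suc) from
          where
          from : ∀ S → Partial done cur b q S → Partial done cur (suc b) q S
          from S pa with S b in b∈S
          ... | false = partial-pred (inj₁ b∈S) pa
          ... | true  = contradiction
            (subst (p b + D ≤_)
              (sym (trans (Partial.size pa) (size-insert (insertion-remove b∈S))))
              (ℕ.m≤n+m (p b + D) (profit p (remove b S) + D * count (remove b S) cur))) s≰q

      represents-filter : ∀ {q w c} → lo cur * D ≤ q → q ℕ.< suc (up cur) * D →
        Represents (Partial done cur 0 q) w c → Represents (Filtered done cur q) w c
      represents-filter lo≤ <up = represents-⇔ (λ _ pa → pa , lo≤ , <up) (λ _ → proj₁)

      represents-drop : ∀ {q w c} → ¬ (lo cur * D ≤ q × q ℕ.< suc (up cur) * D) → B ℚ.< w →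
        Represents (Filtered done cur q) w c
      represents-drop out = represents-empty (λ _ → out ∘ proj₂)

      -- The case `k` = 0 stays in its block, any other comes from one block higher. By this
      -- recursion one descending sweep folds all blocks into the lowest.
      merged-split : ∀ {q} → D ≤ q → ∀ S →
        Merged done cur (q ∸ D) S → Filtered done cur (q ∸ D) S ⊎ Merged done cur q S
      merged-split D≤q S (zero , f) = inj₁ (subst (λ q → Filtered done cur q S) (ℕ.+-identityʳ _) f)
      merged-split D≤q S (suc k , f) = inj₂ (k , subst (λ q → Filtered done cur q S)
        (trans (sym (ℕ.+-assoc _ D (k * D))) (cong (_+ k * D) (ℕ.m∸n+n≡m D≤q))) f)

      filtered⇒merged : ∀ {q} S → Filtered done cur q S → Merged done cur q S
      filtered⇒merged S f = 0 , subst (λ q → Filtered done cur q S) (sym (ℕ.+-identityʳ _)) f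

      merged-lower : ∀ {q} → D ≤ q → ∀ S → Merged done cur q S → Merged done cur (q ∸ D) S
      merged-lower D≤q S (k , f) = suc k , subst (λ q → Filtered done cur q S)
        (sym (trans (sym (ℕ.+-assoc _ D (k * D))) (cong (_+ k * D) (ℕ.m∸n+n≡m D≤q)))) f

      represents-mergeˡ : ∀ {q w w′ c c′} → D ≤ q → w ℚ.≤ w′ →
        Represents (Filtered done cur (q ∸ D)) w c → Represents (Merged done cur q) w′ c′ →
        Represents (Merged done cur (q ∸ D)) w c
      represents-mergeˡ D≤q w≤w′ r r′ =
        represents-union w≤w′ r r′ filtered⇒merged (merged-split D≤q)

      represents-mergeʳ : ∀ {q w w′ c c′} → D ≤ q → ¬ w ℚ.≤ w′ →
        Represents (Filtered done cur (q ∸ D)) w c → Represents (Merged done cur q) w′ c′ →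
        Represents (Merged done cur (q ∸ D)) w′ c′
      represents-mergeʳ D≤q w≰w′ r r′ = represents-union (ℚ.<⇒≤ (ℚ.≰⇒> w≰w′)) r′ r
        (merged-lower D≤q) (λ S → Sum.swap ∘ merged-split D≤q S)

      module _ {a : ℕ} (a<N : a ℕ.< N) (a∈cur : cat a ≡ cur) where

        partial⇒q<Q : ∀ {b q S} → Partial done cur b q S → q ℕ.< Q
        partial⇒q<Q {b} {q} {S} pa = begin-strict
          q                             ≡⟨ Partial.size pa ⟩
          profit p S + D * count S cur  <⟨ ℕ.+-monoˡ-< _ (profit<D S) ⟩
          D + D * count S cur           ≤⟨ ℕ.+-monoʳ-≤ D (ℕ.*-monoʳ-≤ D count≤M) ⟩
          D + D * M                     ≡⟨ cong (D +_) (ℕ.*-comm D M) ⟩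
          Q                             ∎
          where
          open ℕ.≤-Reasoning
          count≤M : count S cur ≤ M
          count≤M = ℕ.≤-trans (sumOver≤sumBelow N S _)
            (subst (λ i → categorySize i ≤ M) a∈cur (size≤M a a<N))

        -- The base of that recursion: above the top block there are no sets.
        represents-top : ∀ {q w c} → Q ≤ q + D →
          Represents (Filtered done cur q) w c → Represents (Merged done cur q) w c
        represents-top {q} Q≤q+D = represents-⇔ filtered⇒merged from
          where
          from : ∀ S → Merged done cur q S → Filtered done cur q S
          from S (zero , f) = subst (λ q → Filtered done cur q S) (ℕ.+-identityʳ _) f
          from S (suc k , f) = contradiction (partial⇒q<Q (proj₁ f))
            (ℕ.≤⇒≯ (ℕ.≤-trans Q≤q+D (ℕ.+-monoʳ-≤ q (ℕ.m≤m+n D (k * D)))))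

        -- The multiple of `D` to add is the true count of items of `cur`. The item `a` of that
        -- category is what makes its bounds available.
        closed⇒merged : ∀ {q} S → Closed (finish done cur) q S → Merged done cur q S
        closed⇒merged {q} S (closed support bounds size) = count S cur ,
          partial support′ bounds′ (cong₂ _+_ size (ℕ.*-comm (count S cur) D)) ,
          ℕ.≤-trans (ℕ.*-monoˡ-≤ D (proj₁ inBounds)) (ℕ.m≤n+m _ q) ,
          ℕ.+-mono-<-≤ (subst (ℕ._< D) (sym size) (profit<D S)) (ℕ.*-monoˡ-≤ D (proj₂ inBounds))
          where
          support′ : ∀ j → j ℕ.< N → S j ≡ true → done (cat j) ≡ true ⊎ (cat j ≡ cur × 0 ≤ j)
          support′ j j<N j∈S with cat j ≡ᵇ cur in eq | support j j<N j∈S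
          ... | true  | _ = inj₂ (≡ᵇ⇒≡ eq , z≤n)
          ... | false | d = inj₁ d
          bounds′ : ∀ j → j ℕ.< N → done (cat j) ≡ true → InBounds S (cat j)
          bounds′ j j<N d = bounds j j<N (cong₂ _∨_
            (≢⇒≡ᵇ-false (cat j) cur λ c → contradiction (trans (sym fresh) (trans (cong done (sym c)) d)) λ ()) d)
          inBounds : InBounds S cur
          inBounds = subst (InBounds S) a∈cur (bounds a a<N
            (cong (_∨ done (cat a)) (trans (cong (_≡ᵇ cur) a∈cur) (≡ᵇ-refl cur))))

        -- Uniqueness of quotient and remainder: `q` and the profit are both below `D`, hence `k` is
        -- the count and `q` the profit, and the interval of indices yields the bounds of `cur`.
        merged⇒closed : ∀ {q} → q ℕ.< D → ∀ S → Merged done cur q S → Closed (finish done cur) q S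
        merged⇒closed {q} q<D S (k , partial support bounds size , lo≤ , <up) =
          closed support′ bounds′ q≡
          where
          size′ : q + k * D ≡ profit p S + count S cur * D
          size′ = trans size (cong (profit p S +_) (ℕ.*-comm D (count S cur)))
          k≡ : k ≡ count S cur
          k≡ = ℕ.≤-antisym (quotient≤ q (profit<D S) size′) (quotient≤ (profit p S) q<D (sym size′))
            where
            quotient≤ : ∀ r {s k l} → s ℕ.< D → r + k * D ≡ s + l * D → k ≤ l
            quotient≤ r {s} {k} {l} s<D eq = ℕ.≤-pred (ℕ.*-cancelʳ-< D k (suc l) (begin-strict
              k * D       ≤⟨ ℕ.m≤n+m _ r ⟩
              r + k * D   ≡⟨ eq ⟩
              s + l * D   <⟨ ℕ.+-monoˡ-< (l * D) s<D ⟩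
              suc l * D   ∎))
              where open ℕ.≤-Reasoning
          q≡ : q ≡ profit p S
          q≡ = ℕ.+-cancelʳ-≡ (k * D) _ _
            (trans size′ (cong (λ l → profit p S + l * D) (sym k≡)))
          inBounds : InBounds S cur
          inBounds = subst (λ l → lo cur ≤ l × l ≤ up cur) k≡
            ( ℕ.≤-pred (ℕ.*-cancelʳ-< D _ _ (ℕ.≤-<-trans lo≤ (ℕ.+-monoˡ-< (k * D) q<D)))
            , ℕ.≤-pred (ℕ.*-cancelʳ-< D _ _ (ℕ.≤-<-trans (ℕ.m≤n+m _ q) <up)))
          support′ : ∀ j → j ℕ.< N → S j ≡ true → finish done cur (cat j) ≡ true
          support′ j j<N j∈S with cat j ≡ᵇ cur in eq
          ... | true = refl
          ... | false = Sum.[ id , (λ (c , _) → contradiction (trans (sym eq) (trans (cong (_≡ᵇ cur) c) (≡ᵇ-refl cur))) λ ()) ]′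
            (support j j<N j∈S)
          bounds′ : ∀ j → j ℕ.< N → finish done cur (cat j) ≡ true → InBounds S (cat j)
          bounds′ j j<N d with cat j ℕ.≟ cur
          ... | yes c = subst (InBounds S) (sym c) inBounds
          ... | no c≢ = bounds j j<N (subst (λ c → c ∨ done (cat j) ≡ true) (≢⇒≡ᵇ-false (cat j) cur c≢) d)

        represents-close : ∀ {q w c} → q ℕ.< D →
          Represents (Merged done cur q) w c → Represents (Closed (finish done cur) q) w c
        represents-close q<D = represents-⇔ (merged⇒closed q<D) closed⇒merged

    represents-beyond : ∀ {done q w c} → D ≤ q → B ℚ.< w → Represents (Closed done q) w c
    represents-beyond D≤q = represents-empty (λ S cl → ℕ.≤⇒≯ D≤q (closed⇒q<D cl))

    closed⇒admissible : ∀ {done q S} → (∀ j → j ℕ.< N → done (cat j) ≡ true) →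
      Closed done q S → Admissible S
    closed⇒admissible all (closed _ bounds _) j j<N = bounds j j<N (all j j<N)

    admissible⇒closed : ∀ {done S} → (∀ j → j ℕ.< N → done (cat j) ≡ true) →
      Admissible S → Closed done (profit p S) S
    admissible⇒closed all adm = closed (λ j j<N _ → all j j<N) (λ j j<N _ → adm j j<N) refl

-- The program

-- Names of arrays.  #load and #mask form the table: the weight of a set S and
-- its code Σ_{j ∈ S} 2^j, so that sets are extended and copied at unit cost.
#N #cat #lo #up #mask #profit #pow #base #length #a #b #q #cur #size #bit #least #most
  #bestMask #bestProfit #maxSize #j #counter #power #k #cap #wt #value #load
  #inf #itemWt #maxValue #scale #out #done #found : ℕ
#N = 0
#cat = 1
#lo = 2
#up = 3
#mask = 4
#profit = 5
#pow = 6
#base = 7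
#length = 8
#a = 9
#b = 10
#q = 11
#cur = 12
#size = 13
#bit = 14
#least = 15
#most = 16
#bestMask = 17
#bestProfit = 18
#maxSize = 19
#j = 20
#counter = 21
#power = 22
#k = 23
#cap = 0
#wt = 1
#value = 2
#load = 3
#inf = 4
#itemWt = 5
#maxValue = 6
#scale = 7
#out = 0
#done = 1
#found = 2

infixl 6 _⊕_ _⊖_
infixl 7 _⊛_
infix 4 _⊑_
_⊕_ _⊖_ _⊛_ : Exp nat → Exp nat → Exp nat
_⊕_ = op₂ addᴺ
_⊖_ = op₂ subᴺ
_⊛_ = op₂ mulᴺ

_⊑_ : Exp nat → Exp nat → Exp bool
_⊑_ = op₂ leqᴺ

clearCell setItemCell itemCell filterCell mergeCell selectCell : Program

clearCell = put rat #load (var #q) (get rat #inf (lit 0))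

setItemCell =
  put nat #mask (var #q) (get nat #mask (var #q ⊖ var #size) ⊕ var #bit) ⨾
  put rat #load (var #q)
    (op₂ addᴿ (get rat #load (var #q ⊖ var #size)) (get rat #itemWt (lit 0)))

itemCell = if (var #size ⊑ var #q)
  (if (op₂ leqᴿ (get rat #load (var #q))
         (op₂ addᴿ (get rat #load (var #q ⊖ var #size)) (get rat #itemWt (lit 0))))
    skip setItemCell)
  skip

filterCell = if (var #least ⊑ var #q) (if (var #most ⊑ var #q) clearCell skip) clearCell

-- A cell is emptied once it has been folded down, so that only indices below `D` are occupied when
-- the next category begins.
mergeCell = if (var #base ⊑ var #q)
  (if (op₂ leqᴿ (get rat #load (var #q ⊖ var #base)) (get rat #load (var #q)))
    skip
    (put nat #mask (var #q ⊖ var #base) (get nat #mask (var #q)) ⨾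
     put rat #load (var #q ⊖ var #base) (get rat #load (var #q))) ⨾
   clearCell)
  skip

-- In a downward scan the first cell within capacity carries the maximum profit; `#found` stands in
-- for an early exit.
selectCell = if (get bool #found (lit 0)) skip
  (if (op₂ leqᴿ (get rat #load (var #q)) (get rat #cap (lit 0)))
    (put bool #found (lit 0) (lit true) ⨾
     #bestProfit ≔ var #q ⨾
     #bestMask ≔ get nat #mask (var #q))
    skip)

loadItem addItem addIfCurrent addItems startCategory filterTable mergeTable addCategory : Program

loadItem =
  #size ≔ get nat #profit (var #b) ⊕ var #base ⨾
  #bit ≔ get nat #pow (var #b) ⨾
  put rat #itemWt (lit 0) (get rat #wt (var #b))

addItem = loadItem ⨾ for #q (var #length) itemCell

-- Two comparisons, since the machine has no equality test on naturals.
addIfCurrent =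
  if (get nat #cat (var #b) ⊑ var #cur)
    (if (var #cur ⊑ get nat #cat (var #b)) addItem skip)
    skip

startCategory =
  #cur ≔ get nat #cat (var #a) ⨾
  put bool #done (var #cur) (lit true) ⨾
  #least ≔ get nat #lo (var #cur) ⊛ var #base ⨾
  #most ≔ (lit 1 ⊕ get nat #up (var #cur)) ⊛ var #base

addItems = for #b (var #N) addIfCurrent

filterTable = for #q (var #length) filterCell

mergeTable = for #q (var #length) mergeCell

addCategory = startCategory ⨾ addItems ⨾ filterTable ⨾ mergeTable

clearTable initTable forgetCategory forgetCategories visitCategory addCategories select
  maximise : Program

clearTable = for #q (var #length) clearCell

initTable =
  put rat #load (lit 0) (lit 0ℚ) ⨾
  put nat #mask (lit 0) (lit 0)

-- `maximise` is run many times, so the flags of the previous run have to be erased.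
forgetCategory = put bool #done (get nat #cat (var #a)) (lit false)

forgetCategories = for #a (var #N) forgetCategory

-- A category is treated when the first of its items comes up; its other items find the flag set.
visitCategory = if (get bool #done (get nat #cat (var #a))) skip addCategory

addCategories = for #a (var #N) visitCategory

select = for #q (var #base) selectCell

setLength startSelect : Program

setLength = #length ≔ (lit 1 ⊕ var #maxSize) ⊛ var #base

startSelect = put bool #found (lit 0) (lit false)

maximise =
  setLength ⨾ clearTable ⨾ initTable ⨾ forgetCategories ⨾ addCategories ⨾ startSelect ⨾ select

-- For reading an array after one write: the conditional is what `update` leaves once the array
-- names have been compared.
cell-case : ∀ {A : Set} (R : A → Set) k q {x y : A} →
  (q ≡ k → R x) → (q ≢ k → R y) → R (if k ≡ᵇ q then x else y)
cell-case R k q r-eq r-ne with k ≡ᵇ q in eq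
... | true  = r-eq (sym (≡ᵇ⇒≡ eq))
... | false = r-ne λ { refl → contradiction (trans (sym (≡ᵇ-refl k)) eq) λ () }

cell-case₂ : ∀ {A A′ : Set} (R : A → A′ → Set) k q {x y : A} {x′ y′ : A′} →
  (q ≡ k → R x x′) → (q ≢ k → R y y′) →
  R (if k ≡ᵇ q then x else y) (if k ≡ᵇ q then x′ else y′)
cell-case₂ R k q r-eq r-ne with k ≡ᵇ q in eq
... | true  = r-eq (sym (≡ᵇ⇒≡ eq))
... | false = r-ne λ { refl → contradiction (trans (sym (≡ᵇ-refl k)) eq) λ () }

linear-bound : ∀ {a b c x y} → a ≤ c → b ≤ c → x ≤ y → x * a + b ≤ c * suc y
linear-bound {a} {b} {c} {x} {y} a≤c b≤c x≤y = begin
  x * a + b   ≤⟨ ℕ.+-mono-≤ (ℕ.*-mono-≤ x≤y a≤c) b≤c ⟩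
  y * c + c   ≡⟨ solve y c ⟩
  c * suc y   ∎
  where
  open ℕ.≤-Reasoning
  solve : ∀ y c → y * c + c ≡ c * suc y
  solve = solve-∀

-- Boolean, so that the preservation of all input data by a concrete program is one `refl`.
keepsSetting keepsInput : Program → Bool
keepsSetting P = not (writes nat #N P) ∧ not (writes nat #cat P) ∧ not (writes nat #lo P) ∧
  not (writes nat #up P) ∧ not (writes rat #wt P) ∧ not (writes rat #cap P) ∧
  not (writes rat #inf P) ∧ not (writes nat #pow P) ∧ not (writes nat #maxSize P)
keepsInput P = keepsSetting P ∧ (not (writes nat #base P) ∧ not (writes nat #profit P))

-- Correctness and running time of the dynamic program

module Maximise
  (N : ℕ) (cat lo up : ℕ → ℕ) (wt : ℕ → ℚ)
  (wt-nonNeg : ∀ j → j ℕ.< N → 0ℚ ℚ.≤ wt j) (B : ℚ) (M : ℕ)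
  where
  open Knapsack N cat lo up wt wt-nonNeg B

  record Setting (σ : Memory) : Set where
    field
      N≡    : nats σ #N 0 ≡ N
      cat≡  : ∀ j → nats σ #cat j ≡ cat j
      lo≡   : ∀ i → nats σ #lo i ≡ lo i
      up≡   : ∀ i → nats σ #up i ≡ up i
      wt≡   : ∀ j → rats σ #wt j ≡ wt j
      cap≡  : rats σ #cap 0 ≡ B
      B<inf : B ℚ.< rats σ #inf 0
      pow≡  : ∀ j → j ℕ.< N → nats σ #pow j ≡ 2 ^ j
      M≡    : nats σ #maxSize 0 ≡ M

  record Ready (p : ℕ → ℕ) (D : ℕ) (σ : Memory) : Set where
    field
      setting : Setting σ
      D≡      : nats σ #base 0 ≡ D
      profit≡ : ∀ j → j ℕ.< N → nats σ #profit j ≡ p j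
    open Setting setting public

  not-true : ∀ {b} → not b ≡ true → b ≡ false
  not-true {false} _ = refl

  setting-frame : ∀ P {σ τ} → keepsSetting P ≡ true → Frame P σ τ → Setting σ → Setting τ
  setting-frame P kept fr r
    with writes nat #N P in w₁ | writes nat #cat P in w₂ | writes nat #lo P in w₃
       | writes nat #up P in w₄ | writes rat #wt P in w₅ | writes rat #cap P in w₆
       | writes rat #inf P in w₇ | writes nat #pow P in w₈ | writes nat #maxSize P in w₉
  ... | false | false | false | false | false | false | false | false | false =
    let open Setting in record
      { N≡ = trans (fr nat #N w₁ 0) (N≡ r)
      ; cat≡ = λ j → trans (fr nat #cat w₂ j) (cat≡ r j)
      ; lo≡ = λ j → trans (fr nat #lo w₃ j) (lo≡ r j)
      ; up≡ = λ j → trans (fr nat #up w₄ j) (up≡ r j)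
      ; wt≡ = λ j → trans (fr rat #wt w₅ j) (wt≡ r j)
      ; cap≡ = trans (fr rat #cap w₆ 0) (cap≡ r)
      ; B<inf = subst (B ℚ.<_) (sym (fr rat #inf w₇ 0)) (B<inf r)
      ; pow≡ = λ j j<N → trans (fr nat #pow w₈ j) (pow≡ r j j<N)
      ; M≡ = trans (fr nat #maxSize w₉ 0) (M≡ r)
      }

  open Ready

  ready-frame : ∀ P {σ τ p D} → keepsInput P ≡ true → Frame P σ τ → Ready p D σ → Ready p D τ
  ready-frame P kept fr r .setting =
    setting-frame P (∧-trueˡ (keepsSetting P) _ kept) fr (setting r)
  ready-frame P kept fr r .D≡ = trans
    (fr nat #base (not-true (∧-trueˡ (not (writes nat #base P)) _ (∧-trueʳ (keepsSetting P) _ kept))) 0) (D≡ r)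
  ready-frame P kept fr r .profit≡ j j<N = trans
    (fr nat #profit (not-true (∧-trueʳ (not (writes nat #base P)) _ (∧-trueʳ (keepsSetting P) _ kept))) j)
    (profit≡ r j j<N)

  module _
    (p : ℕ → ℕ) (D : ℕ) (p<D : ℕΣ.sumBelow N p ℕ.< D)
    (size≤M : ∀ j → j ℕ.< N → categorySize (cat j) ≤ M)
    where
    open Table p D p<D M size≤M

    Cells : (ℕ → ℚ → ℕ → Set) → Memory → Set
    Cells R σ = ∀ q → q ℕ.< Q → R q (rats σ #load q) (nats σ #mask q)

    TableOf : (ℕ → ItemSet → Set) → Memory → Set
    TableOf 𝓕 = Cells (λ q → Represents (𝓕 q))

    Q-loop-time : ℕ → ℕ
    Q-loop-time t = 4 + (Q * (11 + t) + 5)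

    item-time : ℕ
    item-time = worstCase loadItem + Q-loop-time (worstCase itemCell)

    0<D : 0 ℕ.< D
    0<D = ℕ.≤-<-trans z≤n p<D

    -- The table is updated in place, from the top: the new contents of a cell
    -- depend on old cells with smaller indices only.
    Sweep : (old new : ℕ → ℚ → ℕ → Set) → ℕ → Memory → Set
    Sweep old new i = Cells (λ q w c → (i ≤ q → new q w c) × (q ℕ.< i → old q w c))

    -- At position i, every cell q ≥ max i D has been merged into cell q ∸ D and
    -- cleared, so a remaining cell q is complete as soon as i ≤ q + D.
    record Merging (done : ℕ → Bool) (cur i q : ℕ) (w : ℚ) (c : ℕ) : Set where
      constructor merging
      field
        cleared : i ≤ q → D ≤ q → B ℚ.< w
        merged  : q ℕ.< i ⊎ q ℕ.< D → i ≤ q + D → Represents (Merged done cur q) w c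
        pending : q + D ℕ.< i → Represents (Filtered done cur q) w c

    module _ {done : ℕ → Bool} {cur : ℕ} (fresh : done cur ≡ false) where

      module _ {b : ℕ} (b<N : b ℕ.< N) (b∈cur : cat b ≡ cur) where

        private
          old new : ℕ → ℚ → ℕ → Set
          old q = Represents (Partial done cur (suc b) q)
          new q = Represents (Partial done cur b q)

        run-itemCells : ∀ {σ} → nats σ #length 0 ≡ Q → nats σ #size 0 ≡ p b + D →
          nats σ #bit 0 ≡ 2 ^ b → rats σ #itemWt 0 ≡ wt b →
          TableOf (Partial done cur (suc b)) σ →
          Run (for #q (var #length) itemCell) σ (Q-loop-time (worstCase itemCell))
            (TableOf (Partial done cur b))
        run-itemCells {σ} Q≡ size≡ bit≡ wtb≡ tab = run-mono ℕ.≤-refl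
          (λ τ inv q q<Q → proj₁ (inv q q<Q) z≤n)
          (run-for-uniform #q (var #length) itemCell (Sweep old new) refl (λ _ _ _ inv → inv)
            body Q≡ (λ q q<Q → (λ Q≤q → contradiction q<Q (ℕ.≤⇒≯ Q≤q)) , λ _ → tab q q<Q))
          where
          body : ∀ i τ → i ℕ.< Q → nats τ #q 0 ≡ i → Frame (for #q (var #length) itemCell) σ τ →
            Sweep old new (suc i) τ → Run itemCell τ (worstCase itemCell) (Sweep old new i)
          body i τ i<Q refl fr inv = run-step itemCell refl
            (if-elim (Sweep old new i) _
              (λ s≤i → let s≤i = subst (_≤ i) size (does-true (_ ℕ.≤? _) s≤i) in
                if-elim (Sweep old new i) _
                  (λ w≤ → keep λ r → represents-keep fresh b<N b∈cur s≤i
                    (subst₂ (λ s x → rats τ #load i ℚ.≤ rats τ #load (i ∸ s) ℚ.+ x) size wtb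
                      (does-true (_ ℚ.≤? _) w≤)) r (source s≤i))
                  (λ w≰ → λ q q<Q → cell-case₂
                    (λ w c → (i ≤ q → new q w c) × (q ℕ.< i → old q w c)) i q
                    (λ { refl → (λ _ → subst₂ (new i)
                            (cong₂ (λ s x → rats τ #load (i ∸ s) ℚ.+ x) (sym size) (sym wtb))
                            (cong₂ (λ s x → nats τ #mask (i ∸ s) + x) (sym size) (sym bit))
                            (represents-replace fresh b<N b∈cur s≤i
                              (subst₂ (λ s x → ¬ rats τ #load i ℚ.≤ rats τ #load (i ∸ s) ℚ.+ x) size wtb
                                (does-false (_ ℚ.≤? _) w≰))
                              (proj₂ (inv i i<Q) ℕ.≤-refl) (source s≤i)))
                         , (λ i<i → contradiction i<i (ℕ.<-irrefl refl)) })
                    (other q q<Q)))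
              (λ s≰i → keep λ r → represents-small fresh b<N b∈cur
                (subst (λ s → ¬ s ≤ i) size (does-false (_ ℕ.≤? _) s≰i)) r))
            where
            size : nats τ #size 0 ≡ p b + D
            size = trans (fr nat #size refl 0) size≡
            bit : nats τ #bit 0 ≡ 2 ^ b
            bit = trans (fr nat #bit refl 0) bit≡
            wtb : rats τ #itemWt 0 ≡ wt b
            wtb = trans (fr rat #itemWt refl 0) wtb≡
            source : p b + D ≤ i → old (i ∸ (p b + D)) (rats τ #load (i ∸ (p b + D)))
              (nats τ #mask (i ∸ (p b + D)))
            -- The cell that is read is not above `i`, so the sweep has not overwritten it and `b`
            -- cannot be inserted twice.
            source s≤i = proj₂ (inv _ (ℕ.≤-<-trans (ℕ.m∸n≤m i (p b + D)) i<Q)) (s≤s (ℕ.m∸n≤m i (p b + D)))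
            other : ∀ q → q ℕ.< Q → q ≢ i →
              (i ≤ q → new q (rats τ #load q) (nats τ #mask q)) ×
              (q ℕ.< i → old q (rats τ #load q) (nats τ #mask q))
            other q q<Q q≢i =
              (λ i≤q → proj₁ (inv q q<Q) (ℕ.≤∧≢⇒< i≤q (q≢i ∘ sym))) ,
              (λ q<i → proj₂ (inv q q<Q) (ℕ.m≤n⇒m≤1+n q<i))
            keep : (old i (rats τ #load i) (nats τ #mask i) →
                    new i (rats τ #load i) (nats τ #mask i)) → Sweep old new i τ
            keep f q q<Q with q ℕ.≟ i
            ... | yes refl = (λ _ → f (proj₂ (inv i i<Q) ℕ.≤-refl)) ,
                             (λ i<i → contradiction i<i (ℕ.<-irrefl refl))
            ... | no q≢i = other q q<Q q≢i

        run-addItem : ∀ {σ} → Ready p D σ → nats σ #length 0 ≡ Q → nats σ #b 0 ≡ b →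
          TableOf (Partial done cur (suc b)) σ →
          Run addItem σ item-time (TableOf (Partial done cur b))
        run-addItem {σ} r Q≡ refl tab = run-seq (run-step loadItem refl
          (run-itemCells Q≡ (cong₂ _+_ (profit≡ r b b<N) (D≡ r)) (pow≡ r b b<N) (wt≡ r b) tab))

      run-filter : ∀ {σ} → Ready p D σ → nats σ #length 0 ≡ Q →
        nats σ #least 0 ≡ lo cur * D → nats σ #most 0 ≡ suc (up cur) * D →
        TableOf (Partial done cur 0) σ →
        Run filterTable σ (Q-loop-time (worstCase filterCell))
          (TableOf (Filtered done cur))
      run-filter {σ} r Q≡ least≡ most≡ tab = run-mono ℕ.≤-refl
        (λ τ inv q q<Q → proj₁ (inv q q<Q) z≤n)
        (run-for-uniform #q (var #length) filterCell (Sweep old new) refl (λ _ _ _ inv → inv)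
          body Q≡ (λ q q<Q → (λ Q≤q → contradiction q<Q (ℕ.≤⇒≯ Q≤q)) , λ _ → tab q q<Q))
        where
        old new : ℕ → ℚ → ℕ → Set
        old q = Represents (Partial done cur 0 q)
        new q = Represents (Filtered done cur q)

        body : ∀ i τ → i ℕ.< Q → nats τ #q 0 ≡ i → Frame filterTable σ τ →
          Sweep old new (suc i) τ → Run filterCell τ (worstCase filterCell) (Sweep old new i)
        body i τ i<Q refl fr inv = run-step filterCell refl
          (if-elim (Sweep old new i) _
            (λ least≤i → if-elim (Sweep old new i) _
              (λ most≤i → clear λ (_ , i<most) → ℕ.≤⇒≯
                (subst (_≤ i) most (does-true (_ ℕ.≤? _) most≤i)) i<most)
              (λ most≰i → λ q q<Q → keep
                (subst (_≤ i) least (does-true (_ ℕ.≤? _) least≤i))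
                (subst (i ℕ.<_) most (ℕ.≰⇒> (does-false (_ ℕ.≤? _) most≰i))) q q<Q))
            (λ least≰i → clear λ (least≤i , _) →
              does-false (_ ℕ.≤? _) least≰i (subst (_≤ i) (sym least) least≤i)))
          where
          least : nats τ #least 0 ≡ lo cur * D
          least = trans (fr nat #least refl 0) least≡
          most : nats τ #most 0 ≡ suc (up cur) * D
          most = trans (fr nat #most refl 0) most≡
          B<inf′ : B ℚ.< rats τ #inf 0
          B<inf′ = subst (B ℚ.<_) (sym (fr rat #inf refl 0)) (B<inf r)
          other : ∀ q → q ℕ.< Q → q ≢ i →
            (i ≤ q → new q (rats τ #load q) (nats τ #mask q)) ×
            (q ℕ.< i → old q (rats τ #load q) (nats τ #mask q))
          other q q<Q q≢i =
            (λ i≤q → proj₁ (inv q q<Q) (ℕ.≤∧≢⇒< i≤q (q≢i ∘ sym))) ,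
            (λ q<i → proj₂ (inv q q<Q) (ℕ.m≤n⇒m≤1+n q<i))
          clear : ¬ (lo cur * D ≤ i × i ℕ.< suc (up cur) * D) → Sweep old new i (step clearCell τ)
          clear out q q<Q = cell-case
            (λ w → (i ≤ q → new q w (nats τ #mask q)) × (q ℕ.< i → old q w (nats τ #mask q))) i q
            (λ { refl → (λ _ → represents-drop fresh out B<inf′) ,
                        (λ i<i → contradiction i<i (ℕ.<-irrefl refl)) })
            (other q q<Q)
          keep : lo cur * D ≤ i → i ℕ.< suc (up cur) * D → Sweep old new i τ
          keep least≤i i<most q q<Q with q ℕ.≟ i
          ... | yes refl = (λ _ → represents-filter fresh least≤i i<most (proj₂ (inv i i<Q) ℕ.≤-refl)) ,
                           (λ i<i → contradiction i<i (ℕ.<-irrefl refl))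
          ... | no q≢i = other q q<Q q≢i

      module _ {a : ℕ} (a<N : a ℕ.< N) (a∈cur : cat a ≡ cur) where

        run-merge : ∀ {σ} → Ready p D σ → nats σ #length 0 ≡ Q →
          TableOf (Filtered done cur) σ →
          Run mergeTable σ (Q-loop-time (worstCase mergeCell))
            (TableOf (Closed (finish done cur)))
        run-merge {σ} r Q≡ tab = run-mono ℕ.≤-refl
          (λ τ inv q q<Q → close (inv q q<Q))
          (run-for-uniform #q (var #length) mergeCell (λ i → Cells (Merging done cur i)) refl (λ _ _ _ inv → inv)
            body Q≡ (λ q q<Q → merging (λ Q≤q → contradiction q<Q (ℕ.≤⇒≯ Q≤q))
              (λ _ Q≤ → represents-top fresh a<N a∈cur Q≤ (tab q q<Q))
              (λ _ → tab q q<Q)))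
          where
          close : ∀ {q w c} → Merging done cur 0 q w c → Represents (Closed (finish done cur) q) w c
          close {q} (merging cleared merged _) with q ℕ.<? D
          ... | yes q<D = represents-close fresh a<N a∈cur q<D (merged (inj₂ q<D) z≤n)
          ... | no q≮D  = represents-beyond (ℕ.≮⇒≥ q≮D) (cleared z≤n (ℕ.≮⇒≥ q≮D))

          body : ∀ i τ → i ℕ.< Q → nats τ #q 0 ≡ i → Frame mergeTable σ τ →
            Cells (Merging done cur (suc i)) τ → Run mergeCell τ (worstCase mergeCell) (Cells (Merging done cur i))
          body i τ i<Q refl fr inv = run-step mergeCell refl
            (if-elim (Cells (Merging done cur i)) _
              (λ D≤i → let D≤i = subst (_≤ i) base (does-true (_ ℕ.≤? _) D≤i) in
                if-elim (λ υ → Cells (Merging done cur i) (step clearCell υ)) _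
                  (λ w≤ q q<Q → cell-case (λ w → Merging done cur i q w (nats τ #mask q)) i q
                    (λ { refl → here D≤i })
                    (λ q≢i → lower-or-other D≤i q q<Q q≢i λ q≡ →
                      subst (λ q → Represents (Merged done cur q) (rats τ #load q) (nats τ #mask q)) (sym q≡)
                        (represents-mergeˡ fresh D≤i
                          (subst (λ d → rats τ #load (i ∸ d) ℚ.≤ rats τ #load i) base
                            (does-true (_ ℚ.≤? _) w≤)) (below D≤i) (current D≤i))))
                  (λ w≰ q q<Q → cell-case
                    (λ w → Merging done cur i q w (if (i ∸ nats τ #base 0) ≡ᵇ q then nats τ #mask i else nats τ #mask q)) i q
                    (λ { refl → here D≤i })
                    (λ q≢i → cell-case₂ (Merging done cur i q) (i ∸ nats τ #base 0) q
                      (λ q≡ → lowered D≤i q (trans q≡ (cong (i ∸_) base)) q≢i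
                        (subst (λ q → Represents (Merged done cur q) (rats τ #load i) (nats τ #mask i))
                          (sym (trans q≡ (cong (i ∸_) base)))
                          (represents-mergeʳ fresh D≤i
                            (subst (λ d → ¬ rats τ #load (i ∸ d) ℚ.≤ rats τ #load i) base
                              (does-false (_ ℚ.≤? _) w≰)) (below D≤i) (current D≤i))))
                      (λ q≢ → other D≤i q q<Q q≢i λ q≡ → q≢ (trans q≡ (cong (i ∸_) (sym base)))))))
              (λ D≰i → small (ℕ.≰⇒> (subst (λ d → ¬ d ≤ i) base (does-false (_ ℕ.≤? _) D≰i)))))
            where
            base : nats τ #base 0 ≡ D
            base = trans (fr nat #base refl 0) (D≡ r)
            B<inf′ : B ℚ.< rats τ #inf 0
            B<inf′ = subst (B ℚ.<_) (sym (fr rat #inf refl 0)) (B<inf r)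

            below : D ≤ i → Represents (Filtered done cur (i ∸ D)) (rats τ #load (i ∸ D)) (nats τ #mask (i ∸ D))
            below D≤i = Merging.pending (inv _ (ℕ.≤-<-trans (ℕ.m∸n≤m i D) i<Q))
              (s≤s (ℕ.≤-reflexive (ℕ.m∸n+n≡m D≤i)))
            -- Since `D` is positive, index `i + D` has already been passed when the sweep reaches
            -- `i`.
            current : D ≤ i → Represents (Merged done cur i) (rats τ #load i) (nats τ #mask i)
            current D≤i = Merging.merged (inv i i<Q) (inj₁ ℕ.≤-refl)
              (ℕ.≤-trans (ℕ.≤-reflexive (ℕ.+-comm 1 i)) (ℕ.+-monoʳ-≤ i 0<D))

            here : ∀ {c} → D ≤ i → Merging done cur i i (rats τ #inf 0) c
            here D≤i = merging (λ _ _ → B<inf′)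
              (Sum.[ (λ i<i → contradiction i<i (ℕ.<-irrefl refl))
                   , (λ i<D → contradiction i<D (ℕ.≤⇒≯ D≤i)) ])
              (λ i+D<i → contradiction i+D<i (ℕ.≤⇒≯ (ℕ.m≤m+n i D)))

            lowered : D ≤ i → ∀ q {w c} → q ≡ i ∸ D → q ≢ i →
              Represents (Merged done cur q) w c → Merging done cur i q w c
            lowered D≤i q q≡ q≢i rep = merging
              (λ i≤q → contradiction
                (ℕ.≤-antisym (subst (_≤ i) (sym q≡) (ℕ.m∸n≤m i D)) i≤q) q≢i)
              (λ _ _ → rep)
              (λ q+D<i → contradiction q+D<i (ℕ.≤⇒≯ (ℕ.≤-reflexive
                (sym (trans (cong (_+ D) q≡) (ℕ.m∸n+n≡m D≤i))))))

            other : D ≤ i → ∀ q → q ℕ.< Q → q ≢ i → q ≢ i ∸ D →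
              Merging done cur i q (rats τ #load q) (nats τ #mask q)
            other D≤i q q<Q q≢i q≢i∸D = merging
              (λ i≤q → Merging.cleared (inv q q<Q) (ℕ.≤∧≢⇒< i≤q (q≢i ∘ sym)))
              (λ q< i≤q+D → Merging.merged (inv q q<Q) (Sum.map₁ ℕ.m≤n⇒m≤1+n q<)
                (ℕ.≤∧≢⇒< i≤q+D λ i≡ → q≢i∸D (sym (trans (cong (_∸ D) i≡) (ℕ.m+n∸n≡m q D)))))
              (λ q+D<i → Merging.pending (inv q q<Q) (ℕ.m≤n⇒m≤1+n q+D<i))

            lower-or-other : D ≤ i → ∀ q → q ℕ.< Q → q ≢ i →
              (q ≡ i ∸ D → Represents (Merged done cur q) (rats τ #load q) (nats τ #mask q)) →
              Merging done cur i q (rats τ #load q) (nats τ #mask q)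
            lower-or-other D≤i q q<Q q≢i f with q ℕ.≟ i ∸ D
            ... | yes q≡ = lowered D≤i q q≡ q≢i (f q≡)
            ... | no q≢  = other D≤i q q<Q q≢i q≢

            small : i ℕ.< D → Cells (Merging done cur i) τ
            small i<D q q<Q = merging
              (λ i≤q D≤q → Merging.cleared (inv q q<Q) (ℕ.<-≤-trans i<D D≤q) D≤q)
              (λ q< _ → Merging.merged (inv q q<Q) (Sum.map₁ ℕ.m≤n⇒m≤1+n q<)
                (ℕ.≤-trans i<D (ℕ.m≤n+m D q)))
              (λ q+D<i → contradiction (ℕ.<-trans q+D<i i<D) (ℕ.≤⇒≯ (ℕ.m≤n+m D q)))

    module _ {done : ℕ → Bool} {cur : ℕ} (fresh : done cur ≡ false) where

      -- The potential counts the items of `cur` still ahead, and only these pay for a sweep. Every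
      -- item pays 26: the loop overhead 11 and at most 15 for the two comparisons.
      run-addItems : ∀ {σ} → Ready p D σ → nats σ #length 0 ≡ Q → nats σ #cur 0 ≡ cur →
        TableOf (Partial done cur N) σ →
        Run addItems σ
          (4 + (N * 26 + item-time * categorySize cur + 5))
          (TableOf (Partial done cur 0))
      run-addItems {σ} r Q≡ cur≡ tab = run-mono ℕ.≤-refl (λ _ → proj₂)
        (run-for {⊤} #b (var #N) addIfCurrent (λ b _ → TableOf (Partial done cur b))
          (λ b _ → b * 26 + item-time * ℕΣ.sumBelow b (belongs cur))
          refl (λ _ _ _ _ inv → inv)
          (λ b _ τ b<N b≡ fr tab → tt , body b τ b<N b≡ fr tab) (N≡ r) tab)
        where
        body : ∀ b τ → b ℕ.< N → nats τ #b 0 ≡ b → Frame addItems σ τ →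
          TableOf (Partial done cur (suc b)) τ →
          ∃[ t ] (Run addIfCurrent τ t (TableOf (Partial done cur b)) ×
            11 + t + (b * 26 + item-time * ℕΣ.sumBelow b (belongs cur)) ≤
            suc b * 26 + item-time * ℕΣ.sumBelow (suc b) (belongs cur))
        body b τ b<N b≡ fr tab with cat b ℕ.≟ cur
        ... | yes b∈cur = 14 + item-time ,
          run-if
            (λ _ → run-if
              (λ _ → run-addItem fresh b<N b∈cur (ready-frame addItems refl fr r)
                (trans (fr nat #length refl 0) Q≡) b≡ tab)
              (λ cur≰ → contradiction (ℕ.≤-reflexive (sym cat≡cur)) (does-false (_ ℕ.≤? _) cur≰)))
            (λ ≰cur → contradiction (ℕ.≤-reflexive cat≡cur) (does-false (_ ℕ.≤? _) ≰cur)) ,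
          subst (λ x → 25 + item-time + (b * 26 + item-time * ℕΣ.sumBelow b (belongs cur)) ≤
                    suc b * 26 + item-time * (ℕΣ.sumBelow b (belongs cur) + indicator x))
            (sym (trans (cong (_≡ᵇ cur) b∈cur) (≡ᵇ-refl cur)))
            (ℕ.≤-trans (ℕ.n≤1+n _)
              (ℕ.≤-reflexive (solve item-time b (ℕΣ.sumBelow b (belongs cur)))))
          where
          cat≡cur : nats τ #cat (nats τ #b 0) ≡ nats τ #cur 0
          cat≡cur = trans (cat≡ (ready-frame addItems refl fr r) _)
            (trans (cong cat b≡) (trans b∈cur (sym (trans (fr nat #cur refl 0) cur≡))))
          solve : ∀ t b s → 26 + t + (b * 26 + t * s) ≡ suc b * 26 + t * (s + 1)
          solve = solve-∀
        ... | no b∉cur = 15 ,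
          run-if
            (λ ≤cur → run-if
              (λ cur≤ → contradiction (ℕ.≤-antisym (does-true (_ ℕ.≤? _) ≤cur) (does-true (_ ℕ.≤? _) cur≤)) cat≢cur)
              (λ _ → run-step skip refl unused))
            (λ _ → run-mono (ℕ.m≤n+m 1 7) (λ _ → id) (run-step skip refl unused)) ,
          ℕ.≤-reflexive (cong (λ x → 26 + b * 26 + item-time * x)
            (sym (trans (cong (λ x → ℕΣ.sumBelow b (belongs cur) + indicator x) (≢⇒≡ᵇ-false (cat b) cur b∉cur))
              (ℕ.+-identityʳ _))))
          where
          cat≢cur : nats τ #cat (nats τ #b 0) ≢ nats τ #cur 0
          cat≢cur eq = b∉cur (trans (sym (trans (cat≡ (ready-frame addItems refl fr r) _) (cong cat b≡)))
            (trans eq (trans (fr nat #cur refl 0) cur≡)))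
          unused : TableOf (Partial done cur b) τ
          unused q q<Q = represents-⇔ (λ _ → partial-suc fresh)
            (λ _ → partial-pred fresh (inj₂ b∉cur)) (tab q q<Q)

    Tracks : (ℕ → Bool) → Memory → Set
    Tracks done σ = ∀ j → j ℕ.< N → bools σ #done (cat j) ≡ done (cat j)

    category-time : ℕ → ℕ
    category-time i = worstCase startCategory +
      (4 + (N * 26 + item-time * i + 5) +
        (Q-loop-time (worstCase filterCell) + Q-loop-time (worstCase mergeCell)))

    run-addCategory : ∀ {done a σ} → done (cat a) ≡ false → a ℕ.< N → Ready p D σ →
      nats σ #length 0 ≡ Q → nats σ #a 0 ≡ a →
      TableOf (Closed done) σ → Tracks done σ →
      Run addCategory σ (category-time (categorySize (cat a)))
        (λ τ → TableOf (Closed (finish done (cat a))) τ × Tracks (finish done (cat a)) τ)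
    run-addCategory {done} {a} {σ} fresh a<N r Q≡ refl tab tracks =
      run-bind (run-loopFree startCategory refl) λ { .υ fr₁ refl →
      run-bind (run-addItems fresh (ready-frame startCategory refl fr₁ r) (trans (fr₁ nat #length refl 0) Q≡)
        (cat≡ r a) (λ q q<Q → represents-⇔ (λ _ → closed⇒partial fresh)
          (λ _ → partial⇒closed fresh) (tab q q<Q))) λ τ₂ fr₂ tab₂ →
      run-bind (run-filter fresh (ready-frame addItems refl fr₂ (ready-frame startCategory refl fr₁ r))
        (trans (fr₂ nat #length refl 0) (trans (fr₁ nat #length refl 0) Q≡))
        (trans (fr₂ nat #least refl 0) (cong₂ _*_ (trans (cong (nats σ #lo) (cat≡ r a)) (lo≡ r _)) (D≡ r)))
        (trans (fr₂ nat #most refl 0)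
          (cong₂ (λ u d → suc u * d) (trans (cong (nats σ #up) (cat≡ r a)) (up≡ r _)) (D≡ r)))
        tab₂) λ τ₃ fr₃ tab₃ →
      run-mono ℕ.≤-refl
        (λ τ₄ (fr₄ , tab₄) → tab₄ , λ j j<N →
          trans (fr₄ bool #done refl _) (trans (fr₃ bool #done refl _)
            (trans (fr₂ bool #done refl _) (started j j<N))))
        (run-frame (run-merge fresh a<N refl
          (ready-frame filterTable refl fr₃ (ready-frame addItems refl fr₂ (ready-frame startCategory refl fr₁ r)))
          (trans (fr₃ nat #length refl 0) (trans (fr₂ nat #length refl 0)
            (trans (fr₁ nat #length refl 0) Q≡))) tab₃)) }
      where
      υ : Memory
      υ = step startCategory σ
      started : ∀ j → j ℕ.< N → bools υ #done (cat j) ≡ finish done (cat a) (cat j)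
      started j j<N = cell-case (_≡ finish done (cat a) (cat j)) (nats σ #cat a) (cat j)
        (λ j≡ → sym (cong (_∨ done (cat j)) (trans (cong (_≡ᵇ cat a) (trans j≡ (cat≡ r a))) (≡ᵇ-refl (cat a)))))
        (λ j≢ → trans (tracks j j<N) (sym (cong (_∨ done (cat j))
          (≢⇒≡ᵇ-false (cat j) (cat a) λ j≡ → j≢ (trans j≡ (sym (cat≡ r a)))))))

    -- The potential of the outer loop pays for inserting every item of a category
    -- that is not done, so the whole loop inserts N items.
    remaining : (ℕ → Bool) → ℕ
    remaining done = ℕΣ.sumBelow N (λ j → indicator (not (done (cat j))))

    remaining-finish : ∀ {done} cur → done cur ≡ false →
      remaining done ≡ remaining (finish done cur) + categorySize cur
    remaining-finish {done} cur fresh = trans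
      (ℕΣ.sumBelow-cong N λ j _ → pointwise (cat j))
      (ℕΣ.sumBelow-∙ N _ (belongs cur))
      where
      pointwise : ∀ i → indicator (not (done i)) ≡
        indicator (not (finish done cur i)) + indicator (i ≡ᵇ cur)
      pointwise i with i ≡ᵇ cur in eq
      ... | true rewrite trans (cong done (≡ᵇ⇒≡ {i} {cur} eq)) fresh = refl
      ... | false = sym (ℕ.+-identityʳ _)

    -- `category-time` is affine in the category size. Its constant part, with the sweeps for
    -- filtering and merging, is charged to every item; the linear part is left to `remaining`. The
    -- 24 covers loop overhead and flag test, which need 17 at most.
    visit-time : ℕ
    visit-time = 24 + category-time 0

    -- The ghost state is the set of finished categories. Passing an item leaves its category
    -- finished, either now or through an item visited before.
    run-addCategories : ∀ {σ} → Ready p D σ → nats σ #length 0 ≡ Q →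
      TableOf (Closed (λ _ → false)) σ → Tracks (λ _ → false) σ →
      Run addCategories σ
        (4 + (N * visit-time + item-time * remaining (λ _ → false) + 5))
        (λ τ → ∃[ done ] ((∀ j → j ℕ.< N → done (cat j) ≡ true) × TableOf (Closed done) τ))
    run-addCategories {σ} r Q≡ tab tracks = run-mono ℕ.≤-refl
      (λ τ (done , tab , _ , all) → done , (λ j → all j z≤n) , tab)
      (run-for #a (var #N) visitCategory
        (λ i done τ → TableOf (Closed done) τ × Tracks done τ ×
          (∀ j → i ≤ j → j ℕ.< N → done (cat j) ≡ true))
        (λ i done → i * visit-time + item-time * remaining done)
        refl (λ _ _ _ _ inv → inv) body (N≡ r)
        (tab , tracks , λ j N≤j j<N → contradiction j<N (ℕ.≤⇒≯ N≤j)))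
      where
      extend : ∀ {i done done′} → done′ (cat i) ≡ true →
        (∀ j → done (cat j) ≡ true → done′ (cat j) ≡ true) →
        (∀ j → suc i ≤ j → j ℕ.< N → done (cat j) ≡ true) →
        (∀ j → i ≤ j → j ℕ.< N → done′ (cat j) ≡ true)
      extend {i} i-done grow all j i≤j j<N with i ℕ.≟ j
      ... | yes refl = i-done
      ... | no i≢j   = grow j (all j (ℕ.≤∧≢⇒< i≤j i≢j) j<N)

      body : ∀ i done τ → i ℕ.< N → nats τ #a 0 ≡ i → Frame addCategories σ τ →
        (TableOf (Closed done) τ × Tracks done τ × (∀ j → suc i ≤ j → j ℕ.< N → done (cat j) ≡ true)) →
        ∃[ done′ ] ∃[ t ] (Run visitCategory τ t
            (λ υ → TableOf (Closed done′) υ × Tracks done′ υ ×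
              (∀ j → i ≤ j → j ℕ.< N → done′ (cat j) ≡ true)) ×
          11 + t + (i * visit-time + item-time * remaining done′) ≤
          suc i * visit-time + item-time * remaining done)
      body i done τ i<N refl fr (tab , tracks , all) with done (cat i) in i-done
      ... | true = done , 6 ,
        run-if (λ _ → run-step skip refl (tab , tracks , extend {done = done} {done} i-done (λ _ → id) all))
          (λ not-done → contradiction (trans (sym not-done) flag) λ ()) ,
        ℕ.≤-trans (ℕ.+-monoˡ-≤ (i * visit-time + item-time * remaining done) 17≤visit)
          (ℕ.≤-reflexive (sym (ℕ.+-assoc visit-time (i * visit-time) _)))
        where
        flag : bools τ #done (nats τ #cat i) ≡ true
        flag = trans (cong (bools τ #done) (cat≡ (ready-frame addCategories refl fr r) i)) (trans (tracks i i<N) i-done)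
        17≤visit : 17 ≤ visit-time
        17≤visit = ℕ.≤-trans (from-yes (17 ℕ.≤? 24)) (ℕ.m≤m+n 24 (category-time 0))
      ... | false = finish done (cat i) , 5 + category-time (categorySize (cat i)) ,
        run-if (λ done → contradiction (trans (sym done) flag) λ ())
          (λ _ → run-mono ℕ.≤-refl
            (λ υ (tab′ , tracks′) → tab′ , tracks′ ,
              extend {done = done} {finish done (cat i)} (cong (_∨ done (cat i)) (≡ᵇ-refl (cat i)))
                (λ j d → trans (cong ((cat j ≡ᵇ cat i) ∨_) d) (Bool.∨-zeroʳ _)) all)
            (run-addCategory i-done i<N (ready-frame addCategories refl fr r) (trans (fr nat #length refl 0) Q≡)
              refl tab tracks)) ,
        pay
        where
        flag : bools τ #done (nats τ #cat i) ≡ false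
        flag = trans (cong (bools τ #done) (cat≡ (ready-frame addCategories refl fr r) i)) (trans (tracks i i<N) i-done)
        open ℕ.≤-Reasoning
        solve : ∀ s n k c f v R →
          16 + (s + (4 + (n + k * c + 5) + f)) + (v + k * R) ≡
          16 + (s + (4 + (n + k * 0 + 5) + f)) + v + k * (R + c)
        solve = solve-∀
        pay : 16 + category-time (categorySize (cat i)) +
              (i * visit-time + item-time * remaining (finish done (cat i))) ≤
              suc i * visit-time + item-time * remaining done
        pay = begin
          16 + category-time (categorySize (cat i)) +
            (i * visit-time + item-time * remaining (finish done (cat i)))
            ≡⟨ solve (worstCase startCategory) (N * 26) item-time (categorySize (cat i))
                 (Q-loop-time (worstCase filterCell) + Q-loop-time (worstCase mergeCell))
                 (i * visit-time) (remaining (finish done (cat i))) ⟩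
          16 + category-time 0 + i * visit-time +
            item-time * (remaining (finish done (cat i)) + categorySize (cat i))
            ≤⟨ ℕ.+-mono-≤ (ℕ.+-monoˡ-≤ (i * visit-time)
                 (ℕ.+-monoˡ-≤ (category-time 0) (from-yes (16 ℕ.≤? 24))))
                 (ℕ.≤-reflexive (cong (item-time *_) (sym (remaining-finish {done} (cat i) i-done)))) ⟩
          suc i * visit-time + item-time * remaining done ∎

    Best : Memory → Set
    Best σ = ∃[ S ] (Feasible S × profit p S ≡ nats σ #bestProfit 0 ×
      code S ≡ nats σ #bestMask 0 × (∀ T → Feasible T → profit p T ≤ profit p S))

    D≤Q : D ≤ Q
    D≤Q = ℕ.m≤m+n D (M * D)

    -- As long as nothing is found, all feasible profits lie below the current index. At index 0
    -- this contradicts the given feasible set, so the scan succeeds.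
    run-select : ∀ {done σ} → (∀ j → j ℕ.< N → done (cat j) ≡ true) → ∃[ S ] Feasible S →
      nats σ #base 0 ≡ D → rats σ #cap 0 ≡ B → bools σ #found 0 ≡ false →
      TableOf (Closed done) σ →
      Run select σ (4 + (D * (11 + worstCase selectCell) + 5)) Best
    run-select {done} {σ} all (U , U-feasible) base≡ cap≡ found≡ tab = run-mono ℕ.≤-refl
      (λ { τ (inj₁ (_ , best)) → best
         ; τ (inj₂ (_ , none)) → contradiction (none U U-feasible) λ () })
      (run-for-uniform #q (var #base) selectCell Inv refl (λ _ _ _ inv → inv) body base≡
        (inj₂ (found≡ , λ T _ → profit<D T)))
      where
      Inv : ℕ → Memory → Set
      Inv i τ = (bools τ #found 0 ≡ true × Best τ) ⊎
        (bools τ #found 0 ≡ false × (∀ T → Feasible T → profit p T ℕ.< i))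

      body : ∀ i τ → i ℕ.< D → nats τ #q 0 ≡ i → Frame select σ τ → Inv (suc i) τ →
        Run selectCell τ (worstCase selectCell) (Inv i)
      body i τ i<D refl fr inv = run-step selectCell refl
        (if-elim (Inv i) _
          (λ found → Sum.[ inj₁ , (λ (¬found , _) → contradiction (trans (sym ¬found) found) λ ()) ]′ inv)
          (λ ¬found → if-elim (Inv i) _
            (λ w≤B → let
                S , cl , weight≡ , code≡ = attained cell (subst (rats τ #load i ℚ.≤_) cap (does-true (_ ℚ.≤? _) w≤B))
              in inj₁ (refl , S
                , (closed⇒admissible all cl
                  , subst₂ ℚ._≤_ (sym weight≡) cap (does-true (_ ℚ.≤? _) w≤B))
                , sym (Closed.size cl) , code≡
                , λ T T-feasible → subst (profit p T ≤_) (Closed.size cl) (ℕ.≤-pred (below ¬found T T-feasible))))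
            (λ w≰B → inj₂ (¬found , λ T T-feasible → ℕ.≤∧≢⇒< (ℕ.≤-pred (below ¬found T T-feasible))
              λ T≡i → does-false (_ ℚ.≤? _) w≰B (subst (rats τ #load i ℚ.≤_) (sym cap)
                (ℚ.≤-trans
                  (minimal cell T (subst (λ q → Closed done q T) T≡i
                    (admissible⇒closed all (proj₁ T-feasible))) (proj₂ T-feasible))
                  (proj₂ T-feasible)))))))
        where
        cap : rats τ #cap 0 ≡ B
        cap = trans (fr rat #cap refl 0) cap≡
        cell : Represents (Closed done i) (rats τ #load i) (nats τ #mask i)
        cell = subst₂ (Represents (Closed done i)) (sym (fr rat #load refl i)) (sym (fr nat #mask refl i))
          (tab i (ℕ.<-≤-trans i<D D≤Q))
        below : bools τ #found 0 ≡ false → ∀ T → Feasible T → profit p T ℕ.< suc i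
        below ¬found = Sum.[ (λ (found , _) → contradiction (trans (sym ¬found) found) λ ()) , proj₂ ]′ inv

    run-clearTable : ∀ {σ} → Ready p D σ → nats σ #length 0 ≡ Q →
      Run clearTable σ (Q-loop-time (worstCase clearCell))
        (Cells (λ _ w _ → B ℚ.< w))
    run-clearTable {σ} r Q≡ = run-mono ℕ.≤-refl (λ τ inv q q<Q → inv q q<Q z≤n)
      (run-for-uniform #q (var #length) clearCell
        (λ i → Cells (λ q w _ → i ≤ q → B ℚ.< w)) refl (λ _ _ _ inv → inv)
        (λ i τ i<Q i≡ fr inv → run-step clearCell refl λ q q<Q →
          cell-case (λ w → i ≤ q → B ℚ.< w) (nats τ #q 0) q
            (λ _ _ → subst (B ℚ.<_) (sym (fr rat #inf refl 0)) (B<inf r))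
            (λ q≢ i≤q → inv q q<Q (ℕ.≤∧≢⇒< i≤q λ i≡q → q≢ (trans (sym i≡q) (sym i≡)))))
        Q≡ (λ q q<Q Q≤q → contradiction q<Q (ℕ.≤⇒≯ Q≤q)))

    table-init : ∀ {σ} → Cells (λ _ w _ → B ℚ.< w) σ →
      TableOf (Closed (λ _ → false)) (step initTable σ)
    table-init cleared zero    q<Q = represents-init
    table-init cleared (suc q) q<Q = represents-empty
      (λ S cl → contradiction (proj₁ (closed-init-unique cl)) λ ()) (cleared (suc q) q<Q)

    run-forgetCategories : ∀ {σ} → Ready p D σ →
      Run forgetCategories σ (4 + (N * (11 + worstCase forgetCategory) + 5)) (Tracks (λ _ → false))
    run-forgetCategories {σ} r = run-mono ℕ.≤-refl (λ τ inv j j<N → inv j z≤n j<N)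
      (run-for-uniform #a (var #N) forgetCategory
        (λ i τ → ∀ j → i ≤ j → j ℕ.< N → bools τ #done (cat j) ≡ false) refl (λ _ _ _ inv → inv)
        (λ i τ i<N i≡ fr inv → run-step forgetCategory refl λ j i≤j j<N →
          cell-case (_≡ false) (nats τ #cat (nats τ #a 0)) (cat j) (λ _ → refl)
            (λ j≢ → inv j (ℕ.≤∧≢⇒< i≤j λ { refl → j≢ (sym (trans
              (cat≡ (ready-frame forgetCategories refl fr r) _) (cong cat i≡))) }) j<N))
        (N≡ r) (λ j N≤j j<N → contradiction j<N (ℕ.≤⇒≯ N≤j)))

    maximise-time : ℕ
    maximise-time = worstCase setLength + (Q-loop-time (worstCase clearCell) +
      (worstCase initTable + (4 + (N * (11 + worstCase forgetCategory) + 5) +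
      (4 + (N * visit-time + item-time * remaining (λ _ → false) + 5) +
      (worstCase startSelect + (4 + (D * (11 + worstCase selectCell) + 5)))))))

    run-maximise : ∀ {σ} → Ready p D σ → ∃[ S ] Feasible S → Run maximise σ maximise-time Best
    run-maximise {σ} r feasible =
      run-bind (run-loopFree setLength refl) λ { .(step setLength σ) fr₁ refl →
      let r₁ = ready-frame setLength refl fr₁ r
          Q₁ = cong₂ (λ m d → suc m * d) (M≡ r) (D≡ r)
      in run-bind (run-clearTable r₁ Q₁) λ τ₂ fr₂ cleared →
      let r₂ = ready-frame clearTable refl fr₂ r₁
          Q₂ = trans (fr₂ nat #length refl 0) Q₁
      in run-bind (run-step initTable {Q = TableOf (Closed (λ _ → false))} refl (table-init {τ₂} cleared)) λ τ₃ fr₃ tab₃ →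
      let r₃ = ready-frame initTable refl fr₃ r₂
          Q₃ = trans (fr₃ nat #length refl 0) Q₂
      in run-bind (run-forgetCategories r₃) λ τ₄ fr₄ tracks →
      let r₄ = ready-frame forgetCategories refl fr₄ r₃
          Q₄ = trans (fr₄ nat #length refl 0) Q₃
          tab₄ = λ q q<Q → subst₂ (Represents (Closed (λ _ → false) q))
            (sym (fr₄ rat #load refl q)) (sym (fr₄ nat #mask refl q)) (tab₃ q q<Q)
      in run-bind (run-addCategories r₄ Q₄ tab₄ tracks) λ { τ₅ fr₅ (done , all , tab₅) →
      let r₅ = ready-frame addCategories refl fr₅ r₄
      in run-bind (run-step startSelect
           {Q = λ τ → bools τ #found 0 ≡ false × TableOf (Closed done) τ} refl (refl , tab₅))
           λ { τ₆ fr₆ (found≡ , tab₆) →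
      let r₆ = ready-frame startSelect refl fr₆ r₅
      in run-select all feasible (D≡ r₆) (cap≡ r₆) found≡ tab₆ }}}

    -- Per item, visiting costs at most 87 H and inserting 57 H, together 144 H; the remaining 54 H
    -- are rounded up to another 144 H. The 87 is 34 + 53, the cost per cell of filtering and
    -- merging.
    maximise-time≤ : maximise-time ≤ 144 * (suc N * suc (Q + N))
    maximise-time≤ = begin
      maximise-time
        ≡⟨ split Q N D (N * visit-time) (item-time * remaining (λ _ → false)) ⟩
      ((Q + N) * 16 + D * 35 + 54) + (N * visit-time + item-time * remaining (λ _ → false))
        ≤⟨ ℕ.+-mono-≤ rest≤
             (ℕ.+-mono-≤ (ℕ.*-monoʳ-≤ N visit-time≤) (ℕ.*-mono-≤ item-time≤ remaining≤)) ⟩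
      54 * H + (N * (87 * H) + 57 * H * N)
        ≤⟨ ℕ.+-monoˡ-≤ _ (ℕ.*-monoˡ-≤ H (from-yes (54 ℕ.≤? 144))) ⟩
      144 * H + (N * (87 * H) + 57 * H * N)
        ≡⟨ collect N H ⟩
      144 * (suc N * H) ∎
      where
      open ℕ.≤-Reasoning
      H : ℕ
      H = suc (Q + N)
      split : ∀ Q N D v i →
        9 + ((4 + (Q * 16 + 5)) + (6 + (4 + (N * 16 + 5) + (4 + (v + i + 5) + (3 + (4 + (D * 35 + 5))))))) ≡
        ((Q + N) * 16 + D * 35 + 54) + (v + i)
      split = solve-∀
      collect : ∀ N H → 144 * H + (N * (87 * H) + 57 * H * N) ≡ 144 * (suc N * H)
      collect = solve-∀
      rest-split : ∀ y → y * 16 + y * 35 + 54 ≡ y * 51 + 54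
      rest-split = solve-∀
      rest≤ : (Q + N) * 16 + D * 35 + 54 ≤ 54 * H
      rest≤ = begin
        (Q + N) * 16 + D * 35 + 54
          ≤⟨ ℕ.+-monoˡ-≤ 54 (ℕ.+-monoʳ-≤ ((Q + N) * 16)
               (ℕ.*-monoˡ-≤ 35 (ℕ.≤-trans D≤Q (ℕ.m≤m+n Q N)))) ⟩
        (Q + N) * 16 + (Q + N) * 35 + 54  ≡⟨ rest-split (Q + N) ⟩
        (Q + N) * 51 + 54
          ≤⟨ linear-bound (from-yes (51 ℕ.≤? 54)) ℕ.≤-refl ℕ.≤-refl ⟩
        54 * H ∎
      item-split : ∀ Q → 18 + (4 + (Q * 57 + 5)) ≡ Q * 57 + 27
      item-split = solve-∀
      item-time≤ : item-time ≤ 57 * H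
      item-time≤ = ℕ.≤-trans (ℕ.≤-reflexive (item-split Q))
        (linear-bound ℕ.≤-refl (from-yes (27 ℕ.≤? 57)) (ℕ.m≤m+n Q N))
      visit-split : ∀ Q N k →
        24 + (27 + (4 + (N * 26 + k * 0 + 5) + ((4 + (Q * 34 + 5)) + (4 + (Q * 53 + 5))))) ≡
        Q * 87 + N * 26 + 78
      visit-split = solve-∀
      visit-time≤ : visit-time ≤ 87 * H
      visit-time≤ = begin
        visit-time              ≡⟨ visit-split Q N item-time ⟩
        Q * 87 + N * 26 + 78
          ≤⟨ ℕ.+-monoˡ-≤ 78 (ℕ.+-monoʳ-≤ (Q * 87) (ℕ.*-monoʳ-≤ N (from-yes (26 ℕ.≤? 87)))) ⟩
        Q * 87 + N * 87 + 78    ≡⟨ cong (_+ 78) (ℕ.*-distribʳ-+ 87 Q N) ⟨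
        (Q + N) * 87 + 78
          ≤⟨ linear-bound ℕ.≤-refl (from-yes (78 ℕ.≤? 87)) ℕ.≤-refl ⟩
        87 * H                  ∎
      remaining≤ : remaining (λ _ → false) ≤ N
      remaining≤ = ℕ.≤-reflexive (sum-one N)
        where
        sum-one : ∀ n → ℕΣ.sumBelow n (λ _ → 1) ≡ n
        sum-one zero    = refl
        sum-one (suc n) = trans (cong (_+ 1) (sum-one n)) (ℕ.+-comm n 1)

-- Naturals as rationals, and rounding

-- `fromℕ` normalises through a gcd that is stuck on a variable; this exposes numerator and
-- denominator.
fromℕ-mkℚ : ∀ k → fromℕ k ≡ mkℚ (ℤ.+ k) 0 (Coprimality.sym (Coprimality.1-coprimeTo k))
fromℕ-mkℚ k = ℚ.normalize-coprime (Coprimality.sym (Coprimality.1-coprimeTo k))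

fromℕ-mono-≤ : ∀ {k l} → k ≤ l → fromℕ k ℚ.≤ fromℕ l
fromℕ-mono-≤ {k} {l} k≤l = subst₂ ℚ._≤_ (sym (fromℕ-mkℚ k)) (sym (fromℕ-mkℚ l))
  (ℚ.*≤* (ℤ.*-monoʳ-≤-nonNeg (ℤ.+ 1) (ℤ.+≤+ k≤l)))

fromℕ-+ : ∀ k l → fromℕ (k + l) ≡ fromℕ k ℚ.+ fromℕ l
fromℕ-+ k l = sym (trans (cong₂ ℚ._+_ (fromℕ-mkℚ k) (fromℕ-mkℚ l))
  (cong (ℚ._/ 1) (cong₂ ℤ._+_ (ℤ.*-identityʳ (ℤ.+ k)) (ℤ.*-identityʳ (ℤ.+ l)))))

fromℕ-* : ∀ k l → fromℕ (k * l) ≡ fromℕ k ℚ.* fromℕ l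
fromℕ-* k l = sym (trans (cong₂ ℚ._*_ (fromℕ-mkℚ k) (fromℕ-mkℚ l))
  (cong (ℚ._/ 1) (sym (ℤ.pos-* k l))))

0≤fromℕ : ∀ k → 0ℚ ℚ.≤ fromℕ k
0≤fromℕ k = fromℕ-mono-≤ {0} {k} z≤n

round : ℚ → ℕ
round = ⟦ floorᵒ ⟧₁

round-nonNeg : ∀ {x} → 0ℚ ℚ.≤ x → round x ≡ ℤ.∣ ℚ.floor x ∣
round-nonNeg 0≤x = cong (λ x → ℤ.∣ ℚ.floor x ∣) (ℚ.p≤q⇒p⊔q≡q 0≤x)

round-mkℚ : ∀ a d .{c : Coprimality.Coprime a (suc d)} → 0ℚ ℚ.≤ mkℚ (ℤ.+ a) d c → round (mkℚ (ℤ.+ a) d c) ≡ a ℕ./ suc d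
round-mkℚ a d {c} 0≤x = trans (round-nonNeg 0≤x)
  (trans (ℤ.abs-* (ℤ.+ 1) (ℤ.+ (a ℕ./ suc d))) (ℕ.*-identityˡ _))

round-lower : ∀ {x} → 0ℚ ℚ.≤ x → fromℕ (round x) ℚ.≤ x
round-lower {mkℚ (ℤ.+ a) d c} 0≤x = subst (ℚ._≤ mkℚ (ℤ.+ a) d c)
  (sym (trans (cong fromℕ (round-mkℚ a d 0≤x)) (fromℕ-mkℚ (a ℕ./ suc d))))
  (ℚ.*≤* (subst₂ ℤ._≤_ (ℤ.pos-* (a ℕ./ suc d) (suc d)) (sym (ℤ.*-identityʳ (ℤ.+ a)))
    (ℤ.+≤+ (ℕ.m/n*n≤m a (suc d)))))
round-lower {mkℚ ℤ.-[1+ a ] d c} 0≤x = contradiction (ℚ.drop-*≤* 0≤x)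
  λ le → contradiction (subst₂ ℤ._≤_ (ℤ.*-zeroˡ (ℤ.+ suc d)) (ℤ.*-identityʳ ℤ.-[1+ a ]) le) λ ()

-- With `round-lower` this is the universal property of the floor, from which monotonicity and the
-- upper bound follow.
round-greatest : ∀ {x} k → 0ℚ ℚ.≤ x → fromℕ k ℚ.≤ x → k ≤ round x
round-greatest {mkℚ (ℤ.+ a) d c} k 0≤x k≤x = subst (k ≤_) (sym (round-mkℚ a d 0≤x))
  (subst (_≤ a ℕ./ suc d) (ℕ.m*n/n≡m k (suc d)) (ℕ./-monoˡ-≤ (suc d) k*d≤a))
  where
  k*d≤a : k * suc d ≤ a
  k*d≤a = ℤ.drop‿+≤+ (subst₂ ℤ._≤_ (sym (ℤ.pos-* k (suc d))) (ℤ.*-identityʳ (ℤ.+ a))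
    (ℚ.drop-*≤* (subst (ℚ._≤ mkℚ (ℤ.+ a) d c) (fromℕ-mkℚ k) k≤x)))
round-greatest {mkℚ ℤ.-[1+ a ] d c} k 0≤x = contradiction (ℚ.drop-*≤* 0≤x)
  λ le → contradiction (subst₂ ℤ._≤_ (ℤ.*-zeroˡ (ℤ.+ suc d)) (ℤ.*-identityʳ ℤ.-[1+ a ]) le) λ ()

-- With the variable k, since fromℕ (suc (round x)) would unfold to a gcd.
round-upper : ∀ {x} k → 0ℚ ℚ.≤ x → round x ℕ.< k → x ℚ.≤ fromℕ k
round-upper {x} k 0≤x x<k with fromℕ k ℚ.≤? x
... | yes k≤x = contradiction (round-greatest k 0≤x k≤x) (ℕ.<⇒≱ x<k)
... | no k≰x  = ℚ.<⇒≤ (ℚ.≰⇒> k≰x)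

round-mono : ∀ {x y} → 0ℚ ℚ.≤ x → x ℚ.≤ y → round x ≤ round y
round-mono 0≤x x≤y = round-greatest _ (ℚ.≤-trans 0≤x x≤y) (ℚ.≤-trans (round-lower 0≤x) x≤y)

-- Scaling the values

*-nonNeg : ∀ {x y} → 0ℚ ℚ.≤ x → 0ℚ ℚ.≤ y → 0ℚ ℚ.≤ x ℚ.* y
*-nonNeg {x} {y} 0≤x 0≤y = ℚ.nonNegative⁻¹ (x ℚ.* y)
  {{ℚ.nonNeg*nonNeg⇒nonNeg x {{ℚ.nonNegative 0≤x}} y {{ℚ.nonNegative 0≤y}}}}

-- A divisor 0 does occur, when all items of feasible sets are worthless. The totalised quotient 0
-- then makes all profits vanish.
÷₀-spec : ∀ {x v} → 0ℚ ℚ.≤ x → 0ℚ ℚ.≤ v →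
  0ℚ ℚ.≤ x ÷₀ v × ((v ≡ 0ℚ × x ÷₀ v ≡ 0ℚ) ⊎ (0ℚ ℚ.< v × (x ÷₀ v) ℚ.* v ≡ x))
÷₀-spec {x} {v} 0≤x 0≤v with v ℚ.≟ 0ℚ
... | yes v≡0 = ℚ.≤-refl , inj₁ (v≡0 , refl)
... | no v≢0  =
  ℚ.*-cancelʳ-≤-pos v (subst₂ ℚ._≤_ (sym (ℚ.*-zeroˡ v)) (sym quotient) 0≤x) ,
  inj₂ (ℚ.positive⁻¹ v , quotient)
  where
  instance
    v-nonZero : ℚ.NonZero v
    v-nonZero = ℚ.≢-nonZero v≢0
    v-pos : ℚ.Positive v
    v-pos = ℚ.nonNeg∧nonZero⇒pos v {{ℚ.nonNegative 0≤v}}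
  quotient : (x ℚ.÷ v) ℚ.* v ≡ x
  quotient = trans (ℚ.*-assoc x (ℚ.1/ v) v)
    (trans (cong (x ℚ.*_) (ℚ.*-inverseˡ v)) (ℚ.*-identityʳ x))

sumOver-nonNeg : ∀ n S {f} → (∀ j → j ℕ.< n → 0ℚ ℚ.≤ f j) → 0ℚ ℚ.≤ ℚΣ.sumOver n S f
sumOver-nonNeg zero    S 0≤ = ℚ.≤-refl
sumOver-nonNeg (suc n) S 0≤ = ℚ.+-mono-≤ (sumOver-nonNeg n S λ j j<n → 0≤ j (ℕ.m≤n⇒m≤1+n j<n))
  (if-elim (0ℚ ℚ.≤_) (S n) (λ _ → 0≤ n ℕ.≤-refl) (λ _ → ℚ.≤-refl))

-- Here `range` is N / δ and, for positive `v`, `scale` is N / (δ v). Rounding value · `scale` down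
-- amounts to rounding the value down to a multiple of δ v / N.
module Scaling
  (N : ℕ) (value : ℕ → ℚ) (value-nonNeg : ∀ j → j ℕ.< N → 0ℚ ℚ.≤ value j)
  (δ : ℚ) (0<δ : 0ℚ ℚ.< δ) (v range scale : ℚ) (0≤v : 0ℚ ℚ.≤ v)
  (δ*range≡N : δ ℚ.* range ≡ fromℕ N) (0≤range : 0ℚ ℚ.≤ range) (0≤scale : 0ℚ ℚ.≤ scale)
  (scale-spec : (v ≡ 0ℚ × scale ≡ 0ℚ) ⊎ (0ℚ ℚ.< v × scale ℚ.* v ≡ range))
  where

  -- Items above `v` lie in no feasible set. Profit 0 for them keeps the sum of profits, and with it
  -- the table, small.
  scaled : ℕ → ℕ
  scaled j = if does (value j ℚ.≤? v) then round (value j ℚ.* scale) else 0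

  scaled-elim : ∀ (R : ℕ → Set) j →
    (value j ℚ.≤ v → R (round (value j ℚ.* scale))) → (¬ value j ℚ.≤ v → R 0) → R (scaled j)
  scaled-elim R j small large = if-elim R (does (value j ℚ.≤? v))
    (λ vj≤v → small (does-true (value j ℚ.≤? v) vj≤v))
    (λ vj≰v → large (does-false (value j ℚ.≤? v) vj≰v))

  valueOf : ItemSet → ℚ
  valueOf S = ℚΣ.sumOver N S value

  v*scale≤range : v ℚ.* scale ℚ.≤ range
  v*scale≤range = Sum.[
    (λ (v≡0 , _) → subst (λ x → x ℚ.* scale ℚ.≤ range) (sym v≡0)
      (subst (ℚ._≤ range) (sym (ℚ.*-zeroˡ scale)) 0≤range)) ,
    (λ (_ , sv≡r) → ℚ.≤-reflexive (trans (ℚ.*-comm v scale) sv≡r)) ]′ scale-spec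

  scaled≤ : ∀ j → j ℕ.< N → scaled j ≤ round range
  scaled≤ j j<N = scaled-elim (_≤ round range) j
    (λ vj≤v → round-mono (*-nonNeg (value-nonNeg j j<N) 0≤scale)
      (ℚ.≤-trans (ℚ.*-monoʳ-≤-nonNeg scale {{ℚ.nonNegative 0≤scale}} vj≤v) v*scale≤range))
    (λ _ → z≤n)

  sum-scaled≤ : ℕΣ.sumBelow N scaled ≤ N * round range
  sum-scaled≤ = below N scaled≤
    where
    below : ∀ n → (∀ j → j ℕ.< n → scaled j ≤ round range) → ℕΣ.sumBelow n scaled ≤ n * round range
    below zero    _ = z≤n
    below (suc n) ≤r = subst (ℕΣ.sumBelow n scaled + scaled n ≤_) (ℕ.+-comm (n * round range) (round range))
      (ℕ.+-mono-≤ (below n λ j j<n → ≤r j (ℕ.m≤n⇒m≤1+n j<n)) (≤r n ℕ.≤-refl))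

  scaled-lower : ∀ j → j ℕ.< N → fromℕ (scaled j) ℚ.≤ value j ℚ.* scale
  scaled-lower j j<N = scaled-elim (λ k → fromℕ k ℚ.≤ value j ℚ.* scale) j
    (λ _ → round-lower 0≤x) (λ _ → 0≤x)
    where
    0≤x : 0ℚ ℚ.≤ value j ℚ.* scale
    0≤x = *-nonNeg (value-nonNeg j j<N) 0≤scale

  scaled-upper : ∀ j k → j ℕ.< N → value j ℚ.≤ v → scaled j ℕ.< k → value j ℚ.* scale ℚ.≤ fromℕ k
  scaled-upper j k j<N vj≤v = scaled-elim (λ l → l ℕ.< k → value j ℚ.* scale ℚ.≤ fromℕ k) j
    (λ _ → round-upper k (*-nonNeg (value-nonNeg j j<N) 0≤scale))
    (λ vj≰v → contradiction vj≤v vj≰v)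

  value≤valueOf : ∀ S j → j ℕ.< N → S j ≡ true → value j ℚ.≤ valueOf S
  value≤valueOf S j = go N value-nonNeg
    where
    go : ∀ n → (∀ j → j ℕ.< n → 0ℚ ℚ.≤ value j) → j ℕ.< n → S j ≡ true →
      value j ℚ.≤ ℚΣ.sumOver n S value
    go (suc n) 0≤ j≤n j∈S with j ℕ.≟ n
    ... | yes refl = subst₂ ℚ._≤_ (ℚ.+-identityˡ (value j))
      (cong (λ b → ℚΣ.sumOver n S value ℚ.+ (if b then value n else 0ℚ)) (sym j∈S))
      (ℚ.+-monoˡ-≤ (value j) (sumOver-nonNeg n S λ i i<n → 0≤ i (ℕ.m≤n⇒m≤1+n i<n)))
    ... | no j≢n = subst (ℚ._≤ _) (ℚ.+-identityʳ (value j))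
      (ℚ.+-mono-≤ (go n (λ i i<n → 0≤ i (ℕ.m≤n⇒m≤1+n i<n)) (ℕ.≤∧≢⇒< (ℕ.≤-pred j≤n) j≢n) j∈S)
        (if-elim (0ℚ ℚ.≤_) (S n) (λ _ → 0≤ n ℕ.≤-refl) (λ _ → ℚ.≤-refl)))

  sum-lower : ∀ n S → (∀ j → j ℕ.< n → fromℕ (scaled j) ℚ.≤ value j ℚ.* scale) →
    fromℕ (ℕΣ.sumOver n S scaled) ℚ.≤ ℚΣ.sumOver n S value ℚ.* scale
  sum-lower zero    S lower = ℚ.≤-reflexive (sym (ℚ.*-zeroˡ scale))
  sum-lower (suc n) S lower = subst₂ ℚ._≤_
    (sym (fromℕ-+ (ℕΣ.sumOver n S scaled) (if S n then scaled n else 0)))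
    (sym (ℚ.*-distribʳ-+ scale (ℚΣ.sumOver n S value) (if S n then value n else 0ℚ)))
    (ℚ.+-mono-≤ (sum-lower n S λ j j<n → lower j (ℕ.m≤n⇒m≤1+n j<n)) last)
    where
    last : fromℕ (if S n then scaled n else 0) ℚ.≤ (if S n then value n else 0ℚ) ℚ.* scale
    last = bool-elim
      (λ b → fromℕ (if b then scaled n else 0) ℚ.≤ (if b then value n else 0ℚ) ℚ.* scale) (S n)
      (λ _ → lower n ℕ.≤-refl) (λ _ → ℚ.≤-reflexive (sym (ℚ.*-zeroˡ scale)))

  -- Rounding loses at most 1 per item, `n` in all. As in `round-upper`, a variable `k` above
  -- `scaled j` keeps `fromℕ` from unfolding.
  sum-upper : ∀ n S →
    (∀ j k → j ℕ.< n → S j ≡ true → scaled j ℕ.< k → value j ℚ.* scale ℚ.≤ fromℕ k) →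
    ℚΣ.sumOver n S value ℚ.* scale ℚ.≤ fromℕ (ℕΣ.sumOver n S scaled + n)
  sum-upper zero    S upper = ℚ.≤-reflexive (ℚ.*-zeroˡ scale)
  sum-upper (suc n) S upper = subst₂ ℚ._≤_
    (sym (ℚ.*-distribʳ-+ scale (ℚΣ.sumOver n S value) (if S n then value n else 0ℚ)))
    (trans (sym (fromℕ-+ (ℕΣ.sumOver n S scaled + n) (t + 1)))
      (cong fromℕ (solve (ℕΣ.sumOver n S scaled) n t)))
    (ℚ.+-mono-≤ (sum-upper n S λ j k j<n → upper j k (ℕ.m≤n⇒m≤1+n j<n))
      (last (t + 1) (ℕ.≤-reflexive (ℕ.+-comm 1 t))))
    where
    t : ℕ
    t = if S n then scaled n else 0
    solve : ∀ s n t → s + n + (t + 1) ≡ s + t + suc n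
    solve = solve-∀
    last : ∀ k → t ℕ.< k → (if S n then value n else 0ℚ) ℚ.* scale ℚ.≤ fromℕ k
    last k = bool-elim
      (λ b → (if b then scaled n else 0) ℕ.< k → (if b then value n else 0ℚ) ℚ.* scale ℚ.≤ fromℕ k) (S n)
      (λ n∈S → upper n k ℕ.≤-refl n∈S)
      (λ _ _ → subst (ℚ._≤ fromℕ k) (sym (ℚ.*-zeroˡ scale)) (0≤fromℕ k))

  scale-positive : 0 ℕ.< N → 0ℚ ℚ.< v → scale ℚ.* v ≡ range → 0ℚ ℚ.< scale
  scale-positive 0<N 0<v sv≡r = ℚ.*-cancelʳ-<-nonNeg v {{ℚ.nonNegative 0≤v}}
    (subst₂ ℚ._<_ (sym (ℚ.*-zeroˡ v)) (sym sv≡r)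
      (ℚ.*-cancelˡ-<-nonNeg δ {{ℚ.nonNegative (ℚ.<⇒≤ 0<δ)}}
        (subst₂ ℚ._<_ (sym (ℚ.*-zeroʳ δ)) (sym δ*range≡N) 0<fromℕ)))
    where
    0<fromℕ : 0ℚ ℚ.< fromℕ N
    0<fromℕ = ℚ.<-≤-trans (ℚ.positive⁻¹ 1ℚ) (fromℕ-mono-≤ {1} {N} 0<N)

  -- The inequality is proved after multiplication by `scale`. There the rounding loss is `N` = δ ·
  -- `scale` · `v`, which is at most δ · `scale` · value of `T` because `T` is worth at least `v`.
  -- If `v` is 0, then `T` is worthless.
  scaled-approximates : ∀ {S T} → (∀ j → j ℕ.< N → T j ≡ true → value j ℚ.≤ v) →
    v ℚ.≤ valueOf T → ℕΣ.sumOver N T scaled ≤ ℕΣ.sumOver N S scaled →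
    (1ℚ ℚ.- δ) ℚ.* valueOf T ℚ.≤ valueOf S
  scaled-approximates {S} {T} T≤v v≤T pT≤pS = Sum.[ valueless , valuable ]′ scale-spec
    where
    valueless : v ≡ 0ℚ × scale ≡ 0ℚ → (1ℚ ℚ.- δ) ℚ.* valueOf T ℚ.≤ valueOf S
    valueless (v≡0 , _) = subst (ℚ._≤ valueOf S)
      (sym (trans (cong ((1ℚ ℚ.- δ) ℚ.*_) T≡0) (ℚ.*-zeroʳ (1ℚ ℚ.- δ))))
      (sumOver-nonNeg N S value-nonNeg)
      where
      T≡0 : valueOf T ≡ 0ℚ
      T≡0 = ℚΣ.sumOver-ε N value λ j j<N j∈T →
        ℚ.≤-antisym (subst (value j ℚ.≤_) v≡0 (T≤v j j<N j∈T)) (value-nonNeg j j<N)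
    valuable : 0ℚ ℚ.< v × scale ℚ.* v ≡ range → (1ℚ ℚ.- δ) ℚ.* valueOf T ℚ.≤ valueOf S
    valuable (0<v , sv≡r) = ℚ.*-cancelʳ-≤-pos scale {{ℚ.positive (scale-positive (0<N N v≤T) 0<v sv≡r)}}
      (begin
        (1ℚ ℚ.- δ) ℚ.* x ℚ.* scale                    ≡⟨ expand δ x scale ⟩
        x ℚ.* scale ℚ.- δ ℚ.* (scale ℚ.* x)
          ≤⟨ ℚ.+-mono-≤ upper (ℚ.neg-antimono-≤ N≤) ⟩
        fromℕ (ℕΣ.sumOver N S scaled) ℚ.+ fromℕ N ℚ.- fromℕ N
          ≡⟨ cancel (fromℕ (ℕΣ.sumOver N S scaled)) (fromℕ N) ⟩
        fromℕ (ℕΣ.sumOver N S scaled)                 ≤⟨ sum-lower N S scaled-lower ⟩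
        valueOf S ℚ.* scale                           ∎)
      where
      open ℚ.≤-Reasoning
      x : ℚ
      x = valueOf T
      0<N : ∀ n → v ℚ.≤ ℚΣ.sumOver n T value → 0 ℕ.< n
      0<N zero    v≤0 = contradiction (ℚ.<-≤-trans 0<v v≤0) (ℚ.<-irrefl refl)
      0<N (suc n) _   = s≤s z≤n
      expand : ∀ δ x s → (1ℚ ℚ.- δ) ℚ.* x ℚ.* s ≡ x ℚ.* s ℚ.- δ ℚ.* (s ℚ.* x)
      expand = solve 3 (λ δ x s → (con 1ℚ :- δ) :* x :* s := x :* s :- δ :* (s :* x)) refl
        where open +-*-Solver
      cancel : ∀ a b → a ℚ.+ b ℚ.- b ≡ a
      cancel = solve 2 (λ a b → a :+ b :- b := a) refl
        where open +-*-Solver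
      upper : x ℚ.* scale ℚ.≤ fromℕ (ℕΣ.sumOver N S scaled) ℚ.+ fromℕ N
      upper = ℚ.≤-trans (sum-upper N T λ j k j<N j∈T → scaled-upper j k j<N (T≤v j j<N j∈T))
        (subst (fromℕ (ℕΣ.sumOver N T scaled + N) ℚ.≤_) (fromℕ-+ (ℕΣ.sumOver N S scaled) N) (fromℕ-mono-≤ (ℕ.+-monoˡ-≤ N pT≤pS)))
      N≡ : fromℕ N ≡ δ ℚ.* (scale ℚ.* v)
      N≡ = trans (sym δ*range≡N) (cong (δ ℚ.*_) (sym sv≡r))
      N≤ : fromℕ N ℚ.≤ δ ℚ.* (scale ℚ.* x)
      N≤ = subst (ℚ._≤ δ ℚ.* (scale ℚ.* x)) (sym N≡)
        (ℚ.*-monoˡ-≤-nonNeg δ {{ℚ.nonNegative (ℚ.<⇒≤ 0<δ)}} (ℚ.*-monoˡ-≤-nonNeg scale {{ℚ.nonNegative 0≤scale}} v≤T))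

-- Preparation: powers of two and the largest category size

start storePower powers countItem measureCategory measureCategories prepare : Program

-- Capacity + 1 serves as infinity, because a weight above the capacity already means that there is
-- no set.
start =
  put rat #inf (lit 0) (op₂ addᴿ (get rat #cap (lit 0)) (lit 1ℚ)) ⨾
  #counter ≔ lit 0 ⨾
  #power ≔ lit 1 ⨾
  #maxSize ≔ lit 0

storePower =
  put nat #pow (var #counter) (var #power) ⨾
  #power ≔ var #power ⊕ var #power ⨾
  #counter ≔ var #counter ⊕ lit 1

powers = for #k (var #N) storePower

countItem =
  if (get nat #cat (var #b) ⊑ get nat #cat (var #a))
    (if (get nat #cat (var #a) ⊑ get nat #cat (var #b)) (#counter ≔ var #counter ⊕ lit 1) skip)
    skip

measureCategory =
  #counter ≔ lit 0 ⨾
  for #b (var #N) countItem ⨾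
  if (var #counter ⊑ var #maxSize) skip (#maxSize ≔ var #counter)

-- Comparing all pairs of items takes O(N²) steps and again avoids a loop over categories.
measureCategories = for #a (var #N) measureCategory

prepare = start ⨾ powers ⨾ measureCategories

module Preparation
  (N : ℕ) (cat lo up : ℕ → ℕ) (wt : ℕ → ℚ)
  (wt-nonNeg : ∀ j → j ℕ.< N → 0ℚ ℚ.≤ wt j) (B : ℚ)
  where
  open Knapsack N cat lo up wt wt-nonNeg B
  open Maximise N cat lo up wt wt-nonNeg B using (Setting)

  record Input (σ : Memory) : Set where
    field
      N≡   : nats σ #N 0 ≡ N
      cat≡ : ∀ j → nats σ #cat j ≡ cat j
      lo≡  : ∀ i → nats σ #lo i ≡ lo i
      up≡  : ∀ i → nats σ #up i ≡ up i
      wt≡  : ∀ j → rats σ #wt j ≡ wt j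
      cap≡ : rats σ #cap 0 ≡ B

  open Input

  -- The loop variable falls while the exponent has to rise, so a separate counter is kept; the
  -- invariant links the two by their sum `N`.
  run-powers : ∀ {σ} → nats σ #N 0 ≡ N → nats σ #counter 0 ≡ 0 → nats σ #power 0 ≡ 1 →
    Run powers σ (4 + (N * (11 + worstCase storePower) + 5))
      (λ τ → ∀ j → j ℕ.< N → nats τ #pow j ≡ 2 ^ j)
  run-powers {σ} N≡ counter≡ power≡ = run-mono ℕ.≤-refl
    (λ τ (sum≡ , _ , done) j j<N → done j
      (subst (j ℕ.<_) (sym (trans (sym (ℕ.+-identityʳ _)) sum≡)) j<N))
    (run-for-uniform #k (var #N) storePower Inv refl (λ _ _ _ inv → inv)
      body N≡ (cong (_+ N) counter≡ , trans power≡ (cong (2 ^_) (sym counter≡)) ,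
        λ j j<0 → contradiction (subst (j ℕ.<_) counter≡ j<0) λ ()))
    where
    Inv : ℕ → Memory → Set
    Inv i τ = nats τ #counter 0 + i ≡ N × nats τ #power 0 ≡ 2 ^ nats τ #counter 0 ×
      (∀ j → j ℕ.< nats τ #counter 0 → nats τ #pow j ≡ 2 ^ j)
    body : ∀ i τ → i ℕ.< N → nats τ #k 0 ≡ i → Frame powers σ τ → Inv (suc i) τ →
      Run storePower τ (worstCase storePower) (Inv i)
    body i τ i<N _ _ (sum≡ , power≡ , stored) = run-step storePower refl
      ( trans (ℕ.+-assoc c 1 i) sum≡
      , trans (cong₂ _+_ power≡ (trans power≡ (sym (ℕ.+-identityʳ _)))) (cong (2 ^_) (ℕ.+-comm 1 c))
      , λ j j<c+1 → cell-case (_≡ 2 ^ j) c j (λ { refl → power≡ })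
          (λ j≢c → stored j (ℕ.≤∧≢⇒< (ℕ.≤-pred (subst (j ℕ.<_) (ℕ.+-comm c 1) j<c+1)) j≢c)))
      where
      c : ℕ
      c = nats τ #counter 0

  run-countItems : ∀ {σ a} → nats σ #N 0 ≡ N → (∀ j → nats σ #cat j ≡ cat j) → a ℕ.< N → nats σ #a 0 ≡ a → nats σ #counter 0 ≡ 0 →
    Run (for #b (var #N) countItem) σ (4 + (N * (11 + worstCase countItem) + 5))
      (λ τ → nats τ #counter 0 ≡ categorySize (cat a))
  run-countItems {σ} {a} N≡ cat≡ a<N refl counter≡ = run-mono ℕ.≤-refl
    (λ τ count≡ → trans (sym (ℕ.+-identityʳ _)) count≡)
    (run-for-uniform #b (var #N) countItem Inv refl (λ _ _ _ inv → inv) body N≡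
      (cong (_+ categorySize (cat a)) counter≡))
    where
    Inv : ℕ → Memory → Set
    Inv i τ = nats τ #counter 0 + ℕΣ.sumBelow i (belongs (cat a)) ≡ categorySize (cat a)
    body : ∀ i τ → i ℕ.< N → nats τ #b 0 ≡ i → Frame (for #b (var #N) countItem) σ τ → Inv (suc i) τ →
      Run countItem τ (worstCase countItem) (Inv i)
    body i τ i<N refl fr inv = run-step countItem refl
      (if-elim (Inv i) _
        (λ ≤a → if-elim (Inv i) _
          (λ a≤ → trans (ℕ.+-assoc c 1 s) (trans (cong (c +_) (trans (ℕ.+-comm 1 s)
            (cong (λ x → s + indicator x)
              (sym (trans (cong (_≡ᵇ cat a)
                (subst₂ _≡_ cat-i cat-a (ℕ.≤-antisym (does-true (_ ℕ.≤? _) ≤a) (does-true (_ ℕ.≤? _) a≤))))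
                (≡ᵇ-refl (cat a))))))) inv))
          (λ a≰ → skipped λ eq → does-false (_ ℕ.≤? _) a≰ (ℕ.≤-reflexive (sym eq))))
        (λ ≰a → skipped λ eq → does-false (_ ℕ.≤? _) ≰a (ℕ.≤-reflexive eq)))
      where
      c s : ℕ
      c = nats τ #counter 0
      s = ℕΣ.sumBelow i (belongs (cat a))
      cat-i : nats τ #cat i ≡ cat i
      cat-i = trans (fr nat #cat refl i) (cat≡ i)
      cat-a : nats τ #cat (nats τ #a 0) ≡ cat a
      cat-a = trans (cong (nats τ #cat) (fr nat #a refl 0)) (trans (fr nat #cat refl a) (cat≡ a))
      skipped : nats τ #cat i ≢ nats τ #cat (nats τ #a 0) → Inv i τ
      skipped ne = trans (cong (c +_) (sym (trans
        (cong (λ x → s + indicator x) (≢⇒≡ᵇ-false (cat i) (cat a) λ eq → ne (trans cat-i (trans eq (sym cat-a)))))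
        (ℕ.+-identityʳ s)))) inv

  measure-time : ℕ
  measure-time = worstCase (#counter ≔ lit 0) + (4 + (N * (11 + worstCase countItem) + 5) +
    worstCase (if (var #counter ⊑ var #maxSize) skip (#maxSize ≔ var #counter)))

  input-frame : ∀ {σ τ} → Frame measureCategories σ τ → Input σ → Input τ
  input-frame fr inp = record
    { N≡   = trans (fr nat #N refl 0) (N≡ inp)
    ; cat≡ = λ j → trans (fr nat #cat refl j) (cat≡ inp j)
    ; lo≡  = λ j → trans (fr nat #lo refl j) (lo≡ inp j)
    ; up≡  = λ j → trans (fr nat #up refl j) (up≡ inp j)
    ; wt≡  = λ j → trans (fr rat #wt refl j) (wt≡ inp j)
    ; cap≡ = trans (fr rat #cap refl 0) (cap≡ inp)
    }

  run-measureCategories : ∀ {σ n} → Input σ → nats σ #maxSize 0 ≡ 0 →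
    (∀ j → j ℕ.< N → categorySize (cat j) ≤ n) →
    Run measureCategories σ (4 + (N * (11 + measure-time) + 5))
      (λ τ → nats τ #maxSize 0 ≤ n × (∀ j → j ℕ.< N → categorySize (cat j) ≤ nats τ #maxSize 0))
  run-measureCategories {σ} {n} inp maxSize≡ size≤n = run-mono ℕ.≤-refl
    (λ τ (max≤ , ≤max) → max≤ , λ j j<N → ≤max j z≤n j<N)
    (run-for-uniform #a (var #N) measureCategory Inv refl (λ _ _ _ inv → inv) body (N≡ inp)
      (subst (_≤ n) (sym maxSize≡) z≤n , λ j N≤j j<N → contradiction j<N (ℕ.≤⇒≯ N≤j)))
    where
    Inv : ℕ → Memory → Set
    Inv i τ = nats τ #maxSize 0 ≤ n ×
      (∀ j → i ≤ j → j ℕ.< N → categorySize (cat j) ≤ nats τ #maxSize 0)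
    body : ∀ i τ → i ℕ.< N → nats τ #a 0 ≡ i → Frame measureCategories σ τ → Inv (suc i) τ →
      Run measureCategory τ measure-time (Inv i)
    body i τ i<N a≡ fr (max≤n , ≤max) =
      run-bind (run-loopFree (#counter ≔ lit 0) refl) λ { .(write τ nat #counter 0 0) fr₁ refl →
      run-bind (run-countItems {write τ nat #counter 0 0} (N≡ (input-frame fr inp)) (cat≡ (input-frame fr inp)) i<N a≡ refl) λ τ₂ fr₂ counter≡ →
      let max≡ : nats τ₂ #maxSize 0 ≡ nats τ #maxSize 0
          max≡ = fr₂ nat #maxSize refl 0
      in run-step (if (var #counter ⊑ var #maxSize) skip (#maxSize ≔ var #counter)) refl
        (if-elim (Inv i) _
          (λ c≤m → subst (_≤ n) (sym max≡) max≤n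
                 , extend i (nats τ₂ #maxSize 0)
                   (subst (_≤ nats τ₂ #maxSize 0) counter≡ (does-true (_ ℕ.≤? _) c≤m))
                   (λ j i<j j<N → subst (categorySize (cat j) ≤_) (sym max≡) (≤max j i<j j<N)))
          (λ c≰m → subst (_≤ n) (sym counter≡) (size≤n i i<N)
                 , extend i (nats τ₂ #counter 0) (ℕ.≤-reflexive (sym counter≡))
                   (λ j i<j j<N → ℕ.≤-trans (≤max j i<j j<N) (subst (_≤ nats τ₂ #counter 0) max≡
                     (ℕ.<⇒≤ (ℕ.≰⇒> (does-false (_ ℕ.≤? _) c≰m))))))) }
      where
      extend : ∀ i m → categorySize (cat i) ≤ m →
        (∀ j → suc i ≤ j → j ℕ.< N → categorySize (cat j) ≤ m) →
        ∀ j → i ≤ j → j ℕ.< N → categorySize (cat j) ≤ m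
      extend i m here above j i≤j j<N with i ℕ.≟ j
      ... | yes refl = here
      ... | no i≢j   = above j (ℕ.≤∧≢⇒< i≤j i≢j) j<N

  prepare-time : ℕ
  prepare-time = worstCase start + ((4 + (N * (11 + worstCase storePower) + 5)) +
    (4 + (N * (11 + measure-time) + 5)))

  run-prepare : ∀ {σ n} → Input σ → (∀ j → j ℕ.< N → categorySize (cat j) ≤ n) →
    Run prepare σ prepare-time
      (λ τ → ∃[ M ] (M ≤ n × (∀ j → j ℕ.< N → categorySize (cat j) ≤ M) × Setting M τ))
  run-prepare {σ} inp size≤n =
    run-bind (run-loopFree start refl) λ { .(step start σ) fr₁ refl →
    run-bind (run-powers {step start σ} (N≡ inp) refl refl) λ τ₂ fr₂ powers≡ →
    let inp₂ : Input τ₂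
        inp₂ = record
          { N≡   = trans (fr₂ nat #N refl 0) (N≡ inp)
          ; cat≡ = λ j → trans (fr₂ nat #cat refl j) (cat≡ inp j)
          ; lo≡  = λ j → trans (fr₂ nat #lo refl j) (lo≡ inp j)
          ; up≡  = λ j → trans (fr₂ nat #up refl j) (up≡ inp j)
          ; wt≡  = λ j → trans (fr₂ rat #wt refl j) (wt≡ inp j)
          ; cap≡ = trans (fr₂ rat #cap refl 0) (cap≡ inp)
          }
    in run-mono ℕ.≤-refl
      (λ τ (fr₃ , max≤n , ≤max) → nats τ #maxSize 0 , max≤n , ≤max ,
        let inp₃ = input-frame fr₃ inp₂ in record
          { N≡ = N≡ inp₃ ; cat≡ = cat≡ inp₃ ; lo≡ = lo≡ inp₃ ; up≡ = up≡ inp₃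
          ; wt≡ = wt≡ inp₃ ; cap≡ = cap≡ inp₃
          ; B<inf = subst (B ℚ.<_)
              (sym (trans (fr₃ rat #inf refl 0) (trans (fr₂ rat #inf refl 0) (cong (ℚ._+ 1ℚ) (Input.cap≡ inp)))))
              B<B+1
          ; pow≡ = λ j j<N → trans (fr₃ nat #pow refl j) (powers≡ j j<N)
          ; M≡ = refl
          })
      (run-frame (run-measureCategories inp₂ (fr₂ nat #maxSize refl 0) size≤n)) }
    where
    B<B+1 : B ℚ.< B ℚ.+ 1ℚ
    B<B+1 = subst (ℚ._< B ℚ.+ 1ℚ) (ℚ.+-identityʳ B) (ℚ.+-monoʳ-< B (ℚ.positive⁻¹ 1ℚ))

-- The largest value of an item in a feasible set, and the decoding of the result

clearProfit setUnitProfit recordValue testItem startTests testItems : Program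

clearProfit = put nat #profit (var #k) (lit 0)

clearProfits : Program
clearProfits = for #k (var #N) clearProfit

setUnitProfit = put nat #profit (var #j) (lit 1)

recordValue =
  if (lit 1 ⊑ var #bestProfit)
    (if (op₂ leqᴿ (get rat #value (var #j)) (get rat #maxValue (lit 0)))
      skip
      (put rat #maxValue (lit 0) (get rat #value (var #j))))
    skip

testItem = clearProfits ⨾ setUnitProfit ⨾ maximise ⨾ recordValue

-- The profits of a test sum to 1, so base 2 is enough.
startTests =
  #base ≔ lit 2 ⨾
  put rat #maxValue (lit 0) (lit 0ℚ)

testItems = for #j (var #N) testItem

rangeExp : ℚ → Exp rat
rangeExp δ⁻¹ = op₂ mulᴿ (op₁ toRat (var #N)) (lit δ⁻¹)

-- The reciprocal of δ is a literal of the program, which thus depends on ε but not on the instance.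
-- The new base is one more than the bound N · ⌊N / δ⌋ on the sum of the profits.
setScale : ℚ → Program
setScale δ⁻¹ =
  #base ≔ lit 1 ⊕ var #N ⊛ op₁ floorᵒ (rangeExp δ⁻¹) ⨾
  put rat #scale (lit 0) (op₂ divᴿ (rangeExp δ⁻¹) (get rat #maxValue (lit 0)))

scaleItem scaleValues decodeItem decode : Program

scaleItem =
  if (op₂ leqᴿ (get rat #value (var #k)) (get rat #maxValue (lit 0)))
    (put nat #profit (var #k)
      (op₁ floorᵒ (op₂ mulᴿ (get rat #value (var #k)) (get rat #scale (lit 0)))))
    clearProfit

scaleValues = for #k (var #N) scaleItem

decodeItem =
  if (get nat #pow (var #j) ⊑ var #bestMask)
    (put bool #out (var #j) (lit true) ⨾
     #bestMask ≔ var #bestMask ⊖ get nat #pow (var #j))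
    (put bool #out (var #j) (lit false))

decode = for #j (var #N) decodeItem

scheme : ℚ → Program
scheme δ⁻¹ =
  prepare ⨾ startTests ⨾ testItems ⨾ setScale δ⁻¹ ⨾ scaleValues ⨾ maximise ⨾ decode

-- Unit profits and binary decoding

unit : ℕ → ℕ → ℕ
unit j k = indicator (k ≡ᵇ j)

sumOver-unit : ∀ n S j → j ℕ.< n → ℕΣ.sumOver n S (unit j) ≡ indicator (S j)
sumOver-unit n S j j<n = trans
  (ℕΣ.sumBelow-bump n {f = λ _ → 0} {b = j} {x = indicator (S j)} j<n elsewhere here)
  (cong (_+ indicator (S j)) (ℕΣ.sumBelow-ε n λ _ _ → refl))
  where
  elsewhere : ∀ k → k ℕ.< n → k ≢ j → (if S k then unit j k else 0) ≡ 0
  elsewhere k _ k≢j rewrite ≢⇒≡ᵇ-false k j k≢j = if-elim (_≡ 0) (S k) (λ _ → refl) (λ _ → refl)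
  here : (if S j then unit j j else 0) ≡ indicator (S j)
  here rewrite ≡ᵇ-refl j = refl

sumOver-pow : ∀ n S → ℕΣ.sumOver n S (2 ^_) ℕ.< 2 ^ n
sumOver-pow zero    S = s≤s z≤n
sumOver-pow (suc n) S = subst (ℕΣ.sumOver (suc n) S (2 ^_) ℕ.<_)
  (cong (2 ^ n +_) (sym (ℕ.+-identityʳ (2 ^ n))))
  (ℕ.+-mono-<-≤ (sumOver-pow n S)
    (if-elim (_≤ 2 ^ n) (S n) (λ _ → ℕ.≤-refl) (λ _ → z≤n)))

-- Greedy binary expansion from the highest bit: the items below `i` contribute less than 2^i by
-- `sumOver-pow`, so comparing the rest of the code with 2^i reveals whether `i` is in the set.
run-decode : ∀ {N σ} S → nats σ #N 0 ≡ N → (∀ j → j ℕ.< N → nats σ #pow j ≡ 2 ^ j) →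
  nats σ #bestMask 0 ≡ ℕΣ.sumOver N S (2 ^_) →
  Run decode σ (4 + (N * (11 + worstCase decodeItem) + 5))
    (λ τ → ∀ j → j ℕ.< N → bools τ #out j ≡ S j)
run-decode {N} {σ} S N≡ pow≡ mask≡ = run-mono ℕ.≤-refl
  (λ τ (_ , decoded) j j<N → decoded j z≤n j<N)
  (run-for-uniform #j (var #N) decodeItem Inv refl (λ _ _ _ inv → inv) body N≡
    (mask≡ , λ j N≤j j<N → contradiction j<N (ℕ.≤⇒≯ N≤j)))
  where
  Inv : ℕ → Memory → Set
  Inv i τ = nats τ #bestMask 0 ≡ ℕΣ.sumOver i S (2 ^_) ×
    (∀ j → i ≤ j → j ℕ.< N → bools τ #out j ≡ S j)
  body : ∀ i τ → i ℕ.< N → nats τ #j 0 ≡ i → Frame decode σ τ → Inv (suc i) τ →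
    Run decodeItem τ (worstCase decodeItem) (Inv i)
  body i τ i<N refl fr (mask≡ , decoded) = run-step decodeItem refl
    (if-elim (Inv i) _
      (λ pow≤ → taken (does-true (_ ℕ.≤? _) pow≤))
      (λ pow≰ → skipped (does-false (_ ℕ.≤? _) pow≰)))
    where
    s : ℕ
    s = ℕΣ.sumOver i S (2 ^_)
    pow : nats τ #pow i ≡ 2 ^ i
    pow = trans (fr nat #pow refl i) (pow≡ i i<N)
    write-out : ∀ {b} → b ≡ S i → ∀ j → i ≤ j → j ℕ.< N →
      (if i ≡ᵇ j then b else bools τ #out j) ≡ S j
    write-out b≡ j i≤j j<N = cell-case (_≡ S j) i j (λ { refl → b≡ })
      (λ j≢i → decoded j (ℕ.≤∧≢⇒< i≤j (j≢i ∘ sym)) j<N)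
    split : ∀ b → S i ≡ b → nats τ #bestMask 0 ≡ s + (if b then 2 ^ i else 0)
    split b i∈S = trans mask≡ (cong (λ b → s + (if b then 2 ^ i else 0)) i∈S)
    Decoded : Bool → ℕ → Set
    Decoded b m = m ≡ s × (∀ j → i ≤ j → j ℕ.< N → (if i ≡ᵇ j then b else bools τ #out j) ≡ S j)
    taken : nats τ #pow i ≤ nats τ #bestMask 0 →
      Decoded true (nats τ #bestMask 0 ∸ nats τ #pow i)
    taken pow≤ = bool-elim (λ _ → Decoded true (nats τ #bestMask 0 ∸ nats τ #pow i)) (S i)
      (λ i∈S → trans (cong₂ _∸_ (split true i∈S) pow) (ℕ.m+n∸n≡m s (2 ^ i)) , write-out (sym i∈S))
      (λ i∉S → contradiction
        (ℕ.≤-<-trans (subst₂ _≤_ pow (trans (split false i∉S) (ℕ.+-identityʳ s)) pow≤) (sumOver-pow i S))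
        (ℕ.<-irrefl refl))
    skipped : ¬ nats τ #pow i ≤ nats τ #bestMask 0 → Decoded false (nats τ #bestMask 0)
    skipped pow≰ = bool-elim (λ _ → Decoded false (nats τ #bestMask 0)) (S i)
      (λ i∈S → contradiction
        (subst₂ _≤_ (sym pow) (sym (split true i∈S)) (ℕ.m≤n+m (2 ^ i) s)) pow≰)
      (λ i∉S → trans (split false i∉S) (ℕ.+-identityʳ s) , write-out (sym i∉S))

-- The search for the largest value of a usable item

module MaximumValue
  (N : ℕ) (cat lo up : ℕ → ℕ) (wt : ℕ → ℚ)
  (wt-nonNeg : ∀ j → j ℕ.< N → 0ℚ ℚ.≤ wt j) (B : ℚ) (M : ℕ)
  (size≤M : ∀ j → j ℕ.< N → Knapsack.categorySize N cat lo up wt wt-nonNeg B (cat j) ≤ M)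
  (feasible : ∃[ S ] Knapsack.Feasible N cat lo up wt wt-nonNeg B S)
  (value : ℕ → ℚ)
  where
  open Knapsack N cat lo up wt wt-nonNeg B
  open Maximise N cat lo up wt wt-nonNeg B M

  maximise-bound : ℕ → ℕ
  maximise-bound D = 144 * (suc N * suc (suc M * D + N))

  run-maximise-within : ∀ {p D σ} → ℕΣ.sumBelow N p ℕ.< D → Ready p D σ →
    Run maximise σ (maximise-bound D)
      (λ τ → ∃[ S ] (Feasible S × profit p S ≡ nats τ #bestProfit 0 ×
        code S ≡ nats τ #bestMask 0 × (∀ T → Feasible T → profit p T ≤ profit p S)))
  run-maximise-within {p} {D} p<D r =
    run-mono (maximise-time≤ p D p<D size≤M) (λ _ → id) (run-maximise p D p<D size≤M r feasible)

  clear-time test-time : ℕ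
  clear-time = 4 + (N * (11 + worstCase clearProfit) + 5)
  test-time = clear-time + (worstCase setUnitProfit + (maximise-bound 2 + worstCase recordValue))

  run-clearProfits : ∀ {σ} → nats σ #N 0 ≡ N →
    Run clearProfits σ clear-time (λ τ → ∀ k → k ℕ.< N → nats τ #profit k ≡ 0)
  run-clearProfits {σ} N≡ = run-mono ℕ.≤-refl (λ _ inv k → inv k z≤n)
    (run-for-uniform #k (var #N) clearProfit
      (λ i τ → ∀ k → i ≤ k → k ℕ.< N → nats τ #profit k ≡ 0) refl (λ _ _ _ inv → inv)
      (λ i τ i<N i≡ fr inv → run-step clearProfit refl λ k i≤k k<N →
        cell-case (_≡ 0) (nats τ #k 0) k (λ _ → refl)
          (λ k≢ → inv k (ℕ.≤∧≢⇒< i≤k λ i≡k → k≢ (trans (sym i≡k) (sym i≡))) k<N))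
      N≡ (λ k N≤k k<N → contradiction k<N (ℕ.≤⇒≯ N≤k)))

  Possible : ℕ → Set
  Possible j = ∃[ S ] (Feasible S × S j ≡ true)

  -- The origin of `new` is recorded because an upper bound alone would not do: an optimal set must
  -- be worth at least the final value.
  Tested : ℕ → (old new : ℚ) → Set
  Tested j old new =
    (Possible j × value j ℚ.≤ new × old ℚ.≤ new × (new ≡ old ⊎ new ≡ value j)) ⊎
    (¬ Possible j × new ≡ old)

  -- With the indicator of `j` as profit, the best profit is 1 if some feasible set contains `j` and
  -- 0 otherwise.
  run-testItem : ∀ {σ j} → j ℕ.< N → Setting σ → nats σ #base 0 ≡ 2 →
    (∀ k → rats σ #value k ≡ value k) → nats σ #j 0 ≡ j →
    Run testItem σ test-time (λ τ → Tested j (rats σ #maxValue 0) (rats τ #maxValue 0))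
  run-testItem {σ} {j} j<N s base≡ value≡ refl =
    run-bind (run-clearProfits (Setting.N≡ s)) λ τ₁ fr₁ cleared →
    run-bind (run-loopFree setUnitProfit refl) λ { .(step setUnitProfit τ₁) fr₂ refl →
    let j≡ : nats τ₁ #j 0 ≡ j
        j≡ = fr₁ nat #j refl 0
        s₂ = setting-frame setUnitProfit {τ₁} refl fr₂ (setting-frame clearProfits refl fr₁ s)
        ready : Ready (unit j) 2 (step setUnitProfit τ₁)
        ready = record
          { setting = s₂
          ; D≡ = trans (fr₁ nat #base refl 0) base≡
          ; profit≡ = λ k k<N → cell-case (_≡ unit j k) (nats τ₁ #j 0) k
              (λ k≡ → sym (cong indicator (trans (cong (_≡ᵇ j) (trans k≡ j≡)) (≡ᵇ-refl j))))
              (λ k≢ → trans (cleared k k<N)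
                (sym (cong indicator (≢⇒≡ᵇ-false k j λ k≡j → k≢ (trans k≡j (sym j≡))))))
          }
    in run-bind (run-maximise-within unit<2 ready) λ { τ₃ fr₃ (S , S-feasible , profit≡ , _ , best) →
    let max≡ : rats τ₃ #maxValue 0 ≡ rats σ #maxValue 0
        max≡ = trans (fr₃ rat #maxValue refl 0) (fr₁ rat #maxValue refl 0)
        vj≡ : rats τ₃ #value (nats τ₃ #j 0) ≡ value j
        vj≡ = trans (cong (rats τ₃ #value) (trans (fr₃ nat #j refl 0) j≡))
          (trans (fr₃ rat #value refl j) (trans (fr₁ rat #value refl j) (value≡ j)))
        possible : 1 ≤ nats τ₃ #bestProfit 0 → S j ≡ true
        possible 1≤ = indicator-true (subst (1 ≤_) (trans (sym profit≡) (sumOver-unit N S j j<N)) 1≤)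
        impossible : ¬ 1 ≤ nats τ₃ #bestProfit 0 → ¬ Possible j
        impossible 1≰ (T , T-feasible , j∈T) = 1≰ (subst₂ _≤_
          (trans (sumOver-unit N T j j<N) (cong indicator j∈T)) profit≡ (best T T-feasible))
    in run-step recordValue refl
      (if-elim (λ τ → Tested j (rats σ #maxValue 0) (rats τ #maxValue 0)) _
        (λ 1≤ → let j∈S = possible (does-true (_ ℕ.≤? _) 1≤) in
          if-elim (λ τ → Tested j (rats σ #maxValue 0) (rats τ #maxValue 0)) _
            (λ v≤ → inj₁ ((S , S-feasible , j∈S)
              , subst (ℚ._≤ rats τ₃ #maxValue 0) vj≡ (does-true (_ ℚ.≤? _) v≤)
              , ℚ.≤-reflexive (sym max≡) , inj₁ max≡))
            (λ v≰ → inj₁ ((S , S-feasible , j∈S)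
              , ℚ.≤-reflexive (sym vj≡)
              , subst (ℚ._≤ rats τ₃ #value (nats τ₃ #j 0)) max≡
                  (ℚ.<⇒≤ (ℚ.≰⇒> (does-false (_ ℚ.≤? _) v≰)))
              , inj₂ vj≡)))
        (λ 1≰ → inj₂ (impossible (does-false (_ ℕ.≤? _) 1≰) , max≡))) }}
    where
    unit<2 : ℕΣ.sumBelow N (unit j) ℕ.< 2
    unit<2 = s≤s (ℕ.≤-reflexive (sumOver-unit N (λ _ → true) j j<N))
    indicator-true : ∀ {b} → 1 ≤ indicator b → b ≡ true
    indicator-true {true} _ = refl

  -- The value 0 is the initial one, which survives if no usable item has positive value.
  record MaxValue (v : ℚ) : Set where
    field
      attained : v ≡ 0ℚ ⊎ (∃[ j ] (j ℕ.< N × Possible j × v ≡ value j))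
      bound    : ∀ j → j ℕ.< N → Possible j → value j ℚ.≤ v

  run-testItems : ∀ {σ} → Setting σ → nats σ #base 0 ≡ 2 → rats σ #maxValue 0 ≡ 0ℚ →
    (∀ k → rats σ #value k ≡ value k) →
    Run testItems σ (4 + (N * (11 + test-time) + 5)) (λ τ → MaxValue (rats τ #maxValue 0))
  run-testItems {σ} s base≡ max≡ value≡ = run-mono ℕ.≤-refl
    (λ τ (att , bound) → record { attained = att ; bound = λ j j<N → bound j z≤n j<N })
    (run-for-uniform #j (var #N) testItem Inv refl (λ _ _ _ inv → inv) body (Setting.N≡ s)
      (inj₁ max≡ , λ j N≤j j<N → contradiction j<N (ℕ.≤⇒≯ N≤j)))
    where
    Attained : ℚ → Set
    Attained v = v ≡ 0ℚ ⊎ (∃[ j ] (j ℕ.< N × Possible j × v ≡ value j))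
    Inv : ℕ → Memory → Set
    Inv i τ = Attained (rats τ #maxValue 0) ×
      (∀ j → i ≤ j → j ℕ.< N → Possible j → value j ℚ.≤ rats τ #maxValue 0)
    body : ∀ i τ → i ℕ.< N → nats τ #j 0 ≡ i → Frame testItems σ τ → Inv (suc i) τ →
      Run testItem τ test-time (Inv i)
    body i τ i<N i≡ fr (att , bound) = run-mono ℕ.≤-refl
      (λ υ → update-max (rats υ #maxValue 0))
      (run-testItem i<N (setting-frame testItems refl fr s) (trans (fr nat #base refl 0) base≡)
        (λ k → trans (fr rat #value refl k) (value≡ k)) i≡)
      where
      old : ℚ
      old = rats τ #maxValue 0
      update-max : ∀ new → Tested i old new →
        Attained new × (∀ j → i ≤ j → j ℕ.< N → Possible j → value j ℚ.≤ new)
      update-max new (inj₁ (i-possible , vi≤ , old≤ , new≡)) =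
        Sum.[ (λ eq → subst Attained (sym eq) att) , (λ eq → inj₂ (i , i<N , i-possible , eq)) ]′ new≡ ,
        λ j i≤j j<N possible → case-≤ i≤j vi≤ λ i<j → ℚ.≤-trans (bound j i<j j<N possible) old≤
        where
        case-≤ : ∀ {j} → i ≤ j → value i ℚ.≤ new → (i ℕ.< j → value j ℚ.≤ new) → value j ℚ.≤ new
        case-≤ {j} i≤j here above with i ℕ.≟ j
        ... | yes refl = here
        ... | no i≢j   = above (ℕ.≤∧≢⇒< i≤j i≢j)
      update-max new (inj₂ (impossible , refl)) = att , later
        where
        later : ∀ j → i ≤ j → j ℕ.< N → Possible j → value j ℚ.≤ old
        later j i≤j j<N possible with i ℕ.≟ j
        ... | yes refl = contradiction possible impossible
        ... | no i≢j   = bound j (ℕ.≤∧≢⇒< i≤j i≢j) j<N possible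

-- The approximation scheme on arrays

module Approximation
  (N : ℕ) (cat lo up : ℕ → ℕ) (wt : ℕ → ℚ)
  (wt-nonNeg : ∀ j → j ℕ.< N → 0ℚ ℚ.≤ wt j) (B : ℚ)
  (feasible : ∃[ S ] Knapsack.Feasible N cat lo up wt wt-nonNeg B S)
  (value : ℕ → ℚ) (value-nonNeg : ∀ j → j ℕ.< N → 0ℚ ℚ.≤ value j)
  (δ : ℚ) (0<δ : 0ℚ ℚ.< δ)
  where
  open Knapsack N cat lo up wt wt-nonNeg B
  open Preparation N cat lo up wt wt-nonNeg B

  valueOf : ItemSet → ℚ
  valueOf S = ℚΣ.sumOver N S value

  Optimal : ItemSet → Set
  Optimal T = Feasible T × (∀ U → Feasible U → valueOf U ℚ.≤ valueOf T)

  Output : Memory → Set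
  Output τ = ∃[ S ] (Feasible S × (∀ j → j ℕ.< N → bools τ #out j ≡ S j) ×
    (∀ T → Optimal T → (1ℚ ℚ.- δ) ℚ.* valueOf T ℚ.≤ valueOf S))

  module _ (M : ℕ) (size≤M : ∀ j → j ℕ.< N → categorySize (cat j) ≤ M) where
    open Maximise N cat lo up wt wt-nonNeg B M
    open MaximumValue N cat lo up wt wt-nonNeg B M size≤M feasible value

    scale-time decode-time : ℕ
    scale-time = 4 + (N * (11 + worstCase scaleItem) + 5)
    decode-time = 4 + (N * (11 + worstCase decodeItem) + 5)

    module _
      (v range scale : ℚ) (max : MaxValue v) (0≤v : 0ℚ ℚ.≤ v)
      (δ*range≡N : δ ℚ.* range ≡ fromℕ N) (0≤range : 0ℚ ℚ.≤ range) (0≤scale : 0ℚ ℚ.≤ scale)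
      (scale-spec : (v ≡ 0ℚ × scale ≡ 0ℚ) ⊎ (0ℚ ℚ.< v × scale ℚ.* v ≡ range))
      where
      open Scaling N value value-nonNeg δ 0<δ v range scale 0≤v δ*range≡N 0≤range 0≤scale scale-spec
        hiding (valueOf)

      run-scaleValues : ∀ {σ} → nats σ #N 0 ≡ N → (∀ k → rats σ #value k ≡ value k) →
        rats σ #maxValue 0 ≡ v → rats σ #scale 0 ≡ scale →
        Run scaleValues σ scale-time (λ τ → ∀ k → k ℕ.< N → nats τ #profit k ≡ scaled k)
      run-scaleValues {σ} N≡ value≡ max≡ scale≡ = run-mono ℕ.≤-refl (λ _ inv k → inv k z≤n)
        (run-for-uniform #k (var #N) scaleItem Inv refl (λ _ _ _ inv → inv) body N≡
          (λ k N≤k k<N → contradiction k<N (ℕ.≤⇒≯ N≤k)))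
        where
        Inv : ℕ → Memory → Set
        Inv i τ = ∀ k → i ≤ k → k ℕ.< N → nats τ #profit k ≡ scaled k
        body : ∀ i τ → i ℕ.< N → nats τ #k 0 ≡ i → Frame scaleValues σ τ → Inv (suc i) τ →
          Run scaleItem τ (worstCase scaleItem) (Inv i)
        body i τ i<N refl fr inv = run-step scaleItem refl
          (if-elim (Inv i) _
            (λ ≤v → set (round (rats τ #value i ℚ.* rats τ #scale 0))
              (trans (cong₂ (λ x y → round (x ℚ.* y)) vi (trans (fr rat #scale refl 0) scale≡))
                (scaled-elim (λ p → round (value i ℚ.* scale) ≡ p) i (λ _ → refl)
                  (λ ≰v → contradiction (subst₂ ℚ._≤_ vi vmax (does-true (_ ℚ.≤? _) ≤v)) ≰v))))
            (λ ≰v → set 0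
              (scaled-elim (0 ≡_) i
                (λ ≤v → contradiction (subst₂ ℚ._≤_ (sym vi) (sym vmax) ≤v) (does-false (_ ℚ.≤? _) ≰v))
                (λ _ → refl))))
          where
          vi : rats τ #value i ≡ value i
          vi = trans (fr rat #value refl i) (value≡ i)
          vmax : rats τ #maxValue 0 ≡ v
          vmax = trans (fr rat #maxValue refl 0) max≡
          set : ∀ p → p ≡ scaled i → ∀ k → i ≤ k → k ℕ.< N →
            (if i ≡ᵇ k then p else nats τ #profit k) ≡ scaled k
          set p p≡ k i≤k k<N = cell-case (_≡ scaled k) i k (λ { refl → p≡ })
            (λ k≢i → inv k (ℕ.≤∧≢⇒< i≤k (k≢i ∘ sym)) k<N)

      run-scaled : ∀ {σ} → Setting σ → nats σ #base 0 ≡ suc (N * round range) →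
        (∀ k → rats σ #value k ≡ value k) → rats σ #maxValue 0 ≡ v → rats σ #scale 0 ≡ scale →
        Run (scaleValues ⨾ maximise ⨾ decode) σ
          (scale-time + (maximise-bound (suc (N * round range)) + decode-time)) Output
      run-scaled {σ} s base≡ value≡ max≡ scale≡ =
        run-bind (run-scaleValues (Setting.N≡ s) value≡ max≡ scale≡) λ τ₁ fr₁ profit≡ →
        let s₁ = setting-frame scaleValues refl fr₁ s
            ready = record
              { setting = s₁ ; D≡ = trans (fr₁ nat #base refl 0) base≡ ; profit≡ = profit≡ }
        in run-bind (run-maximise-within (s≤s sum-scaled≤) ready)
          λ { τ₂ fr₂ (S , S-feasible , _ , code≡ , best) →
        let s₂ = setting-frame maximise refl fr₂ s₁
        in run-mono ℕ.≤-refl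
          (λ τ₃ out≡ → S , S-feasible , out≡ , λ T (T-feasible , T-optimal) →
            scaled-approximates
              (λ j j<N j∈T → MaxValue.bound max j j<N (T , T-feasible , j∈T))
              (v≤ T T-optimal)
              (best T T-feasible))
          (run-decode S (Setting.N≡ s₂) (Setting.pow≡ s₂) (sym code≡)) }
        where
        v≤ : ∀ T → (∀ U → Feasible U → valueOf U ℚ.≤ valueOf T) → v ℚ.≤ valueOf T
        v≤ T optimal = Sum.[
          (λ v≡0 → subst (ℚ._≤ valueOf T) (sym v≡0) (sumOver-nonNeg N T value-nonNeg)) ,
          (λ (j , j<N , (U , U-feasible , j∈U) , v≡) → subst (ℚ._≤ valueOf T) (sym v≡)
            (ℚ.≤-trans (value≤valueOf U j j<N j∈U) (optimal U U-feasible))) ]′ (MaxValue.attained max)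

    run-setScale : ∀ {σ} δ⁻¹ → nats σ #N 0 ≡ N →
      Run (setScale δ⁻¹) σ (worstCase (setScale δ⁻¹))
        (λ τ → nats τ #base 0 ≡ suc (N * round (fromℕ N ℚ.* δ⁻¹)) ×
          rats τ #scale 0 ≡ (fromℕ N ℚ.* δ⁻¹) ÷₀ rats σ #maxValue 0)
    run-setScale {σ} δ⁻¹ N≡ = run-step (setScale δ⁻¹) refl
      (cong (λ k → suc (k * round (fromℕ k ℚ.* δ⁻¹))) N≡ ,
       cong (λ k → (fromℕ k ℚ.* δ⁻¹) ÷₀ rats σ #maxValue 0) N≡)

    rest-time : ℚ → ℕ
    rest-time δ⁻¹ = worstCase startTests + ((4 + (N * (11 + test-time) + 5)) +
      (worstCase (setScale δ⁻¹) + (scale-time +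
        (maximise-bound (suc (N * round (fromℕ N ℚ.* δ⁻¹))) + decode-time))))

    run-rest : ∀ {σ} δ⁻¹ → 0ℚ ℚ.< δ⁻¹ → δ ℚ.* δ⁻¹ ≡ 1ℚ → Setting σ →
      (∀ k → rats σ #value k ≡ value k) →
      Run (startTests ⨾ testItems ⨾ setScale δ⁻¹ ⨾ scaleValues ⨾ maximise ⨾ decode) σ
        (rest-time δ⁻¹) Output
    run-rest {σ} δ⁻¹ 0<δ⁻¹ inverse s value≡ =
      run-bind (run-loopFree startTests refl) λ { .(step startTests σ) fr₁ refl →
      run-bind (run-testItems (setting-frame startTests {σ} refl fr₁ s) refl refl value≡) λ τ₂ fr₂ max →
      let s₂ = setting-frame testItems refl fr₂ (setting-frame startTests {σ} refl fr₁ s)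
      in run-bind (run-setScale δ⁻¹ (Setting.N≡ s₂)) λ { τ₃ fr₃ (base≡ , scale≡) →
      let 0≤v = max-nonNeg max
          spec = ÷₀-spec 0≤range 0≤v
      in run-scaled (rats τ₂ #maxValue 0) (fromℕ N ℚ.* δ⁻¹) ((fromℕ N ℚ.* δ⁻¹) ÷₀ rats τ₂ #maxValue 0)
          max 0≤v δ*range≡N 0≤range (proj₁ spec) (proj₂ spec)
          (setting-frame (setScale δ⁻¹) refl fr₃ s₂) base≡
          (λ k → trans (fr₃ rat #value refl k) (trans (fr₂ rat #value refl k) (value≡ k)))
          (fr₃ rat #maxValue refl 0) scale≡ }}
      where
      max-nonNeg : ∀ {v} → MaxValue v → 0ℚ ℚ.≤ v
      max-nonNeg max = Sum.[ (λ v≡0 → ℚ.≤-reflexive (sym v≡0)) ,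
        (λ (j , j<N , _ , v≡) → subst (0ℚ ℚ.≤_) (sym v≡) (value-nonNeg j j<N)) ]′ (MaxValue.attained max)
      0≤range : 0ℚ ℚ.≤ fromℕ N ℚ.* δ⁻¹
      0≤range = *-nonNeg (0≤fromℕ N) (ℚ.<⇒≤ 0<δ⁻¹)
      δ*range≡N : δ ℚ.* (fromℕ N ℚ.* δ⁻¹) ≡ fromℕ N
      δ*range≡N = trans (ℚ.*-comm δ (fromℕ N ℚ.* δ⁻¹)) (trans (ℚ.*-assoc (fromℕ N) δ⁻¹ δ)
        (trans (cong (fromℕ N ℚ.*_) (trans (ℚ.*-comm δ⁻¹ δ) inverse)) (ℚ.*-identityʳ (fromℕ N))))

  -- The table height `M` is computed by `prepare`, so it appears existentially; `M ≤ n` later turns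
  -- the time into one in terms of `n`.
  run-scheme : ∀ {σ n} δ⁻¹ → 0ℚ ℚ.< δ⁻¹ → δ ℚ.* δ⁻¹ ≡ 1ℚ → Input σ →
    (∀ k → rats σ #value k ≡ value k) → (∀ j → j ℕ.< N → categorySize (cat j) ≤ n) →
    ∃[ M ] ∃[ size≤M ] (M ≤ n × Run (scheme δ⁻¹) σ (prepare-time + rest-time M size≤M δ⁻¹) Output)
  run-scheme {σ} δ⁻¹ 0<δ⁻¹ inverse inp value≡ size≤n =
    let τ , t , d , t≤ , M , M≤n , size≤M , s = run-prepare inp size≤n
    in M , size≤M , M≤n ,
       run-seq (τ , t , d , t≤ , run-rest M size≤M δ⁻¹ 0<δ⁻¹ inverse s
         (λ k → trans (frame d rat #value refl k) (value≡ k)))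

-- Instances as arrays over ℕ

array-toℕ : ∀ {A : Set} (d : A) {k} (f : Fin k → A) j → array d f (toℕ j) ≡ f j
array-toℕ d {k} f j with toℕ j ℕ.<? k
... | yes j<k = cong f (Fin.fromℕ<-toℕ j j<k)
... | no j≮k  = contradiction (Fin.toℕ<n j) j≮k

array-elim : ∀ {A : Set} (P : A → Set) (d : A) {k} (f : Fin k → A) l →
  (∀ j → P (f j)) → P d → P (array d f l)
array-elim P d {k} f l Pf Pd with l ℕ.<? k
... | yes l<k = Pf (fromℕ< l<k)
... | no _    = Pd

below-elim : ∀ {k} (P : ℕ → Set) → (∀ (j : Fin k) → P (toℕ j)) → ∀ j → j ℕ.< k → P j
below-elim P Pf j j<k = subst P (Fin.toℕ-fromℕ< j<k) (Pf (fromℕ< j<k))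

indicator-card : ∀ {k} (p : Subset k) → ∣ p ∣ ≡ FinSum.sum ℕ.+-0-commutativeMonoid (λ j → indicator (lookup p j))
indicator-card []          = refl
indicator-card (true  ∷ p) = cong suc (indicator-card p)
indicator-card (false ∷ p) = indicator-card p

does-≟-toℕ : ∀ {k} (i j : Fin k) → does (i Fin.≟ j) ≡ (toℕ i ≡ᵇ toℕ j)
does-≟-toℕ i j with i Fin.≟ j
... | yes refl = sym (≡ᵇ-refl (toℕ i))
... | no i≢j   = sym (≢⇒≡ᵇ-false (toℕ i) (toℕ j) (i≢j ∘ Fin.toℕ-injective))

term≤sumBelow : ∀ n (f : ℕ → ℕ) {b} → b ℕ.< n → f b ≤ ℕΣ.sumBelow n f
term≤sumBelow (suc n) f {b} b≤n with b ℕ.≟ n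
... | yes refl = ℕ.m≤n+m (f b) _
... | no b≢n   = ℕ.≤-trans (term≤sumBelow n f (ℕ.≤∧≢⇒< (ℕ.≤-pred b≤n) b≢n)) (ℕ.m≤m+n _ (f n))

module Encoding (I : Instance) where
  open Instance I hiding (Feasible; Optimal)

  cat lo up : ℕ → ℕ
  cat = array 0 (λ j → toℕ (category j))
  lo  = array 0 lower
  up  = array 0 upper

  wt val : ℕ → ℚ
  wt  = array 0ℚ weight
  val = array 0ℚ value

  wt-nonNeg : ∀ j → j ℕ.< N → 0ℚ ℚ.≤ wt j
  wt-nonNeg j _ = array-elim (0ℚ ℚ.≤_) 0ℚ weight j weight-nonNeg ℚ.≤-refl

  val-nonNeg : ∀ j → j ℕ.< N → 0ℚ ℚ.≤ val j
  val-nonNeg j _ = array-elim (0ℚ ℚ.≤_) 0ℚ value j value-nonNeg ℚ.≤-refl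

  open Knapsack N cat lo up wt wt-nonNeg capacity public
  open Preparation N cat lo up wt wt-nonNeg capacity using (Input) public

  cat-toℕ : ∀ j → cat (toℕ j) ≡ toℕ (category j)
  cat-toℕ = array-toℕ 0 (λ j → toℕ (category j))

  encoded-input : Input (input I)
  encoded-input = record
    { N≡ = refl ; cat≡ = λ _ → refl ; lo≡ = λ _ → refl ; up≡ = λ _ → refl
    ; wt≡ = λ _ → refl ; cap≡ = refl }

  Encodes : ItemSet → Subset N → Set
  Encodes S T = ∀ j → lookup T j ≡ S (toℕ j)

  encode : Subset N → ItemSet
  encode T = array false (lookup T)

  encode-encodes : ∀ T → Encodes (encode T) T
  encode-encodes T j = sym (array-toℕ false (lookup T) j)

  tabulate-encodes : ∀ S → Encodes S (tabulate (S ∘ toℕ))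
  tabulate-encodes S = Vec.lookup∘tabulate (S ∘ toℕ)

  lookup-∩-V : ∀ T i j → lookup (T ∩ V i) j ≡ lookup T j ∧ does (category j Fin.≟ i)
  lookup-∩-V T i j = trans (Vec.lookup-zipWith _∧_ j T (V i))
    (cong (lookup T j ∧_) (Vec.lookup∘tabulate (λ j → does (category j Fin.≟ i)) j))

  card-sumBelow : ∀ (p : Subset N) {g} → (∀ j → indicator (lookup p j) ≡ g (toℕ j)) →
    ∣ p ∣ ≡ ℕΣ.sumBelow N g
  card-sumBelow p {g} p≡g = trans (indicator-card p) (ℕΣ.sumBelow-Fin p≡g)

  belongs-toℕ : ∀ i j → indicator (does (category j Fin.≟ i)) ≡ belongs (toℕ i) (toℕ j)
  belongs-toℕ i j = cong indicator (trans (does-≟-toℕ (category j) i)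
    (cong (_≡ᵇ toℕ i) (sym (cat-toℕ j))))

  card-V : ∀ i → ∣ V i ∣ ≡ categorySize (toℕ i)
  card-V i = card-sumBelow (V i) λ j → trans
    (cong indicator (Vec.lookup∘tabulate (λ j → does (category j Fin.≟ i)) j)) (belongs-toℕ i j)

  card-∩-V : ∀ S T → Encodes S T → ∀ i → ∣ T ∩ V i ∣ ≡ count S (toℕ i)
  card-∩-V S T S∼T i = card-sumBelow (T ∩ V i) λ j → trans
    (cong indicator (lookup-∩-V T i j))
    (trans (indicator-∧ (lookup T j) _)
      (cong₂ (λ b x → if b then x else 0) (S∼T j) (belongs-toℕ i j)))
    where
    indicator-∧ : ∀ b c → indicator (b ∧ c) ≡ (if b then indicator c else 0)
    indicator-∧ true  c = refl
    indicator-∧ false c = refl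

  sum-delta : ∀ {k} (c : Fin k) (x : ℚ) →
    FinSum.sum ℚ.+-0-commutativeMonoid (λ i → if does (c Fin.≟ i) then x else 0ℚ) ≡ x
  sum-delta {k} c x = trans
    (ℚΣ.sumBelow-Fin {k} {_} {λ i → if toℕ c ≡ᵇ i then x else 0ℚ}
      (λ i → cong (λ b → if b then x else 0ℚ) (does-≟-toℕ c i)))
    (trans (ℚΣ.sumBelow-bump k {λ _ → 0ℚ} {b = toℕ c} {x} (Fin.toℕ<n c)
        (λ i _ i≢c → cong (λ b → if b then x else 0ℚ) (≢⇒≡ᵇ-false (toℕ c) i (i≢c ∘ sym)))
        (trans (cong (λ b → if b then x else 0ℚ) (≡ᵇ-refl (toℕ c))) (sym (ℚ.+-identityˡ x))))
      (trans (cong (ℚ._+ x) (ℚΣ.sumBelow-ε k λ _ _ → refl)) (ℚ.+-identityˡ x)))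

  -- After exchanging the two sums, the sum over categories is a Kronecker delta, as every item lies
  -- in exactly one category.
  total-sumOver : ∀ S T → Encodes S T → ∀ f → total f T ≡ ℚΣ.sumOver N S (array 0ℚ f)
  total-sumOver S T S∼T f = trans (∑-comm (λ i j → if lookup (T ∩ V i) j then f j else 0ℚ))
    (ℚΣ.sumBelow-Fin λ j → trans
      (sum-cong-≗ (λ i → trans (cong (λ b → if b then f j else 0ℚ) (lookup-∩-V T i j))
        (if-∧ (lookup T j) (does (category j Fin.≟ i)) (f j))))
      (trans (sum-delta (category j) (if lookup T j then f j else 0ℚ))
        (cong₂ (λ b x → if b then x else 0ℚ) (S∼T j) (sym (array-toℕ 0ℚ f j)))))
    where
    open FinSum ℚ.+-0-commutativeMonoid using (∑-comm; sum-cong-≗)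
    if-∧ : ∀ b c (x : ℚ) → (if b ∧ c then x else 0ℚ) ≡ (if c then (if b then x else 0ℚ) else 0ℚ)
    if-∧ true  c     x = refl
    if-∧ false true  x = refl
    if-∧ false false x = refl

  encode-feasible : ∀ S T → Encodes S T → Instance.Feasible I T → Feasible S
  encode-feasible S T S∼T (bounds , T≤) =
    below-elim (λ j → InBounds S (cat j)) (λ j → subst (InBounds S) (sym (cat-toℕ j))
      (subst₂ (λ l u → l ≤ count S (toℕ (category j)) × count S (toℕ (category j)) ≤ u)
        (sym (array-toℕ 0 lower (category j))) (sym (array-toℕ 0 upper (category j)))
        (subst (λ c → lower (category j) ≤ c × c ≤ upper (category j))
          (card-∩-V S T S∼T (category j)) (bounds (category j))))) ,
    subst (ℚ._≤ capacity) (total-sumOver S T S∼T weight) T≤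

  -- In a category without items every set has count 0, so its bounds hold for `T` because they hold
  -- for the given feasible `U`.
  decode-feasible : ∀ S T → ∃ (Instance.Feasible I) → Encodes S T → Feasible S →
    Instance.Feasible I T
  decode-feasible S T (U , U-feasible) S∼T (bounds , S≤) =
    bounds′ , subst (ℚ._≤ capacity) (sym (total-sumOver S T S∼T weight)) S≤
    where
    unused : ∀ i → (∀ j → category j ≢ i) → ∀ S → count S (toℕ i) ≡ 0
    unused i none S = ℕΣ.sumOver-ε N {S} (belongs (toℕ i)) λ j j<N _ →
      below-elim (λ j → belongs (toℕ i) j ≡ 0)
        (λ j → trans (sym (belongs-toℕ i j)) (cong indicator (dec-false (category j Fin.≟ i) (none j)))) j j<N
    bounds′ : ∀ i → lower i ≤ ∣ T ∩ V i ∣ × ∣ T ∩ V i ∣ ≤ upper i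
    bounds′ i with Fin.any? (λ j → category j Fin.≟ i)
    ... | yes (j , refl) = subst (λ c → lower i ≤ c × c ≤ upper i) (sym (card-∩-V S T S∼T i))
      (subst₂ (λ l u → l ≤ count S (toℕ i) × count S (toℕ i) ≤ u)
        (array-toℕ 0 lower i) (array-toℕ 0 upper i)
        (subst (InBounds S) (cat-toℕ j) (bounds (toℕ j) (Fin.toℕ<n j))))
    ... | no none = subst (λ c → lower i ≤ c × c ≤ upper i)
      (trans (card-∩-V (encode U) U (encode-encodes U) i)
        (trans (unused i (λ j j∈i → none (j , j∈i)) (encode U))
          (sym (trans (card-∩-V S T S∼T i) (unused i (λ j j∈i → none (j , j∈i)) S)))))
      (proj₁ U-feasible i)

  size≤n : ∀ j → j ℕ.< N → categorySize (cat j) ≤ n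
  size≤n = below-elim (λ j → categorySize (cat j) ≤ n) λ j →
    subst (_≤ n) (trans (card-V (category j)) (cong categorySize (sym (cat-toℕ j))))
      (All.lookup (xs≤max 0 (map (λ i → ∣ V i ∣) (allFin m)))
        (∈-map⁺ (λ i → ∣ V i ∣) (∈-allFin (category j))))

  1≤n : 1 ≤ N → 1 ≤ n
  1≤n 1≤N = ℕ.≤-trans
    (ℕ.≤-trans (ℕ.≤-reflexive (sym (cong indicator (≡ᵇ-refl (cat 0)))))
      (term≤sumBelow N (belongs (cat 0)) 1≤N))
    (size≤n 0 1≤N)

-- Bounding the running time

module Monomials {n N : ℕ} (1≤n : 1 ≤ n) (1≤N : 1 ≤ N) where

  -- Since `n` and `N` are at least 1, all lower monomials of the running time are absorbed by this
  -- one.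
  X : ℕ
  X = n * (N * (N * N))

  x≤N*x : ∀ x → x ≤ N * x
  x≤N*x x = subst (_≤ N * x) (ℕ.*-identityˡ x) (ℕ.*-monoˡ-≤ x 1≤N)

  x≤n*x : ∀ x → x ≤ n * x
  x≤n*x x = subst (_≤ n * x) (ℕ.*-identityˡ x) (ℕ.*-monoˡ-≤ x 1≤n)

  NNN≤X : N * (N * N) ≤ X
  NNN≤X = x≤n*x (N * (N * N))
  NN≤X : N * N ≤ X
  NN≤X = ℕ.≤-trans (x≤N*x (N * N)) NNN≤X
  N≤X : N ≤ X
  N≤X = ℕ.≤-trans (x≤N*x N) NN≤X
  1≤X : 1 ≤ X
  1≤X = ℕ.≤-trans 1≤N N≤X
  nNN≤X : n * (N * N) ≤ X
  nNN≤X = ℕ.*-monoʳ-≤ n (x≤N*x (N * N))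
  nN≤X : n * N ≤ X
  nN≤X = ℕ.≤-trans (ℕ.*-monoʳ-≤ n (x≤N*x N)) nNN≤X

  -- Each successor is bounded by doubling `n` or `N`; the two factors 2 give 576 = 144 · 4.
  maximise≤ : ∀ {M} D → M ≤ n →
    144 * (suc N * suc (suc M * D + N)) ≤ 576 * (n * N * D) + 576 * (N * N)
  maximise≤ {M} D M≤n = begin
    144 * (suc N * suc (suc M * D + N))
      ≤⟨ ℕ.*-monoʳ-≤ 144 (ℕ.*-mono-≤ (ℕ.+-monoˡ-≤ N 1≤N)
           (ℕ.≤-trans (ℕ.≤-reflexive (sym (ℕ.+-suc (suc M * D) N)))
             (ℕ.+-mono-≤ (ℕ.*-monoˡ-≤ D (ℕ.+-mono-≤ 1≤n M≤n)) (ℕ.+-monoˡ-≤ N 1≤N)))) ⟩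
    144 * ((N + N) * ((n + n) * D + (N + N)))   ≡⟨ solve n N D ⟩
    576 * (n * N * D) + 576 * (N * N)           ∎
    where
    open ℕ.≤-Reasoning
    solve : ∀ n N D → 144 * ((N + N) * ((n + n) * D + (N + N))) ≡ 576 * (n * N * D) + 576 * (N * N)
    solve = solve-∀

  -- `E` will be ⌊N / δ⌋, the only place where δ enters, so its monomial is kept apart. The other
  -- coefficients 89, 172, 626, 576, 576 and 1152 sum to 3191.
  total≤ : ∀ {M} E → M ≤ n →
    89 + (N * 172 + (N * N) * 50) + N * (144 * (suc N * suc (suc M * 2 + N))) +
      144 * (suc N * suc (suc M * suc (N * E) + N)) ≤
    3191 * X + 576 * (n * (N * N) * E)
  total≤ {M} E M≤n = begin
    89 + (N * 172 + (N * N) * 50) + N * (144 * (suc N * suc (suc M * 2 + N))) +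
      144 * (suc N * suc (suc M * suc (N * E) + N))
      ≤⟨ ℕ.+-mono-≤ (ℕ.+-monoʳ-≤ (89 + (N * 172 + (N * N) * 50))
           (ℕ.*-monoʳ-≤ N (maximise≤ {M} 2 M≤n))) (maximise≤ {M} (suc (N * E)) M≤n) ⟩
    89 + (N * 172 + (N * N) * 50) + N * (576 * (n * N * 2) + 576 * (N * N)) +
      (576 * (n * N * suc (N * E)) + 576 * (N * N))
      ≡⟨ solve n N E ⟩
    89 * 1 + 172 * N + 626 * (N * N) + 576 * (N * (N * N)) + 576 * (n * N) + 1152 * (n * (N * N)) +
      576 * (n * (N * N) * E)
      ≤⟨ ℕ.+-monoˡ-≤ (576 * (n * (N * N) * E))
           (ℕ.+-mono-≤ (ℕ.+-mono-≤ (ℕ.+-mono-≤ (ℕ.+-mono-≤ (ℕ.+-mono-≤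
             (ℕ.*-monoʳ-≤ 89 1≤X) (ℕ.*-monoʳ-≤ 172 N≤X)) (ℕ.*-monoʳ-≤ 626 NN≤X))
             (ℕ.*-monoʳ-≤ 576 NNN≤X)) (ℕ.*-monoʳ-≤ 576 nN≤X)) (ℕ.*-monoʳ-≤ 1152 nNN≤X)) ⟩
    89 * X + 172 * X + 626 * X + 576 * X + 576 * X + 1152 * X + 576 * (n * (N * N) * E)
      ≡⟨ cong (_+ 576 * (n * (N * N) * E)) (collect X) ⟩
    3191 * X + 576 * (n * (N * N) * E) ∎
    where
    open ℕ.≤-Reasoning
    solve : ∀ n N E →
      89 + (N * 172 + (N * N) * 50) + N * (576 * (n * N * 2) + 576 * (N * N)) +
        (576 * (n * N * suc (N * E)) + 576 * (N * N)) ≡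
      89 * 1 + 172 * N + 626 * (N * N) + 576 * (N * (N * N)) + 576 * (n * N) + 1152 * (n * (N * N)) +
        576 * (n * (N * N) * E)
    solve = solve-∀
    collect : ∀ X → 89 * X + 172 * X + 626 * X + 576 * X + 576 * X + 1152 * X ≡ 3191 * X
    collect = solve-∀

-- One factor δ turns `E` into `N`; the other is dropped because δ ≤ 1.
scale-bound : ∀ {t a b c X W E N δ} → 0ℚ ℚ.≤ δ → δ ℚ.≤ 1ℚ → fromℕ E ℚ.* δ ℚ.≤ fromℕ N →
  t ≤ a * X + b * (W * E) → W * N ≡ X → a + b ≡ c →
  fromℕ t ℚ.* (δ ℚ.* δ) ℚ.≤ fromℕ (c * X)
scale-bound {t} {a} {b} {c} {X} {W} {E} {N} {δ} 0≤δ δ≤1 Eδ≤N t≤ WN≡X a+b≡c = begin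
  fromℕ t ℚ.* (δ ℚ.* δ)
    ≤⟨ ℚ.*-monoʳ-≤-nonNeg (δ ℚ.* δ) {{ℚ.nonNegative (*-nonNeg 0≤δ 0≤δ)}} (fromℕ-mono-≤ t≤) ⟩
  fromℕ (a * X + b * (W * E)) ℚ.* (δ ℚ.* δ)
    ≡⟨ cong (ℚ._* (δ ℚ.* δ)) (trans (fromℕ-+ (a * X) (b * (W * E)))
         (cong (fromℕ (a * X) ℚ.+_) (trans (cong fromℕ (sym (ℕ.*-assoc b W E))) (fromℕ-* (b * W) E)))) ⟩
  (fromℕ (a * X) ℚ.+ fromℕ (b * W) ℚ.* fromℕ E) ℚ.* (δ ℚ.* δ)
    ≡⟨ regroup (fromℕ (a * X)) (fromℕ (b * W)) (fromℕ E) δ ⟩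
  (fromℕ (a * X) ℚ.* δ ℚ.+ fromℕ (b * W) ℚ.* (fromℕ E ℚ.* δ)) ℚ.* δ
    ≤⟨ ℚ.*-monoʳ-≤-nonNeg δ {{ℚ.nonNegative 0≤δ}} (ℚ.+-mono-≤
         (shrink (0≤fromℕ (a * X)))
         (ℚ.*-monoˡ-≤-nonNeg (fromℕ (b * W)) {{ℚ.nonNegative (0≤fromℕ (b * W))}} Eδ≤N)) ⟩
  (fromℕ (a * X) ℚ.+ fromℕ (b * W) ℚ.* fromℕ N) ℚ.* δ
    ≡⟨ cong (ℚ._* δ) (sym (trans (fromℕ-+ (a * X) (b * W * N))
         (cong (fromℕ (a * X) ℚ.+_) (fromℕ-* (b * W) N)))) ⟩
  fromℕ (a * X + b * W * N) ℚ.* δ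
    ≤⟨ shrink (0≤fromℕ (a * X + b * W * N)) ⟩
  fromℕ (a * X + b * W * N)
    ≡⟨ cong fromℕ (trans (cong (a * X +_) (trans (ℕ.*-assoc b W N) (cong (b *_) WN≡X)))
         (trans (sym (ℕ.*-distribʳ-+ X a b)) (cong (_* X) a+b≡c))) ⟩
  fromℕ (c * X) ∎
  where
  open ℚ.≤-Reasoning
  regroup : ∀ x w e d → (x ℚ.+ w ℚ.* e) ℚ.* (d ℚ.* d) ≡ (x ℚ.* d ℚ.+ w ℚ.* (e ℚ.* d)) ℚ.* d
  regroup = solve 4 (λ x w e d → (x :+ w :* e) :* (d :* d) := (x :* d :+ w :* (e :* d)) :* d) refl
    where open +-*-Solver
  shrink : ∀ {x} → 0ℚ ℚ.≤ x → x ℚ.* δ ℚ.≤ x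
  shrink {x} 0≤x = subst (x ℚ.* δ ℚ.≤_) (ℚ.*-identityʳ x)
    (ℚ.*-monoˡ-≤-nonNeg x {{ℚ.nonNegative 0≤x}} δ≤1)

-- Transfer to instances and the final time bound

module Solution
  (I : Instance) (feasible : ∃ (Instance.Feasible I)) (ε δ δ⁻¹ : ℚ)
  (0<δ : 0ℚ ℚ.< δ) (δ≤1 : δ ℚ.≤ 1ℚ) (δ≤ε : δ ℚ.≤ ε)
  (0<δ⁻¹ : 0ℚ ℚ.< δ⁻¹) (inverse : δ ℚ.* δ⁻¹ ≡ 1ℚ)
  where
  open Instance I using (N; n; totalValue; Approximate) renaming (value to valueᴵ)
  open Encoding I
  open Preparation N cat lo up wt wt-nonNeg (Instance.capacity I) using (prepare-time)

  feasible-set : ∃[ S ] Feasible S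
  feasible-set =
    let U , U-feasible = feasible
    in encode U , encode-feasible (encode U) U (encode-encodes U) U-feasible

  open Approximation N cat lo up wt wt-nonNeg (Instance.capacity I) feasible-set
    val val-nonNeg δ 0<δ

  -- Passing from ε to δ ≤ ε strengthens the guarantee, values being non-negative. An optimal subset
  -- is optimal among item sets too, since every competitor can be tabulated into a subset.
  output-approximate : ∀ {σ} → Output σ → Approximate ε (output I σ)
  output-approximate {σ} (S , S-feasible , out≡ , optimal) =
    decode-feasible S (output I σ) feasible out-encodes S-feasible , bound
    where
    out-encodes : Encodes S (output I σ)
    out-encodes j = trans (Vec.lookup∘tabulate (λ j → bools σ 0 (toℕ j)) j)
      (out≡ (toℕ j) (Fin.toℕ<n j))
    bound : ∀ T → Instance.Optimal I T → (1ℚ ℚ.- ε) ℚ.* totalValue T ℚ.≤ totalValue (output I σ)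
    bound T (T-feasible , T-optimal) = begin
      (1ℚ ℚ.- ε) ℚ.* totalValue T  ≡⟨ cong ((1ℚ ℚ.- ε) ℚ.*_) T≡ ⟩
      (1ℚ ℚ.- ε) ℚ.* x
        ≤⟨ ℚ.*-monoʳ-≤-nonNeg x {{ℚ.nonNegative 0≤x}} (ℚ.+-monoʳ-≤ 1ℚ (ℚ.neg-antimono-≤ δ≤ε)) ⟩
      (1ℚ ℚ.- δ) ℚ.* x
        ≤⟨ optimal (encode T) (encode-feasible (encode T) T (encode-encodes T) T-feasible , encoded-optimal) ⟩
      valueOf S                    ≡⟨ sym (total-sumOver S (output I σ) out-encodes valueᴵ) ⟩
      totalValue (output I σ)      ∎
      where
      open ℚ.≤-Reasoning
      x : ℚ
      x = valueOf (encode T)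
      0≤x : 0ℚ ℚ.≤ x
      0≤x = sumOver-nonNeg N (encode T) val-nonNeg
      T≡ : totalValue T ≡ x
      T≡ = total-sumOver (encode T) T (encode-encodes T) valueᴵ
      encoded-optimal : ∀ U → Feasible U → valueOf U ℚ.≤ x
      encoded-optimal U U-feasible = subst₂ ℚ._≤_
        (total-sumOver U (tabulate (U ∘ toℕ)) (tabulate-encodes U) valueᴵ) T≡
        (T-optimal (tabulate (U ∘ toℕ))
          (decode-feasible U (tabulate (U ∘ toℕ)) feasible (tabulate-encodes U) U-feasible))

  range : ℚ
  range = fromℕ N ℚ.* δ⁻¹

  round-range*δ≤N : fromℕ (round range) ℚ.* δ ℚ.≤ fromℕ N
  round-range*δ≤N = ℚ.≤-trans
    (ℚ.*-monoʳ-≤-nonNeg δ {{ℚ.nonNegative (ℚ.<⇒≤ 0<δ)}}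
      (round-lower (*-nonNeg (0≤fromℕ N) (ℚ.<⇒≤ 0<δ⁻¹))))
    (ℚ.≤-reflexive (trans (ℚ.*-assoc (fromℕ N) δ⁻¹ δ)
      (trans (cong (fromℕ N ℚ.*_) (trans (ℚ.*-comm δ⁻¹ δ) inverse)) (ℚ.*-identityʳ (fromℕ N)))))

  -- The left side is the computed form of `prepare-time` + `rest-time`, with `m₁` for one test run
  -- of `maximise` and `m₂` for the final run on the scaled values.
  time-split : ∀ N m₁ m₂ →
    15 + ((4 + (N * 29 + 5)) + (4 + (N * (11 + (3 + ((4 + (N * 35 + 5)) + 11))) + 5))) +
    (6 + ((4 + (N * (11 + ((4 + (N * 15 + 5)) + (4 + (m₁ + 19)))) + 5)) +
      (23 + ((4 + (N * 32 + 5)) + (m₂ + (4 + (N * 34 + 5))))))) ≡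
    89 + (N * 172 + (N * N) * 50) + N * m₁ + m₂
  time-split = solve-∀

  time-bound : ∀ {M t c} → 3191 + 576 ≡ c → M ≤ n → 1 ≤ N →
    t ≤ 89 + (N * 172 + (N * N) * 50) + N * (144 * (suc N * suc (suc M * 2 + N))) +
      144 * (suc N * suc (suc M * suc (N * round range) + N)) →
    fromℕ t ℚ.* (δ ℚ.* δ) ℚ.≤ fromℕ (c * (n * N ^ 3))
  time-bound {M} {t} {c} c≡ M≤n 1≤N t≤ =
    scale-bound {t} {3191} {576} {c} {n * N ^ 3} {n * (N * N)} {round range} {N} {δ}
      (ℚ.<⇒≤ 0<δ) δ≤1 round-range*δ≤N
      (ℕ.≤-trans t≤
        (subst (λ x → 89 + (N * 172 + (N * N) * 50) + N * (144 * (suc N * suc (suc M * 2 + N))) +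
            144 * (suc N * suc (suc M * suc (N * round range) + N)) ≤
            3191 * x + 576 * (n * (N * N) * round range)) (cong (n *_) (cube N))
          (Monomials.total≤ (1≤n 1≤N) 1≤N {M} (round range) M≤n)))
      (trans (ℕ.*-assoc n (N * N) N) (cong (n *_) (trans (ℕ.*-assoc N N N) (cube N)))) c≡
    where
    cube : ∀ N → N * (N * N) ≡ N ^ 3
    cube N = cong (λ x → N * (N * x)) (sym (ℕ.*-identityʳ N))

  Solves : ℕ → Set
  Solves c = ∃[ σ ] ∃[ t ]
    (⟨ scheme δ⁻¹ , input I ⟩⇓⟨ σ , t ⟩ × Approximate ε (output I σ) ×
      (1 ≤ N → fromℕ t ℚ.* (δ ℚ.* δ) ℚ.≤ fromℕ (c * (n * N ^ 3))))

  scheme-solves : ∀ {c} → 3191 + 576 ≡ c → Solves c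
  scheme-solves {c} c≡ = conclude (run-scheme {input I} δ⁻¹ 0<δ⁻¹ inverse encoded-input (λ _ → refl) size≤n)
    where
    conclude : ∃[ M ] ∃[ size≤M ] (M ≤ n ×
      Run (scheme δ⁻¹) (input I) (prepare-time + rest-time M size≤M δ⁻¹) Output) → Solves c
    conclude (M , size≤M , M≤n , σ , t , d , t≤ , out) = σ , t , d , output-approximate {σ} out , λ 1≤N →
       time-bound {M} c≡ M≤n 1≤N (ℕ.≤-trans t≤ (ℕ.≤-reflexive
         (time-split N (144 * (suc N * suc (suc M * 2 + N)))
           (144 * (suc N * suc (suc M * suc (N * round range) + N))))))

theorem3p1 : ∃[ c ] ((ε : ℚ) → 0ℚ < ε →
    ∃[ P ] ((I : Instance) → ∃ (Instance.Feasible I) →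
    ∃[ σ ] ∃[ t ]
    (⟨ P , input I ⟩⇓⟨ σ , t ⟩ ×
    Instance.Approximate I ε (output I σ) ×
    (1 ≤ Instance.N I → WithinTime I c ε t))))
-- 3767 = 3191 + 576, the two coefficients of `total≤`.
theorem3p1 = 3767 , λ ε 0<ε →
  let δ = 1ℚ ℚ.⊓ ε
      0<δ = Sum.[ (λ δ≡1 → subst (0ℚ ℚ.<_) (sym δ≡1) (ℚ.positive⁻¹ 1ℚ))
                , (λ δ≡ε → subst (0ℚ ℚ.<_) (sym δ≡ε) 0<ε) ]′ (ℚ.⊓-sel 1ℚ ε)
      δ⁻¹ , 0<δ⁻¹ , inverse = positive-inverse δ 0<δ
  in scheme δ⁻¹ , λ I feasible →
     Solution.scheme-solves I feasible ε δ δ⁻¹ 0<δ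
       (ℚ.p⊓q≤p 1ℚ ε) (ℚ.p⊓q≤q 1ℚ ε) 0<δ⁻¹ inverse refl
  where
  positive-inverse : ∀ x → 0ℚ ℚ.< x → ∃[ y ] (0ℚ ℚ.< y × x ℚ.* y ≡ 1ℚ)
  positive-inverse x 0<x =
    (ℚ.1/ x) {{ℚ.pos⇒nonZero x {{x-pos}}}} ,
    ℚ.positive⁻¹ _ {{ℚ.1/pos⇒pos x {{x-pos}}}} ,
    ℚ.*-inverseʳ x {{ℚ.pos⇒nonZero x {{x-pos}}}}
    where
    x-pos : ℚ.Positive x
    x-pos = ℚ.positive 0<x
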